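{- Let $1\le r<n$ and let $i,j$ be integers with $1\le i\le n-r$ and $1\le j\le r$. Set $a:=\min(n-r-i,\,r-j)$ and $b:=\min(i,j)$. Let $\Lambda$ be the ring of symmetric functions with integer coefficients, $I_{r,n-r}$ the $\mathbb Z$-span of the Schur functions $s_\lambda$ with $\lambda\not\subseteq (n-r)^r$ (an ideal), and let $J$ be the ideal of $\Lambda/I_{r,n-r}$ which is the $\mathbb Z$-span of the images of $s_\mu$ with $i^j\subseteq\mu\subseteq(n-r)^r$. Then $J$ is generated as an ideal of $\Lambda/I_{r,n-r}$ by $\{s_\mu: i^j\subseteq\mu\subseteq((i+a)^b,i^{j-b})\}$. Alternatively, $J$ is generated by $\{s_\mu: i^j\subseteq\mu\subseteq(i^j,b^a)\}$.
   Context: Partitions are identified with Young diagrams; $\lambda\subseteq\mu$ means $\lambda_k\le\mu_k$ for all $k$. $c^d$ denotes the rectangular partition with $d$ parts equal to $c$; $((i+a)^b,i^{j-b})$ is the partition with $b$ parts equal to $i+a$ followed by $j-b$ parts equal to $i$; $(i^j,b^a)$ is $j$ parts equal to $i$ followed by $a$ parts equal to $b$. Geometric meaning: $\Lambda/I_{r,n-r}\cong H^\star(\mathrm{Gr}(r,\mathbb C^n),\mathbb Z)$, and for the bigrassmannian $v=v_{r,s,t,n}\in S_n$ (with $i=s-t+1$, $j=r-t+1$, Schubert polynomial $s_{i^j}(x_1,\ldots,x_r)$), $J$ is the ideal $J_v=\mathbb Z$-span$\{\sigma_u:u\ge v\}$ intersected with this Grassmannian cohomology. -}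

module Defs where

open import Data.Nat as ℕ using (ℕ; zero; suc; _≤_; _∸_; _≤ᵇ_)
open import Data.Nat.Properties using () renaming (_≟_ to _≟ℕ_)
open import Data.Integer as ℤ using (ℤ; 0ℤ; 1ℤ)
open import Data.List using (List; []; _∷_; [_]; map; concatMap; upTo; replicate; _++_)
open import Data.Nat.ListAction using (sum)
open import Data.List.Relation.Unary.All using (All)
open import Data.Vec using (Vec; []; _∷_; zipWith)
open import Data.Vec.Properties using (≡-dec)
open import Data.Product using (Σ; _×_; _,_)
open import Data.Bool using (if_then_else_)
open import Relation.Nullary using (¬_)
open import Relation.Nullary.Decidable using (⌊_⌋)
open import Relation.Binary.PropositionalEquality using (_≡_)

at : List ℕ → ℕ → ℕ
at []       _       = 0
at (x ∷ _)  zero    = x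
at (_ ∷ xs) (suc k) = at xs k

IsPartition : List ℕ → Set
IsPartition l = All (1 ≤_) l × (∀ k → at l (suc k) ≤ at l k)

_⊆ₚ_ : List ℕ → List ℕ → Set
l ⊆ₚ m = ∀ k → at l k ≤ at m k

rect : ℕ → ℕ → List ℕ
rect c d = replicate d c

Poly : ℕ → Set
Poly N = List (ℤ × Vec ℕ N)

coeff : ∀ {N} → Poly N → Vec ℕ N → ℤ
coeff []              α = 0ℤ
coeff ((a , β) ∷ p)   α =
  if ⌊ ≡-dec _≟ℕ_ β α ⌋ then a ℤ.+ coeff p α else coeff p α

_≈P_ : ∀ {N} → Poly N → Poly N → Set
p ≈P q = ∀ α → coeff p α ≡ coeff q α

scaleP : ∀ {N} → ℤ → Poly N → Poly N
scaleP z = map (λ { (a , α) → (z ℤ.* a , α) })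

mulP : ∀ {N} → Poly N → Poly N → Poly N
mulP p q = concatMap (λ { (a , α) → map (λ { (b , β) → (a ℤ.* b , zipWith ℕ._+_ α β) }) q }) p

-- Schur polynomials s_λ(x_1,…,x_N) = Σ_{T ∈ SSYT(λ), entries ≤ N} x^T,
-- computed by removing the horizontal strip of entries equal to N
-- (the shapes μ ⊆ λ with λ/μ a horizontal strip, i.e. λ_{k+1} ≤ μ_k ≤ λ_k).

range : ℕ → ℕ → List ℕ
range a b = if a ≤ᵇ b then map (a ℕ.+_) (upTo (suc (b ∸ a))) else []

head0 : List ℕ → ℕ
head0 []      = 0
head0 (x ∷ _) = x

-- all μ (same length as λ, trailing zeros allowed) with λ_{k+1} ≤ μ_k ≤ λ_k
interlace : List ℕ → List (List ℕ)
interlace []         = [ [] ]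
interlace (l ∷ rest) =
  concatMap (λ m → map (m ∷_) (interlace rest)) (range (head0 rest) l)

isZeroᵇ : List ℕ → Data.Bool.Bool
isZeroᵇ []      = Data.Bool.true
isZeroᵇ (x ∷ l) = if ⌊ x ≟ℕ 0 ⌋ then isZeroᵇ l else Data.Bool.false

schur : (N : ℕ) → List ℕ → Poly N
schur zero    l = if isZeroᵇ l then [ (1ℤ , []) ] else []
schur (suc N) l =
  concatMap (λ m → map (λ { (a , α) → (a , (sum l ∸ sum m) ∷ α) }) (schur N m))
            (interlace l)

-- Elements of Λ (symmetric functions over ℤ), written in the Schur basis.
-- An identity in Λ holds iff it holds in Λ_N = ℤ[x_1..x_N]^{S_N} for every N.

LinComb : Set
LinComb = List (ℤ × List ℕ)

evalLin : (N : ℕ) → LinComb → Poly N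
evalLin N = concatMap (λ { (z , l) → scaleP z (schur N l) })

-- Σ z · s_λ · s_ν   (an element of the ideal generated by the s_ν;
-- the coefficient Σ z s_λ ranges over all of Λ)
GenComb : Set
GenComb = List (ℤ × List ℕ × List ℕ)

evalGen : (N : ℕ) → GenComb → Poly N
evalGen N = concatMap (λ { (z , l , m) → scaleP z (mulP (schur N l) (schur N m)) })

box : ℕ → ℕ → List ℕ
box r n = rect (n ∸ r) r

InI : ℕ → ℕ → ℤ × List ℕ → Set
InI r n (z , l) = IsPartition l × ¬ (l ⊆ₚ box r n)

InJ : ℕ → ℕ → ℕ → ℕ → ℤ × List ℕ → Set
InJ r n i j (z , m) = IsPartition m × (rect i j ⊆ₚ m) × (m ⊆ₚ box r n)

InGen : (List ℕ → Set) → ℤ × List ℕ × List ℕ → Set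
InGen S (z , l , m) = IsPartition l × IsPartition m × S m

-- J (as an ideal of Λ/I_{r,n-r}) equals the ideal generated by {s_ν : S ν}:
--  (1) every s_μ ∈ J is ≡ Σ c_k s_{ν_k}  (mod I), with c_k ∈ Λ, ν_k ∈ S;
--  (2) every Σ c_k s_{ν_k} (ν_k ∈ S) is ≡ an element of J  (mod I).
GeneratesJ : ℕ → ℕ → ℕ → ℕ → (List ℕ → Set) → Set
GeneratesJ r n i j S =
  (∀ μ → IsPartition μ → rect i j ⊆ₚ μ → μ ⊆ₚ box r n →
     Σ GenComb λ G → All (InGen S) G ×
     Σ LinComb λ I → All (InI r n) I ×
       ∀ N → schur N μ ≈P (evalGen N G ++ evalLin N I))
  ×
  (∀ (G : GenComb) → All (InGen S) G →
     Σ LinComb λ Jc → All (InJ r n i j) Jc ×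
     Σ LinComb λ I → All (InI r n) I ×
       ∀ N → evalGen N G ≈P (evalLin N Jc ++ evalLin N I))

{-# OPTIONS --safe #-}

-- Write a partition with r rows by its strictly decreasing beta numbers
-- x = λ + (r−1, …, 0); then s_λ extends to an antisymmetric function A of
-- x ∈ ℕ^r.  Multiplication by h_k sums A over x + v, v ∈ ℕ^r with |v| = k, and
-- multiplication by e_k over the 0/1 vectors v, both modulo partitions with more
-- than r rows.  The same holds for the column lengths, with e and h exchanged.
--
-- With y_p the shift of the p-th coordinate, ∏_p (1 − y_p/y_1) = 0; so the shapes
-- obtained by lowering one coordinate m of x by 1, …, r generate the original one,
-- provided m ≥ r.  Applied to the first
-- row this makes i^j ⊆ ν with j rows reducible when ν_1 > i + (r − j); applied,
-- among the columns, to column i+1, it makes ν reducible when that column is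
-- higher than i.  In both cases the lowered vectors still sort to shapes
-- containing i^j, as this only depends on how many coordinates are ≥ a constant.
-- Finally, every shape containing i^j is generated by those with j rows: multiply
-- the shape without its last row q by h_q and induct on q.  The second generating
-- set is obtained by exchanging rows and columns.

module Submission where

open import Defs
open import Data.Bool using (true; false; if_then_else_; T)
open import Data.Empty using (⊥-elim)
open import Data.Integer using (ℤ; 0ℤ; 1ℤ) renaming (_+_ to _⊕_; _*_ to _⊗_; -_ to ⊝_; _-_ to _⊖_)
import Data.Integer as ℤ
import Data.Integer.Properties as ℤₚ
open import Algebra.Properties.AbelianGroup ℤₚ.+-0-abelianGroup using () renaming (∙-cancelˡ to +-cancelˡ; ∙-cancelʳ to +-cancelʳ)
open import Data.Integer.Tactic.RingSolver using (solve-∀)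
open import Data.List using (List; []; _∷_; _++_; map; length; replicate; concatMap; upTo; applyUpTo)
import Data.List.Properties as L
open import Data.List.Relation.Binary.Permutation.Propositional using (_↭_; refl; prep; swap; trans)
open import Data.List.Relation.Binary.Permutation.Propositional.Properties using (All-resp-↭; ↭-length; ∷↭∷ʳ)
open import Data.List.Relation.Binary.Pointwise using (Pointwise; []; _∷_)
import Data.List.Relation.Binary.Pointwise as Pointwise
open import Data.List.Relation.Unary.All using (All; []; _∷_)
import Data.List.Relation.Unary.All as All
open import Data.List.Relation.Unary.All.Properties using (++⁺)
open import Data.List.Relation.Unary.AllPairs using (AllPairs; []; _∷_)
open import Data.Nat using (ℕ; zero; suc; _≤_; _<_; _>_; _∸_; _+_; _⊓_; z≤n; s≤s)
import Data.Nat as ℕ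
open import Data.Nat.Induction using (<-rec)
open import Data.Nat.ListAction using (sum)
open import Data.Nat.ListAction.Properties using (sum-↭)
import Data.Nat.Properties as ℕₚ
open import Data.Product using (Σ; _×_; _,_; proj₁; proj₂)
open import Data.Sum using (_⊎_; inj₁; inj₂)
open import Data.Vec using (Vec; []; _∷_; zipWith)
import Data.Vec as Vec
open import Data.Vec.Properties using (zipWith-assoc; zipWith-identityˡ; ≡-dec)
open import Relation.Binary.Definitions using (tri<; tri≈; tri>)
open import Relation.Binary.PropositionalEquality using (_≡_; refl; sym; cong; cong₂; subst; subst₂; module ≡-Reasoning)
import Relation.Binary.PropositionalEquality as ≡
open import Relation.Nullary using (¬_; yes; no)
open import Relation.Nullary.Decidable using (⌊_⌋)

-- Both bounds come from lowering a beta number by as much as the number of coordinates. The first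
-- of r rows has beta number ν_1 + r - 1. Containing i^j means that j beta numbers are at least i +
-- (r - j), and after a lowering by r the first one still qualifies exactly when ν_1 > i + (r - j);
-- with the width of the box this gives a. Among the c = n - r columns, column i + 1 has beta number
-- its height plus c - i - 1, and the only demand is that this be at least c, so that the height
-- exceeds i; as no column is higher than j, this gives b. The second reduction keeps what the first
-- achieved: it leaves the first i columns at height j, makes no column higher than j, and does not
-- increase the number of nonempty columns.
--
-- Schur polynomials are given here by branching in the number of variables, so `A` is built by the
-- same branching and its Pieri rules are proved by induction on the number of variables. Lowerings
-- that are not horizontal strips cancel by antisymmetry.

-- Alternating functions of integer vectors

data Swap : List ℕ → List ℕ → Set where
  here  : ∀ {a b xs} → Swap (a ∷ b ∷ xs) (b ∷ a ∷ xs)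
  there : ∀ {a xs ys} → Swap xs ys → Swap (a ∷ xs) (a ∷ ys)

Alt : (List ℕ → ℤ) → Set
Alt φ = ∀ {xs ys} → Swap xs ys → φ xs ≡ ⊝ φ ys

-- The argument in ℕ is the exponent of the variable that is being split off.
Series : Set
Series = ℕ → List ℕ → ℤ

Altₛ : Series → Set
Altₛ φ = ∀ e → Alt (φ e)

infixr 5 _▹_
_▹_ : ℕ → Series → Series
(x ▹ φ) e ys = φ e (x ∷ ys)

sh : Series → Series
sh φ e = φ (suc e)

self-neg : ∀ z → z ≡ ⊝ z → z ≡ 0ℤ
self-neg (ℤ.+ zero)    _ = refl
self-neg (ℤ.+ (suc n)) ()
self-neg (ℤ.-[1+ n ])  ()

-- The first `a` moves right until it meets the last one. The case of interest is a second 0 besides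
-- a final coordinate 0.
alt-dup : ∀ {φ} → Alt φ → ∀ a ys → φ (a ∷ ys ++ a ∷ []) ≡ 0ℤ
alt-dup al a []       = self-neg _ (al here)
alt-dup al a (y ∷ ys) = ≡.trans (al here) (cong ⊝_ (alt-dup (λ s → al (there s)) a ys))

alt-adj : ∀ {φ} → Alt φ → ∀ a ys → φ (a ∷ a ∷ ys) ≡ 0ℤ
alt-adj al a ys = self-neg _ (al here)

swp : List ℕ → List ℕ
swp (a ∷ b ∷ xs) = b ∷ a ∷ xs
swp xs           = xs

-- U k φ x is the sum of φ (x + v) over the vectors v of natural numbers with sum k,
-- V k φ x the same over the 0/1 vectors v; D φ x is the sum of φ |v| (x − v) over
-- all natural vectors v ≤ x, and W φ x the same over the 0/1 vectors v ≤ x.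
U : ℕ → (List ℕ → ℤ) → List ℕ → ℤ
U zero    φ xs       = φ xs
U (suc k) φ []       = 0ℤ
U (suc k) φ (x ∷ xs) = U (suc k) (λ ys → φ (x ∷ ys)) xs ⊕ U k φ (suc x ∷ xs)

-- Degree k - 1, with the value 0 at k = 0, so that the recursion of `U` takes one form for all k.
U⁻ : ℕ → (List ℕ → ℤ) → List ℕ → ℤ
U⁻ zero    φ xs = 0ℤ
U⁻ (suc k) φ xs = U k φ xs

V : ℕ → (List ℕ → ℤ) → List ℕ → ℤ
V zero    φ xs       = φ xs
V (suc k) φ []       = 0ℤ
V (suc k) φ (x ∷ xs) = V (suc k) (λ ys → φ (x ∷ ys)) xs ⊕ V k (λ ys → φ (suc x ∷ ys)) xs

D : Series → List ℕ → ℤ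
D φ []           = φ 0 []
D φ (zero ∷ xs)  = D (0 ▹ φ) xs
D φ (suc x ∷ xs) = D (suc x ▹ φ) xs ⊕ D (sh φ) (x ∷ xs)

W : Series → List ℕ → ℤ
W φ []           = φ 0 []
W φ (zero ∷ xs)  = W (0 ▹ φ) xs
W φ (suc x ∷ xs) = W (suc x ▹ φ) xs ⊕ W (x ▹ sh φ) xs

U-∷ : ∀ k φ x xs → U k φ (x ∷ xs) ≡ U k (λ ys → φ (x ∷ ys)) xs ⊕ U⁻ k φ (suc x ∷ xs)
U-∷ zero    φ x xs = sym (ℤₚ.+-identityʳ _)
U-∷ (suc k) φ x xs = refl

U-cong : ∀ k {φ ψ} xs → (∀ ys → length ys ≡ length xs → φ ys ≡ ψ ys) → U k φ xs ≡ U k ψ xs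
U-cong zero    xs       eq = eq xs refl
U-cong (suc k) []       eq = refl
U-cong (suc k) (x ∷ xs) eq =
  cong₂ _⊕_ (U-cong (suc k) xs (λ ys l → eq (x ∷ ys) (cong suc l))) (U-cong k (suc x ∷ xs) eq)

interchange : ∀ a b c d → (a ⊕ b) ⊕ (c ⊕ d) ≡ (a ⊕ c) ⊕ (b ⊕ d)
interchange = solve-∀

U-+ : ∀ k φ ψ xs → U k (λ ys → φ ys ⊕ ψ ys) xs ≡ U k φ xs ⊕ U k ψ xs
U-+ zero    φ ψ xs       = refl
U-+ (suc k) φ ψ []       = refl
U-+ (suc k) φ ψ (x ∷ xs) = ≡.trans
  (cong₂ _⊕_ (U-+ (suc k) (λ ys → φ (x ∷ ys)) (λ ys → ψ (x ∷ ys)) xs) (U-+ k φ ψ (suc x ∷ xs)))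
  (interchange (U (suc k) (λ ys → φ (x ∷ ys)) xs) (U (suc k) (λ ys → ψ (x ∷ ys)) xs) _ _)

U-neg : ∀ k φ xs → U k (λ ys → ⊝ φ ys) xs ≡ ⊝ U k φ xs
U-neg zero    φ xs       = refl
U-neg (suc k) φ []       = refl
U-neg (suc k) φ (x ∷ xs) = ≡.trans
  (cong₂ _⊕_ (U-neg (suc k) (λ ys → φ (x ∷ ys)) xs) (U-neg k φ (suc x ∷ xs)))
  (sym (ℤₚ.neg-distrib-+ (U (suc k) (λ ys → φ (x ∷ ys)) xs) _))

V-cong : ∀ k {φ ψ} xs → (∀ ys → length ys ≡ length xs → φ ys ≡ ψ ys) → V k φ xs ≡ V k ψ xs
V-cong zero    xs       eq = eq xs refl
V-cong (suc k) []       eq = refl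
V-cong (suc k) (x ∷ xs) eq = cong₂ _⊕_
  (V-cong (suc k) xs (λ ys l → eq (x ∷ ys) (cong suc l)))
  (V-cong k xs (λ ys l → eq (suc x ∷ ys) (cong suc l)))

V-+ : ∀ k φ ψ xs → V k (λ ys → φ ys ⊕ ψ ys) xs ≡ V k φ xs ⊕ V k ψ xs
V-+ zero    φ ψ xs       = refl
V-+ (suc k) φ ψ []       = refl
V-+ (suc k) φ ψ (x ∷ xs) = ≡.trans
  (cong₂ _⊕_ (V-+ (suc k) (λ ys → φ (x ∷ ys)) (λ ys → ψ (x ∷ ys)) xs)
             (V-+ k (λ ys → φ (suc x ∷ ys)) (λ ys → ψ (suc x ∷ ys)) xs))
  (interchange (V (suc k) (λ ys → φ (x ∷ ys)) xs) (V (suc k) (λ ys → ψ (x ∷ ys)) xs) _ _)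

D-cong : ∀ {φ ψ} xs → (∀ e ys → length ys ≡ length xs → φ e ys ≡ ψ e ys) → D φ xs ≡ D ψ xs
D-cong []           eq = eq 0 [] refl
D-cong (zero ∷ xs)  eq = D-cong xs (λ e ys l → eq e (0 ∷ ys) (cong suc l))
D-cong (suc x ∷ xs) eq = cong₂ _⊕_
  (D-cong xs (λ e ys l → eq e (suc x ∷ ys) (cong suc l))) (D-cong (x ∷ xs) (λ e → eq (suc e)))

W-cong : ∀ {φ ψ} xs → (∀ e ys → length ys ≡ length xs → φ e ys ≡ ψ e ys) → W φ xs ≡ W ψ xs
W-cong []           eq = eq 0 [] refl
W-cong (zero ∷ xs)  eq = W-cong xs (λ e ys l → eq e (0 ∷ ys) (cong suc l))
W-cong (suc x ∷ xs) eq = cong₂ _⊕_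
  (W-cong xs (λ e ys l → eq e (suc x ∷ ys) (cong suc l)))
  (W-cong xs (λ e ys l → eq (suc e) (x ∷ ys) (cong suc l)))

D-+ : ∀ φ ψ xs → D (λ e ys → φ e ys ⊕ ψ e ys) xs ≡ D φ xs ⊕ D ψ xs
D-+ φ ψ []           = refl
D-+ φ ψ (zero ∷ xs)  = D-+ (0 ▹ φ) (0 ▹ ψ) xs
D-+ φ ψ (suc x ∷ xs) = ≡.trans
  (cong₂ _⊕_ (D-+ (suc x ▹ φ) (suc x ▹ ψ) xs) (D-+ (sh φ) (sh ψ) (x ∷ xs)))
  (interchange (D (suc x ▹ φ) xs) (D (suc x ▹ ψ) xs) _ _)

W-+ : ∀ φ ψ xs → W (λ e ys → φ e ys ⊕ ψ e ys) xs ≡ W φ xs ⊕ W ψ xs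
W-+ φ ψ []           = refl
W-+ φ ψ (zero ∷ xs)  = W-+ (0 ▹ φ) (0 ▹ ψ) xs
W-+ φ ψ (suc x ∷ xs) = ≡.trans
  (cong₂ _⊕_ (W-+ (suc x ▹ φ) (suc x ▹ ψ) xs) (W-+ (x ▹ sh φ) (x ▹ sh ψ) xs))
  (interchange (W (suc x ▹ φ) xs) (W (suc x ▹ ψ) xs) _ _)

-- Linear functionals

record Linear {X : Set} (L : (X → ℤ) → ℤ) : Set where
  field
    ext : ∀ {f g} → (∀ x → f x ≡ g x) → L f ≡ L g
    add : ∀ f g → L (λ x → f x ⊕ g x) ≡ L f ⊕ L g

  zer : L (λ _ → 0ℤ) ≡ 0ℤ
  zer = +-cancelˡ (L (λ _ → 0ℤ)) _ _
    (≡.trans (sym (add (λ _ → 0ℤ) (λ _ → 0ℤ))) (sym (ℤₚ.+-identityʳ _)))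

  neg : ∀ f → L (λ x → ⊝ f x) ≡ ⊝ L f
  neg f = +-cancelˡ (L f) _ _ (≡.trans (sym (add f (λ x → ⊝ f x)))
    (≡.trans (≡.trans (ext (λ x → ℤₚ.+-inverseʳ (f x))) zer) (sym (ℤₚ.+-inverseʳ (L f)))))

module _ {X : Set} {L : (X → ℤ) → ℤ} (lin : Linear L) where
  open Linear lin

  L-V : ∀ k (φ : X → List ℕ → ℤ) xs → L (λ α → V k (φ α) xs) ≡ V k (λ ys → L (λ α → φ α ys)) xs
  L-V zero    φ xs       = refl
  L-V (suc k) φ []       = zer
  L-V (suc k) φ (x ∷ xs) = ≡.trans (add _ _)
    (cong₂ _⊕_ (L-V (suc k) (λ α ys → φ α (x ∷ ys)) xs) (L-V k (λ α ys → φ α (suc x ∷ ys)) xs))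

  L-D : ∀ (φ : X → Series) xs → L (λ α → D (φ α) xs) ≡ D (λ e ys → L (λ α → φ α e ys)) xs
  L-D φ []           = refl
  L-D φ (zero ∷ xs)  = L-D (λ α → 0 ▹ φ α) xs
  L-D φ (suc x ∷ xs) = ≡.trans (add _ _)
    (cong₂ _⊕_ (L-D (λ α → suc x ▹ φ α) xs) (L-D (λ α → sh (φ α)) (x ∷ xs)))

  L-W : ∀ (φ : X → Series) xs → L (λ α → W (φ α) xs) ≡ W (λ e ys → L (λ α → φ α e ys)) xs
  L-W φ []           = refl
  L-W φ (zero ∷ xs)  = L-W (λ α → 0 ▹ φ α) xs
  L-W φ (suc x ∷ xs) = ≡.trans (add _ _)
    (cong₂ _⊕_ (L-W (λ α → suc x ▹ φ α) xs) (L-W (λ α → x ▹ sh (φ α)) xs))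

D-neg : ∀ φ xs → D (λ e ys → ⊝ φ e ys) xs ≡ ⊝ D φ xs
D-neg φ []           = refl
D-neg φ (zero ∷ xs)  = D-neg (0 ▹ φ) xs
D-neg φ (suc x ∷ xs) = ≡.trans (cong₂ _⊕_ (D-neg (suc x ▹ φ) xs) (D-neg (sh φ) (x ∷ xs)))
  (sym (ℤₚ.neg-distrib-+ (D (suc x ▹ φ) xs) _))

W-neg : ∀ φ xs → W (λ e ys → ⊝ φ e ys) xs ≡ ⊝ W φ xs
W-neg φ []           = refl
W-neg φ (zero ∷ xs)  = W-neg (0 ▹ φ) xs
W-neg φ (suc x ∷ xs) = ≡.trans (cong₂ _⊕_ (W-neg (suc x ▹ φ) xs) (W-neg (x ▹ sh φ) xs))
  (sym (ℤₚ.neg-distrib-+ (W (suc x ▹ φ) xs) _))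

-- Antisymmetry of the operators

U-swap : ∀ k φ a b xs → U k φ (a ∷ b ∷ xs) ≡ U k (λ ys → φ (swp ys)) (b ∷ a ∷ xs)
U⁻-swap : ∀ k φ a b xs → U⁻ k φ (a ∷ b ∷ xs) ≡ U⁻ k (λ ys → φ (swp ys)) (b ∷ a ∷ xs)

U-swap zero    φ a b xs = refl
U-swap (suc k) φ a b xs = begin
  (p ⊕ U k (λ ys → φ (a ∷ ys)) (suc b ∷ xs)) ⊕ U k φ (suc a ∷ b ∷ xs)
    ≡⟨ cong ((p ⊕ U k (λ ys → φ (a ∷ ys)) (suc b ∷ xs)) ⊕_) (≡.trans (U-swap k φ (suc a) b xs) (U-∷ k φ' b (suc a ∷ xs))) ⟩
  (p ⊕ U k (λ ys → φ (a ∷ ys)) (suc b ∷ xs)) ⊕ (U k (λ ys → φ' (b ∷ ys)) (suc a ∷ xs) ⊕ U⁻ k φ' (suc b ∷ suc a ∷ xs))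
    ≡⟨ lem p _ _ _ ⟩
  (p ⊕ U k (λ ys → φ' (b ∷ ys)) (suc a ∷ xs)) ⊕ (U k (λ ys → φ (a ∷ ys)) (suc b ∷ xs) ⊕ U⁻ k φ' (suc b ∷ suc a ∷ xs))
    -- The part in which both coordinates have risen is the only one not yet in place; the induction
    -- in lower degree exchanges its coordinates.
    ≡⟨ cong (λ z → (p ⊕ U k (λ ys → φ' (b ∷ ys)) (suc a ∷ xs)) ⊕ (U k (λ ys → φ (a ∷ ys)) (suc b ∷ xs) ⊕ z)) (sym (U⁻-swap k φ (suc a) (suc b) xs)) ⟩
  (p ⊕ U k (λ ys → φ' (b ∷ ys)) (suc a ∷ xs)) ⊕ (U k (λ ys → φ (a ∷ ys)) (suc b ∷ xs) ⊕ U⁻ k φ (suc a ∷ suc b ∷ xs))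
    ≡⟨ cong ((p ⊕ U k (λ ys → φ' (b ∷ ys)) (suc a ∷ xs)) ⊕_) (≡.trans (sym (U-∷ k φ a (suc b ∷ xs))) (U-swap k φ a (suc b) xs)) ⟩
  (p ⊕ U k (λ ys → φ' (b ∷ ys)) (suc a ∷ xs)) ⊕ U k φ' (suc b ∷ a ∷ xs) ∎
  where
  open ≡-Reasoning
  φ' = λ ys → φ (swp ys)
  p = U (suc k) (λ ys → φ (a ∷ b ∷ ys)) xs
  lem : ∀ p q r s → (p ⊕ q) ⊕ (r ⊕ s) ≡ (p ⊕ r) ⊕ (q ⊕ s)
  lem = solve-∀

U⁻-swap zero    φ a b xs = refl
U⁻-swap (suc k) φ a b xs = U-swap k φ a b xs

alt-U : ∀ k {φ} → Alt φ → Alt (U k φ)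
alt-U k {φ} al (here {a} {b} {xs}) = ≡.trans (U-swap k φ a b xs)
  (≡.trans (U-cong k (b ∷ a ∷ xs) (λ { (_ ∷ _ ∷ _) _ → al here })) (U-neg k φ (b ∷ a ∷ xs)))
alt-U zero    al (there s) = al (there s)
alt-U (suc k) {φ} al (there {a} {xs} {ys} s) = ≡.trans
  (cong₂ _⊕_ (alt-U (suc k) (λ t → al (there t)) s) (alt-U k al (there {suc a} s)))
  (sym (ℤₚ.neg-distrib-+ (U (suc k) (λ zs → φ (a ∷ zs)) ys) _))

D-swap : ∀ φ a b xs → D φ (a ∷ b ∷ xs) ≡ D (λ e ys → φ e (swp ys)) (b ∷ a ∷ xs)
D-swap φ zero    zero    xs = refl
D-swap φ zero    (suc b) xs = cong (D (0 ▹ suc b ▹ λ e ys → φ e (swp ys)) xs ⊕_) (D-swap (sh φ) zero b xs)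
D-swap φ (suc a) zero    xs = cong (D (λ e ys → φ e (suc a ∷ 0 ∷ ys)) xs ⊕_) (D-swap (sh φ) a zero xs)
D-swap φ (suc a) (suc b) xs = begin
  (p ⊕ q) ⊕ D (sh φ) (a ∷ suc b ∷ xs)
    ≡⟨ cong ((p ⊕ q) ⊕_) (D-swap (sh φ) a (suc b) xs) ⟩
  (p ⊕ q) ⊕ (r ⊕ D (sh (sh φ')) (b ∷ a ∷ xs))
    ≡⟨ interchange p q r _ ⟩
  (p ⊕ r) ⊕ (q ⊕ D (sh (sh φ')) (b ∷ a ∷ xs))
    ≡⟨ cong (λ z → (p ⊕ r) ⊕ (q ⊕ z)) (sym (D-swap (sh (sh φ)) a b xs)) ⟩
  (p ⊕ r) ⊕ (q ⊕ D (sh (sh φ)) (a ∷ b ∷ xs))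
    ≡⟨ cong ((p ⊕ r) ⊕_) (D-swap (sh φ) (suc a) b xs) ⟩
  (p ⊕ r) ⊕ D (sh φ') (b ∷ suc a ∷ xs) ∎
  where
  open ≡-Reasoning
  φ' : Series
  φ' e ys = φ e (swp ys)
  p = D (λ e ys → φ e (suc a ∷ suc b ∷ ys)) xs
  q = D (λ e ys → φ (suc e) (suc a ∷ ys)) (b ∷ xs)
  r = D (λ e ys → φ' (suc e) (suc b ∷ ys)) (a ∷ xs)

W-swap : ∀ φ a b xs → W φ (a ∷ b ∷ xs) ≡ W (λ e ys → φ e (swp ys)) (b ∷ a ∷ xs)
W-swap φ zero    zero    xs = refl
W-swap φ zero    (suc b) xs = refl
W-swap φ (suc a) zero    xs = refl
W-swap φ (suc a) (suc b) xs = interchange (W (λ e ys → φ e (suc a ∷ suc b ∷ ys)) xs) _ _ _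

alt-D : ∀ {φ} → Altₛ φ → Alt (D φ)
alt-D {φ} al (here {a} {b} {xs}) = ≡.trans (D-swap φ a b xs)
  (≡.trans (D-cong (b ∷ a ∷ xs) (λ { e (_ ∷ _ ∷ _) _ → al e here })) (D-neg φ (b ∷ a ∷ xs)))
alt-D al (there {zero} s) = alt-D (λ e t → al e (there t)) s
alt-D {φ} al (there {suc a} {xs} {ys} s) = ≡.trans
  (cong₂ _⊕_ (alt-D (λ e t → al e (there t)) s) (alt-D (λ e → al (suc e)) (there {a} s)))
  (sym (ℤₚ.neg-distrib-+ (D (suc a ▹ φ) ys) _))

alt-W : ∀ {φ} → Altₛ φ → Alt (W φ)
alt-W {φ} al (here {a} {b} {xs}) = ≡.trans (W-swap φ a b xs)
  (≡.trans (W-cong (b ∷ a ∷ xs) (λ { e (_ ∷ _ ∷ _) _ → al e here })) (W-neg φ (b ∷ a ∷ xs)))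
alt-W al (there {zero} s) = alt-W (λ e t → al e (there t)) s
alt-W {φ} al (there {suc a} {xs} {ys} s) = ≡.trans
  (cong₂ _⊕_ (alt-W (λ e t → al e (there t)) s) (alt-W (λ e t → al (suc e) (there t)) s))
  (sym (ℤₚ.neg-distrib-+ (W (suc a ▹ φ) ys) _))

-- The operators on vectors with a distinguished last coordinate

U-single : ∀ k φ x → U k φ (x ∷ []) ≡ φ (x + k ∷ [])
U-single zero    φ x = cong (λ y → φ (y ∷ [])) (sym (ℕₚ.+-identityʳ x))
U-single (suc k) φ x = ≡.trans (ℤₚ.+-identityˡ _)
  (≡.trans (U-single k φ (suc x)) (cong (λ y → φ (y ∷ [])) (sym (ℕₚ.+-suc x k))))

U-++ : ∀ k φ xs a → U k φ (xs ++ a ∷ []) ≡ U k (λ ys → φ (ys ++ a ∷ [])) xs ⊕ U⁻ k φ (xs ++ suc a ∷ [])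
U-++ zero    φ xs       a = sym (ℤₚ.+-identityʳ _)
U-++ (suc k) φ []       a = refl
U-++ (suc k) φ (x ∷ xs) a = ≡.trans
  (cong₂ _⊕_ (U-++ (suc k) (λ ys → φ (x ∷ ys)) xs a) (U-++ k φ (suc x ∷ xs) a))
  (≡.trans (interchange (U (suc k) (λ ys → φ (x ∷ ys ++ a ∷ [])) xs) _ _ _)
    (cong (U (suc k) (λ ys → φ (ys ++ a ∷ [])) (x ∷ xs) ⊕_) (sym (U-∷ k φ x (xs ++ suc a ∷ [])))))

U-map-suc : ∀ k φ xs → U k φ (map suc xs) ≡ U k (λ ys → φ (map suc ys)) xs
U-map-suc zero    φ xs       = refl
U-map-suc (suc k) φ []       = refl
U-map-suc (suc k) φ (x ∷ xs) = cong₂ _⊕_ (U-map-suc (suc k) (λ ys → φ (suc x ∷ ys)) xs) (U-map-suc k φ (suc x ∷ xs))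

D-++ : ∀ φ xs → D φ (xs ++ 0 ∷ []) ≡ D (λ e ys → φ e (ys ++ 0 ∷ [])) xs
D-++ φ []           = refl
D-++ φ (zero ∷ xs)  = D-++ (0 ▹ φ) xs
D-++ φ (suc x ∷ xs) = cong₂ _⊕_ (D-++ (suc x ▹ φ) xs) (D-++ (sh φ) (x ∷ xs))

W-++ : ∀ φ xs → W φ (xs ++ 0 ∷ []) ≡ W (λ e ys → φ e (ys ++ 0 ∷ [])) xs
W-++ φ []           = refl
W-++ φ (zero ∷ xs)  = W-++ (0 ▹ φ) xs
W-++ φ (suc x ∷ xs) = cong₂ _⊕_ (W-++ (suc x ▹ φ) xs) (W-++ (x ▹ sh φ) xs)

-- Appending an empty row raises all beta numbers by one and adds the beta number 0. The additional
-- terms lower a raised coordinate to 0, where it collides with the new one and the alternating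
-- function vanishes.
D-drop : ∀ {φ} → Altₛ φ → ∀ xs → D φ (map suc xs ++ 0 ∷ []) ≡ D (λ e ys → φ e (map suc ys ++ 0 ∷ [])) xs
D-drop al []           = refl
D-drop {φ} al (zero ∷ xs)  = ≡.trans
  (cong₂ _⊕_ (D-drop (λ e t → al e (there t)) xs) (alt-dup (alt-D {sh φ} (λ e → al (suc e))) 0 (map suc xs)))
  (ℤₚ.+-identityʳ _)
D-drop {φ} al (suc x ∷ xs) =
  cong₂ _⊕_ (D-drop (λ e t → al e (there t)) xs) (D-drop {sh φ} (λ e → al (suc e)) (x ∷ xs))

W-drop : ∀ {φ} → Altₛ φ → ∀ xs → W φ (map suc xs ++ 0 ∷ []) ≡ W (λ e ys → φ e (map suc ys ++ 0 ∷ [])) xs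
W-drop al []           = refl
W-drop {φ} al (zero ∷ xs)  = ≡.trans
  (cong₂ _⊕_ (W-drop (λ e t → al e (there t)) xs) (alt-dup (alt-W {sh φ} (λ e → al (suc e))) 0 (map suc xs)))
  (ℤₚ.+-identityʳ _)
W-drop {φ} al (suc x ∷ xs) =
  cong₂ _⊕_ (W-drop (λ e t → al e (there t)) xs) (W-drop (λ e t → al (suc e) (there t)) xs)

W-0 : ∀ xs → W (λ _ _ → 0ℤ) xs ≡ 0ℤ
W-0 []           = refl
W-0 (zero ∷ xs)  = W-0 xs
W-0 (suc x ∷ xs) = cong₂ _⊕_ (W-0 xs) (W-0 xs)

-- One coordinate of the lists is pinned to 0: this is what makes the Pieri
-- rule exact, the new part created by adding a strip being that coordinate.

UD : ∀ k φ xs → Altₛ φ →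
     U k (D φ) (xs ++ 0 ∷ []) ≡ D (λ e → U k (φ e)) (xs ++ 0 ∷ []) ⊕ U⁻ k (D (sh φ)) (xs ++ 0 ∷ [])
UD zero    φ xs al = sym (ℤₚ.+-identityʳ _)
UD (suc k) φ [] al = ≡.trans (U-single (suc k) (D φ) 0)
  (sym (cong₂ _⊕_ (U-single (suc k) (φ 0) 0) (U-single k (D (sh φ)) 0)))
-- A second 0 besides the pinned one makes all three terms vanish, so the boundary of the lowering
-- is never met.
UD (suc k) φ (zero ∷ xs) al = ≡.trans (alt-dup (alt-U (suc k) (alt-D al)) 0 xs)
  (sym (cong₂ _⊕_ (alt-dup (alt-D (λ e → alt-U (suc k) (al e))) 0 xs)
                  (alt-dup (alt-U k (alt-D {sh φ} (λ e → al (suc e)))) 0 xs)))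
UD (suc k) φ (suc x ∷ xs) al = begin
  U (suc k) (λ zs → D φ (suc x ∷ zs)) ys ⊕ U k (D φ) (suc (suc x) ∷ ys)
    ≡⟨ cong₂ _⊕_ (U-+ (suc k) (D (suc x ▹ φ)) (λ zs → D (sh φ) (x ∷ zs)) ys) (UD k φ (suc (suc x) ∷ xs) al) ⟩
  (U (suc k) (D (suc x ▹ φ)) ys ⊕ p₂) ⊕ ((q₅ ⊕ q₅') ⊕ q₆)
    ≡⟨ cong (λ z → (z ⊕ p₂) ⊕ ((q₅ ⊕ q₅') ⊕ q₆)) (UD (suc k) (suc x ▹ φ) xs (λ e t → al e (there t))) ⟩
  ((q₁ ⊕ q₂) ⊕ p₂) ⊕ ((q₅ ⊕ q₅') ⊕ q₆)
    ≡⟨ alg p₂ r q₁ q₂ q₃ q₄ q₅ q₅' q₆ q₇ q₈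
         (UD (suc k) (sh φ) (x ∷ xs) (λ e → al (suc e)))
         (UD k (sh φ) (suc x ∷ xs) (λ e → al (suc e)))
         (≡.trans (U-∷ k (D (sh φ)) (suc x) ys) (cong (_⊕ q₆) (U-+ k (D (suc x ▹ sh φ)) _ ys)))
         (U-∷ k (D (sh (sh φ))) x ys) ⟩
  ((q₁ ⊕ q₅) ⊕ q₃) ⊕ r
    ≡⟨ cong (λ z → (z ⊕ q₃) ⊕ r) (sym (D-+ (λ e → U (suc k) ((suc x ▹ φ) e)) (λ e zs → U k (φ e) (suc (suc x) ∷ zs)) ys)) ⟩
  D (λ e → U (suc k) (φ e)) (suc x ∷ ys) ⊕ r ∎
  where
  open ≡-Reasoning
  ys = xs ++ 0 ∷ []
  p₂ = U (suc k) (λ zs → D (sh φ) (x ∷ zs)) ys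
  r  = U k (D (sh φ)) (suc x ∷ ys)
  q₁ = D (λ e → U (suc k) ((suc x ▹ φ) e)) ys
  q₂ = U k (D (suc x ▹ sh φ)) ys
  q₃ = D (λ e → U (suc k) (sh φ e)) (x ∷ ys)
  q₄ = U k (D (sh (sh φ))) (x ∷ ys)
  q₅ = D (λ e zs → U k (φ e) (suc (suc x) ∷ zs)) ys
  q₅' = D (λ e → U k (sh φ e)) (suc x ∷ ys)
  q₆ = U⁻ k (D (sh φ)) (suc (suc x) ∷ ys)
  q₇ = U⁻ k (D (sh (sh φ))) (suc x ∷ ys)
  q₈ = U k (λ zs → D (sh (sh φ)) (x ∷ zs)) ys
  alg : ∀ p₂ r q₁ q₂ q₃ q₄ q₅ q₅' q₆ q₇ q₈ → p₂ ⊕ r ≡ q₃ ⊕ q₄ → r ≡ q₅' ⊕ q₇ →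
        r ≡ (q₂ ⊕ q₈) ⊕ q₆ → q₄ ≡ q₈ ⊕ q₇ →
        ((q₁ ⊕ q₂) ⊕ p₂) ⊕ ((q₅ ⊕ q₅') ⊕ q₆) ≡ ((q₁ ⊕ q₅) ⊕ q₃) ⊕ r
  -- A further copy of `r` is added to both sides: on the left it completes `p₂ ⊕ r` for `e₁`, on
  -- the right the two copies are expanded by `e₃` and `e₂`.
  alg p₂ r q₁ q₂ q₃ q₄ q₅ q₅' q₆ q₇ q₈ e₁ e₂ e₃ e₄ = +-cancelʳ r _ _ (begin
    (((q₁ ⊕ q₂) ⊕ p₂) ⊕ ((q₅ ⊕ q₅') ⊕ q₆)) ⊕ r
      ≡⟨ lem₁ p₂ r q₁ q₂ q₅ q₅' q₆ ⟩
    (p₂ ⊕ r) ⊕ (q₁ ⊕ q₂ ⊕ q₅ ⊕ q₅' ⊕ q₆)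
      ≡⟨ cong (_⊕ (q₁ ⊕ q₂ ⊕ q₅ ⊕ q₅' ⊕ q₆)) (≡.trans e₁ (cong (q₃ ⊕_) e₄)) ⟩
    (q₃ ⊕ (q₈ ⊕ q₇)) ⊕ (q₁ ⊕ q₂ ⊕ q₅ ⊕ q₅' ⊕ q₆)
      ≡⟨ lem₂ q₁ q₂ q₃ q₅ q₅' q₆ q₇ q₈ ⟩
    ((q₁ ⊕ q₅) ⊕ q₃) ⊕ ((q₂ ⊕ q₈) ⊕ q₆) ⊕ (q₅' ⊕ q₇)
      ≡⟨ cong₂ (λ u v → ((q₁ ⊕ q₅) ⊕ q₃) ⊕ u ⊕ v) (sym e₃) (sym e₂) ⟩
    (((q₁ ⊕ q₅) ⊕ q₃) ⊕ r) ⊕ r ∎)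
    where
    lem₁ : ∀ p₂ r q₁ q₂ q₅ q₅' q₆ → (((q₁ ⊕ q₂) ⊕ p₂) ⊕ ((q₅ ⊕ q₅') ⊕ q₆)) ⊕ r ≡ (p₂ ⊕ r) ⊕ (q₁ ⊕ q₂ ⊕ q₅ ⊕ q₅' ⊕ q₆)
    lem₁ = solve-∀
    lem₂ : ∀ q₁ q₂ q₃ q₅ q₅' q₆ q₇ q₈ → (q₃ ⊕ (q₈ ⊕ q₇)) ⊕ (q₁ ⊕ q₂ ⊕ q₅ ⊕ q₅' ⊕ q₆) ≡ ((q₁ ⊕ q₅) ⊕ q₃) ⊕ ((q₂ ⊕ q₈) ⊕ q₆) ⊕ (q₅' ⊕ q₇)
    lem₂ = solve-∀

-- The counterpart of e_k(x₀, x') = e_k(x') + x₀ e_(k-1)(x'), as `UD` is that of h_k(x₀, x') =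
-- h_k(x') + x₀ h_(k-1)(x₀, x'). This is why the second term has `U⁻` inside `W` here, but outside
-- `D` there.
UW : ∀ k φ xs → Altₛ φ →
     U k (W φ) (xs ++ 0 ∷ []) ≡ W (λ e → U k (φ e)) (xs ++ 0 ∷ []) ⊕ W (λ e → U⁻ k (φ (suc e))) (xs ++ 0 ∷ [])
UW zero    φ xs al = sym (≡.trans (cong (W φ (xs ++ 0 ∷ []) ⊕_) (W-0 (xs ++ 0 ∷ []))) (ℤₚ.+-identityʳ _))
UW (suc k) φ [] al = ≡.trans (U-single (suc k) (W φ) 0)
  (sym (cong₂ _⊕_ (U-single (suc k) (φ 0) 0) (U-single k (φ 1) 0)))
UW (suc k) φ (zero ∷ xs) al = ≡.trans (alt-dup (alt-U (suc k) (alt-W al)) 0 xs)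
  (sym (cong₂ _⊕_ (alt-dup (alt-W (λ e → alt-U (suc k) (al e))) 0 xs)
                  (alt-dup (alt-W (λ e → alt-U k (al (suc e)))) 0 xs)))
UW (suc k) φ (suc x ∷ xs) al = begin
  U (suc k) (λ zs → W φ (suc x ∷ zs)) ys ⊕ U k (W φ) (suc (suc x) ∷ ys)
    ≡⟨ cong₂ _⊕_ (U-+ (suc k) (W (suc x ▹ φ)) (W (x ▹ sh φ)) ys) (UW k φ (suc (suc x) ∷ xs) al) ⟩
  (U (suc k) (W (suc x ▹ φ)) ys ⊕ U (suc k) (W (x ▹ sh φ)) ys) ⊕ ((e ⊕ f) ⊕ (g ⊕ h))
    ≡⟨ cong (_⊕ ((e ⊕ f) ⊕ (g ⊕ h))) (cong₂ _⊕_ (UW (suc k) (suc x ▹ φ) xs (λ e t → al e (there t)))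
                                                  (UW (suc k) (x ▹ sh φ) xs (λ e t → al (suc e) (there t)))) ⟩
  ((a ⊕ b) ⊕ (c ⊕ d)) ⊕ ((e ⊕ f) ⊕ (g ⊕ h))
    ≡⟨ alg a b c d e f g h ⟩
  ((a ⊕ e) ⊕ (c ⊕ f)) ⊕ ((b ⊕ g) ⊕ (d ⊕ h))
    ≡⟨ sym (cong₂ _⊕_
         (cong₂ _⊕_ (W-+ (λ e → U (suc k) ((suc x ▹ φ) e)) _ ys) (W-+ (λ e → U (suc k) ((x ▹ sh φ) e)) _ ys))
         (cong₂ _⊕_ (≡.trans (W-cong ys (λ e zs _ → U-∷ k (φ (suc e)) (suc x) zs)) (W-+ (λ e → U k ((suc x ▹ sh φ) e)) _ ys))
                    (≡.trans (W-cong ys (λ e zs _ → U-∷ k (φ (suc (suc e))) x zs)) (W-+ (λ e → U k ((x ▹ sh (sh φ)) e)) _ ys)))) ⟩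
  W (λ e → U (suc k) (φ e)) (suc x ∷ ys) ⊕ W (λ e → U k (φ (suc e))) (suc x ∷ ys) ∎
  where
  open ≡-Reasoning
  ys = xs ++ 0 ∷ []
  a = W (λ e → U (suc k) ((suc x ▹ φ) e)) ys
  b = W (λ e → U k ((suc x ▹ sh φ) e)) ys
  c = W (λ e → U (suc k) ((x ▹ sh φ) e)) ys
  d = W (λ e → U k ((x ▹ sh (sh φ)) e)) ys
  e = W (λ e zs → U k (φ e) (suc (suc x) ∷ zs)) ys
  f = W (λ e zs → U k (φ (suc e)) (suc x ∷ zs)) ys
  g = W (λ e zs → U⁻ k (φ (suc e)) (suc (suc x) ∷ zs)) ys
  h = W (λ e zs → U⁻ k (φ (suc (suc e))) (suc x ∷ zs)) ys
  alg : ∀ a b c d e f g h → ((a ⊕ b) ⊕ (c ⊕ d)) ⊕ ((e ⊕ f) ⊕ (g ⊕ h)) ≡ ((a ⊕ e) ⊕ (c ⊕ f)) ⊕ ((b ⊕ g) ⊕ (d ⊕ h))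
  alg = solve-∀

-- The relation between the operators `U` and `V`

altsum : (ℕ → ℕ → ℤ) → ℕ → ℤ
altsum S zero    = S 0 0
altsum S (suc k) = S 0 (suc k) ⊖ altsum (λ l m → S (suc l) m) k

altsum-cong : ∀ {S T : ℕ → ℕ → ℤ} k → (∀ l m → S l m ≡ T l m) → altsum S k ≡ altsum T k
altsum-cong zero    eq = eq 0 0
altsum-cong (suc k) eq = cong₂ _⊖_ (eq 0 (suc k)) (altsum-cong k (λ l → eq (suc l)))

altsum-+ : ∀ (S T : ℕ → ℕ → ℤ) k → altsum (λ l m → S l m ⊕ T l m) k ≡ altsum S k ⊕ altsum T k
altsum-+ S T zero    = refl
altsum-+ S T (suc k) = ≡.trans (cong (S 0 (suc k) ⊕ T 0 (suc k) ⊖_) (altsum-+ (λ l → S (suc l)) (λ l → T (suc l)) k))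
  (lem (S 0 (suc k)) (T 0 (suc k)) _ _)
  where
  lem : ∀ a b c d → a ⊕ b ⊖ (c ⊕ d) ≡ (a ⊖ c) ⊕ (b ⊖ d)
  lem = solve-∀

altsum-0 : ∀ k → altsum (λ _ _ → 0ℤ) k ≡ 0ℤ
altsum-0 zero    = refl
altsum-0 (suc k) = cong (0ℤ ⊖_) (altsum-0 k)

predˡ predʳ : (ℕ → ℕ → ℤ) → ℕ → ℕ → ℤ
predˡ Q zero    m = 0ℤ
predˡ Q (suc l) m = Q l m
predʳ Q l zero    = 0ℤ
predʳ Q l (suc m) = Q l m

altsum-predʳ : ∀ Q k → altsum (predʳ Q) (suc k) ≡ altsum Q k
altsum-predʳ Q zero    = ℤₚ.+-identityʳ _
altsum-predʳ Q (suc k) = cong (Q 0 (suc k) ⊖_)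
  (≡.trans (altsum-cong {λ l → predʳ Q (suc l)} {predʳ (λ l → Q (suc l))} (suc k) (λ { l zero → refl ; l (suc m) → refl })) (altsum-predʳ (λ l → Q (suc l)) k))

V⁻ : ℕ → (List ℕ → ℤ) → List ℕ → ℤ
V⁻ zero    φ xs = 0ℤ
V⁻ (suc k) φ xs = V k φ xs

V-∷ : ∀ k φ x xs → V k φ (x ∷ xs) ≡ V k (λ ys → φ (x ∷ ys)) xs ⊕ V⁻ k (λ ys → φ (suc x ∷ ys)) xs
V-∷ zero    φ x xs = sym (ℤₚ.+-identityʳ _)
V-∷ (suc k) φ x xs = refl

V-0 : ∀ k xs → V k (λ _ → 0ℤ) xs ≡ 0ℤ
V-0 zero    xs       = refl
V-0 (suc k) []       = refl
V-0 (suc k) (x ∷ xs) = cong₂ _⊕_ (V-0 (suc k) xs) (V-0 k xs)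

-- This is Σ (-1)^l e_l h_m = 0 in the commuting shifts of the coordinates. In the induction on the
-- number of coordinates, a term `Q` with raised first coordinate arises once from a raise by `U`
-- and once from a raise by `V`, with l differing by one, and cancels.
VU-altsum : ∀ k φ xs → altsum (λ l m → V l (U m φ) xs) (suc k) ≡ 0ℤ
VU-altsum k φ [] = cong (0ℤ ⊖_) (altsum-0 k)
VU-altsum k φ (x ∷ xs) = begin
  altsum (λ l m → V l (U m φ) (x ∷ xs)) (suc k)
    ≡⟨ altsum-cong (suc k) split ⟩
  altsum (λ l m → V l (U m (λ ys → φ (x ∷ ys))) xs ⊕ (predʳ Q l m ⊕ predˡ Q l m)) (suc k)
    ≡⟨ altsum-+ (λ l m → V l (U m (λ ys → φ (x ∷ ys))) xs) (λ l m → predʳ Q l m ⊕ predˡ Q l m) (suc k) ⟩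
  altsum (λ l m → V l (U m (λ ys → φ (x ∷ ys))) xs) (suc k) ⊕ altsum (λ l m → predʳ Q l m ⊕ predˡ Q l m) (suc k)
    ≡⟨ cong₂ _⊕_ (VU-altsum k (λ ys → φ (x ∷ ys)) xs) (altsum-+ (predʳ Q) (predˡ Q) (suc k)) ⟩
  0ℤ ⊕ (altsum (predʳ Q) (suc k) ⊕ (0ℤ ⊖ altsum Q k))
    ≡⟨ cong (λ z → 0ℤ ⊕ (z ⊕ (0ℤ ⊖ altsum Q k))) (altsum-predʳ Q k) ⟩
  0ℤ ⊕ (altsum Q k ⊕ (0ℤ ⊖ altsum Q k))
    ≡⟨ lem (altsum Q k) ⟩
  0ℤ ∎
  where
  open ≡-Reasoning
  Q : ℕ → ℕ → ℤ
  Q l m = V l (λ ys → U m φ (suc x ∷ ys)) xs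
  lem : ∀ a → 0ℤ ⊕ (a ⊕ (0ℤ ⊖ a)) ≡ 0ℤ
  lem = solve-∀
  left : ∀ l m → V l (λ ys → U⁻ m φ (suc x ∷ ys)) xs ≡ predʳ Q l m
  left l zero    = V-0 l xs
  left l (suc m) = refl
  right : ∀ l m → V⁻ l (λ ys → U m φ (suc x ∷ ys)) xs ≡ predˡ Q l m
  right zero    m = refl
  right (suc l) m = refl
  split : ∀ l m → V l (U m φ) (x ∷ xs) ≡ V l (U m (λ ys → φ (x ∷ ys))) xs ⊕ (predʳ Q l m ⊕ predˡ Q l m)
  split l m = ≡.trans (V-∷ l (U m φ) x xs) (≡.trans
    (cong₂ _⊕_ (≡.trans (V-cong l xs (λ ys _ → U-∷ m φ x ys)) (≡.trans (V-+ l (U m (λ ys → φ (x ∷ ys))) _ xs)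
      (cong (V l (U m (λ ys → φ (x ∷ ys))) xs ⊕_) (left l m)))) (right l m))
    (ℤₚ.+-assoc (V l (U m (λ ys → φ (x ∷ ys))) xs) _ _))

-- Sorting with signs

data Sgn : Set where
  pos neg : Sgn

act : Sgn → ℤ → ℤ
act pos z = z
act neg z = ⊝ z

act-0 : ∀ s → act s 0ℤ ≡ 0ℤ
act-0 pos = refl
act-0 neg = refl

flip : Sgn → Sgn
flip pos = neg
flip neg = pos

act-flip : ∀ s z → ⊝ act s z ≡ act (flip s) z
act-flip pos z = refl
act-flip neg z = ℤₚ.neg-involutive z

_·_ : Sgn → Sgn → Sgn
pos · t = t
neg · t = flip t

act-· : ∀ s t z → act s (act t z) ≡ act (s · t) z
act-· pos t z = refl
act-· neg t z = act-flip t z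

-- The sign is chosen before `φ`: one sign must serve all numbers of variables and all test
-- functions at once.
↭-sgn : ∀ {xs ys} → xs ↭ ys → Σ Sgn λ s → ∀ φ → Alt φ → φ xs ≡ act s (φ ys)
↭-sgn refl = pos , λ _ _ → refl
↭-sgn (prep x p) with ↭-sgn p
... | s , eq = s , λ φ al → eq (λ ys → φ (x ∷ ys)) (λ t → al (there t))
↭-sgn (swap x y p) with ↭-sgn p
... | s , eq = flip s , λ φ al → ≡.trans (al here)
  (≡.trans (cong ⊝_ (eq (λ ys → φ (y ∷ x ∷ ys)) (λ t → al (there (there t))))) (act-flip s _))
↭-sgn (trans p q) with ↭-sgn p | ↭-sgn q
... | s , eq | t , eq' = s · t , λ φ al → ≡.trans (eq φ al) (≡.trans (cong (act s) (eq' φ al)) (act-· s t _))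

Vanishing : List ℕ → Set
Vanishing xs = ∀ φ → Alt φ → φ xs ≡ 0ℤ

vanishing-↭ : ∀ {xs ys} → xs ↭ ys → Vanishing ys → Vanishing xs
vanishing-↭ p v φ al with ↭-sgn p
... | s , eq = ≡.trans (eq φ al) (≡.trans (cong (act s) (v φ al)) (act-0 s))

vanishing-∷ : ∀ x {xs} → Vanishing xs → Vanishing (x ∷ xs)
vanishing-∷ x v φ al = v (λ ys → φ (x ∷ ys)) (λ t → al (there t))

insert : ∀ x ys → AllPairs _>_ ys → Vanishing (x ∷ ys) ⊎ Σ (List ℕ) λ zs → (x ∷ ys) ↭ zs × AllPairs _>_ zs
insert x [] [] = inj₂ (x ∷ [] , refl , [] ∷ [])
insert x (y ∷ ys) (py ∷ pys) with ℕₚ.<-cmp x y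
... | tri> _ _ y<x = inj₂ (x ∷ y ∷ ys , refl , (y<x ∷ All.map (λ z<y → ℕₚ.<-trans z<y y<x) py) ∷ py ∷ pys)
... | tri≈ _ refl _ = inj₁ (λ φ al → alt-adj al x ys)
... | tri< x<y _ _ with insert x ys pys
...   | inj₁ v = inj₁ (vanishing-↭ (swap x y refl) (vanishing-∷ y v))
...   | inj₂ (zs , p , sd) = inj₂ (y ∷ zs , trans (swap x y refl) (prep y p) , All-resp-↭ p (x<y ∷ py) ∷ sd)

sort↓ : ∀ xs → Vanishing xs ⊎ Σ (List ℕ) λ zs → xs ↭ zs × AllPairs _>_ zs
sort↓ [] = inj₂ ([] , refl , [])
sort↓ (x ∷ xs) with sort↓ xs
... | inj₁ v = inj₁ (vanishing-∷ x v)
... | inj₂ (ys , p , sd) with insert x ys sd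
...   | inj₁ v = inj₁ (vanishing-↭ (prep x p) v)
...   | inj₂ (zs , q , sd') = inj₂ (zs , trans (prep x p) q , sd')

-- Weakly decreasing lists and their beta numbers

WD : List ℕ → Set
WD ls = ∀ k → at ls (suc k) ≤ at ls k

wd-[] : WD []
wd-[] k = z≤n

wd-∷ : ∀ {l ls} → at ls 0 ≤ l → WD ls → WD (l ∷ ls)
wd-∷ h wd zero    = h
wd-∷ h wd (suc k) = wd k

wd-tail : ∀ {l ls} → WD (l ∷ ls) → WD ls
wd-tail wd k = wd (suc k)

at-≤-head : ∀ {ls} → WD ls → ∀ k → at ls k ≤ at ls 0
at-≤-head wd zero         = ℕₚ.≤-refl
at-≤-head {ls} wd (suc k) = ℕₚ.≤-trans (wd k) (at-≤-head {ls} wd k)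

at-mono : ∀ {ls} → WD ls → ∀ {k m} → k ≤ m → at ls m ≤ at ls k
at-mono {ls} wd {k} {m} k≤m with ℕₚ.m≤n⇒∃[o]m+o≡n k≤m
... | o , refl = go o
  where
  go : ∀ o → at ls (k + o) ≤ at ls k
  go zero    = ℕₚ.≤-reflexive (cong (at ls) (ℕₚ.+-identityʳ k))
  go (suc o) = ℕₚ.≤-trans (ℕₚ.≤-reflexive (cong (at ls) (ℕₚ.+-suc k o))) (ℕₚ.≤-trans (wd (k + o)) (go o))

at-beyond : ∀ ls k → length ls ≤ k → at ls k ≡ 0
at-beyond []       k       _       = refl
at-beyond (l ∷ ls) (suc k) (s≤s h) = at-beyond ls k h

head0-at : ∀ ls → head0 ls ≡ at ls 0
head0-at []      = refl
head0-at (_ ∷ _) = refl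

-- The beta numbers λ_k + (length λ − k), k = 1, …, length λ.
β : List ℕ → List ℕ
β []       = []
β (x ∷ xs) = x + length xs ∷ β xs

length-β : ∀ xs → length (β xs) ≡ length xs
length-β []       = refl
length-β (x ∷ xs) = cong suc (length-β xs)

SD⇒β : ∀ {zs} → AllPairs _>_ zs → Σ (List ℕ) λ ls → WD ls × zs ≡ β ls
SD⇒β [] = [] , wd-[] , refl
SD⇒β {z ∷ zs} (pz ∷ sd) with SD⇒β sd
SD⇒β {z ∷ _} (pz ∷ sd) | [] , wd , refl = z ∷ [] , wd-∷ z≤n wd-[] , cong (_∷ []) (sym (ℕₚ.+-identityʳ z))
SD⇒β {z ∷ _} ((l<z ∷ _) ∷ sd) | l ∷ ls , wd , refl =
  z ∸ suc (length ls) ∷ l ∷ ls ,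
  wd-∷ (ℕₚ.m+n≤o⇒m≤o∸n l (ℕₚ.≤-trans (ℕₚ.≤-reflexive (ℕₚ.+-suc l (length ls))) l<z)) wd ,
  cong (_∷ β (l ∷ ls)) (sym (ℕₚ.m∸n+n≡m (ℕₚ.≤-trans (s≤s (ℕₚ.m≤n+m (length ls) l)) l<z)))

β-sort : ∀ xs → Vanishing xs ⊎ Σ (List ℕ) λ ls → WD ls × length ls ≡ length xs × xs ↭ β ls
β-sort xs with sort↓ xs
... | inj₁ v = inj₁ v
... | inj₂ (zs , p , sd) with SD⇒β sd
...   | ls , wd , refl = inj₂ (ls , wd , ≡.trans (sym (length-β ls)) (sym (↭-length p)) , p)

-- Shape conditions as counts of coordinates above a threshold

ge : ℕ → ℕ → ℕ
ge zero    x       = 1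
ge (suc c) zero    = 0
ge (suc c) (suc x) = ge c x

cnt : ℕ → List ℕ → ℕ
cnt c []       = 0
cnt c (x ∷ xs) = ge c x + cnt c xs

ge-yes : ∀ {c x} → c ≤ x → ge c x ≡ 1
ge-yes z≤n     = refl
ge-yes (s≤s h) = ge-yes h

ge-no : ∀ {c x} → x < c → ge c x ≡ 0
ge-no {suc c} {zero}  _       = refl
ge-no {suc c} {suc x} (s≤s h) = ge-no h

ge-≤1 : ∀ c x → ge c x ≤ 1
ge-≤1 zero    x       = ℕₚ.≤-refl
ge-≤1 (suc c) zero    = z≤n
ge-≤1 (suc c) (suc x) = ge-≤1 c x

ge-mono : ∀ c {x y} → x ≤ y → ge c x ≤ ge c y
ge-mono zero    h       = ℕₚ.≤-refl
ge-mono (suc c) z≤n     = z≤n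
ge-mono (suc c) (s≤s h) = ge-mono c h

cnt-mono : ∀ c {xs ys} → Pointwise _≤_ xs ys → cnt c xs ≤ cnt c ys
cnt-mono c []      = z≤n
cnt-mono c (h ∷ p) = ℕₚ.+-mono-≤ (ge-mono c h) (cnt-mono c p)

cnt-↭ : ∀ c {xs ys} → xs ↭ ys → cnt c xs ≡ cnt c ys
cnt-↭ c refl         = refl
cnt-↭ c (prep x p)   = cong (ge c x +_) (cnt-↭ c p)
cnt-↭ c (swap {xs} x y p) = ≡.trans (sym (ℕₚ.+-assoc (ge c x) (ge c y) _))
  (≡.trans (cong₂ _+_ (ℕₚ.+-comm (ge c x) (ge c y)) (cnt-↭ c p)) (ℕₚ.+-assoc (ge c y) (ge c x) _))
cnt-↭ c (trans p q)  = ≡.trans (cnt-↭ c p) (cnt-↭ c q)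

cnt-≤-length : ∀ c xs → cnt c xs ≤ length xs
cnt-≤-length c []       = z≤n
cnt-≤-length c (x ∷ xs) = ℕₚ.+-mono-≤ (ge-≤1 c x) (cnt-≤-length c xs)

private
  drop-suc : ∀ {c p v n} → c + suc (suc p) ≡ v + suc n → c + suc p ≡ v + n
  drop-suc {c} {p} {v} {n} e = ℕₚ.suc-injective (≡.trans (sym (ℕₚ.+-suc c (suc p))) (≡.trans e (ℕₚ.+-suc v n)))

  drop-one : ∀ {c v n} → c + 1 ≡ v + suc n → c ≡ v + n
  drop-one {c} {v} {n} e = ℕₚ.suc-injective (≡.trans (≡.trans (cong suc (sym (ℕₚ.+-identityʳ c))) (sym (ℕₚ.+-suc c 0))) (≡.trans e (ℕₚ.+-suc v n)))

-- Beta numbers decrease strictly, so row `p` has length at least `v` iff the first p + 1 of them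
-- reach the value c = v + (length - p - 1). The count is blind to the order, hence meaningful for
-- unsorted vectors; the equation for `c` avoids truncated subtraction.
at⇒cnt : ∀ ls p {v c} → WD ls → p < length ls → c + suc p ≡ v + length ls → v ≤ at ls p → suc p ≤ cnt c (β ls)
at⇒cnt (l ∷ ls) zero {v} {c} wd _ e v≤l = ℕₚ.≤-trans (ℕₚ.≤-reflexive (sym (ge-yes c≤))) (ℕₚ.m≤m+n _ _)
  where
  c≤ : c ≤ l + length ls
  c≤ = ℕₚ.≤-trans (ℕₚ.≤-reflexive (drop-one {c} {v} e)) (ℕₚ.+-monoˡ-≤ (length ls) v≤l)
at⇒cnt (l ∷ ls) (suc p) {v} {c} wd (s≤s p<) e v≤ = ℕₚ.+-mono-≤ (ℕₚ.≤-reflexive (sym (ge-yes c≤))) (at⇒cnt ls p (wd-tail {l} wd) p< e' v≤)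
  where
  e' = drop-suc {c} {p} {v} e
  c≤ : c ≤ l + length ls
  c≤ = ℕₚ.≤-trans (ℕₚ.m≤m+n c (suc p)) (ℕₚ.≤-trans (ℕₚ.≤-reflexive e')
         (ℕₚ.+-monoˡ-≤ (length ls) (ℕₚ.≤-trans v≤ (at-≤-head {l ∷ ls} wd (suc p)))))

cnt-zero : ∀ ls {c} → WD ls → at ls 0 + length ls ≤ c → cnt c (β ls) ≡ 0
cnt-zero []       wd h = refl
cnt-zero (l ∷ ls) {c} wd h = cong₂ _+_ (ge-no h')
  (cnt-zero ls (wd-tail {l} wd) (ℕₚ.≤-trans (ℕₚ.+-monoˡ-≤ (length ls) (wd 0)) (ℕₚ.<⇒≤ h')))
  where
  h' : l + length ls < c
  h' = ℕₚ.≤-trans (ℕₚ.≤-reflexive (sym (ℕₚ.+-suc l (length ls)))) h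

cnt⇒at : ∀ ls p {v c} → WD ls → p < length ls → c + suc p ≡ v + length ls → suc p ≤ cnt c (β ls) → v ≤ at ls p
cnt⇒at (l ∷ ls) zero {v} {c} wd _ e h with v ℕ.≤? l
... | yes v≤l = v≤l
... | no  v≰l = ⊥-elim (ℕₚ.<⇒≱ h (ℕₚ.≤-reflexive (cnt-zero (l ∷ ls) wd
  (ℕₚ.≤-trans (ℕₚ.≤-reflexive (ℕₚ.+-suc l (length ls)))
    (ℕₚ.≤-trans (ℕₚ.+-monoˡ-≤ (length ls) (ℕₚ.≰⇒> v≰l)) (ℕₚ.≤-reflexive (sym (drop-one {c} {v} e))))))))
cnt⇒at (l ∷ ls) (suc p) {v} {c} wd (s≤s p<) e h = cnt⇒at ls p (wd-tail {l} wd) p< (drop-suc {c} {p} {v} e)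
  (ℕₚ.+-cancelˡ-≤ 1 _ _ (ℕₚ.≤-trans h (ℕₚ.+-monoˡ-≤ _ (ge-≤1 c (l + length ls)))))

β-extract : ∀ α i → i < length α → Σ (List ℕ) λ ys → β α ↭ (at α i + (length α ∸ suc i)) ∷ ys
β-extract (a ∷ α) zero    _       = β α , refl
β-extract (a ∷ α) (suc i) (s≤s h) with β-extract α i h
... | ys , p = (a + length α) ∷ ys , trans (prep _ p) (swap _ _ refl)

-- Since `j` is less than the number of coordinates, some coordinate can be spared. If removing the
-- head spoils the count, the head was counted and the spare coordinate lies in the tail.
cnt-extract : ∀ c xs j m → length xs ≡ suc m → j ≤ m → j ≤ cnt c xs →
              Σ ℕ λ q → Σ (List ℕ) λ ys → xs ↭ q ∷ ys × j ≤ cnt c ys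
cnt-extract c (a ∷ xs) j m l j≤m h with j ℕ.≤? cnt c xs
... | yes h' = a , xs , refl , h'
cnt-extract c (a ∷ xs) zero m l j≤m h | no ¬h = ⊥-elim (¬h z≤n)
cnt-extract c (a ∷ xs) (suc j) (suc m) l (s≤s j≤m) h | no ¬h
  with cnt-extract c xs j m (ℕₚ.suc-injective l) j≤m (ℕₚ.+-cancelˡ-≤ 1 _ _ (ℕₚ.≤-trans h (ℕₚ.+-monoˡ-≤ _ (ge-≤1 c a))))
... | q , ys , p , h' = q , a ∷ ys , trans (prep a p) (swap a q refl) ,
  ℕₚ.≤-trans (s≤s h') (ℕₚ.≤-reflexive (cong (_+ cnt c ys) (sym a-counted)))
  where
  a-counted : ge c a ≡ 1
  a-counted with c ℕ.≤? a
  ... | yes c≤a = ge-yes c≤a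
  ... | no c≰a = ⊥-elim (¬h (subst (λ z → suc j ≤ z + cnt c xs) (ge-no (ℕₚ.≰⇒> c≰a)) h))

-- A polynomial Σ a x^α is identified with the functional f ↦ Σ a f(α), and a
-- symmetric function with the family of these functionals over all N.

Fam : Set
Fam = (N : ℕ) → (Vec ℕ N → ℤ) → ℤ

infixr 7 _⊛_
_⊛_ : Fam → Fam → Fam
(p ⊛ q) N f = p N (λ α → q N (λ γ → f (zipWith _+_ α γ)))

-- The argument of `A` is a vector of beta numbers, of row lengths or of column lengths, and
-- `A (k ∷ [])` is h_k or e_k accordingly. The final 0 in `pieri` is an empty last row, room for the
-- one row that a strip may create; `drop` says that such a row changes nothing.
record Side : Set where
  field
    A     : List ℕ → Fam
    lin   : ∀ xs N → Linear (A xs N)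
    alt   : ∀ N f → Alt (λ xs → A xs N f)
    drop  : ∀ xs N f → A (map suc xs ++ 0 ∷ []) N f ≡ A xs N f
    pieri : ∀ k xs N f → (A (k ∷ []) ⊛ A (xs ++ 0 ∷ [])) N f ≡ U k (λ ys → A ys N f) (xs ++ 0 ∷ [])

-- In 0 variables the alternating function of x is the sign of x as a
-- permutation of {length x ∸ 1,…,0}, and 0 if x is not one.

sg : ℕ → ℕ → ℤ
sg zero    zero    = 0ℤ
sg zero    (suc y) = ⊝ 1ℤ
sg (suc x) zero    = 1ℤ
sg (suc x) (suc y) = sg x y

sg-anti : ∀ x y → sg x y ≡ ⊝ sg y x
sg-anti zero    zero    = refl
sg-anti zero    (suc y) = refl
sg-anti (suc x) zero    = refl
sg-anti (suc x) (suc y) = sg-anti x y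

sgs : ℕ → List ℕ → ℤ
sgs x []       = 1ℤ
sgs x (y ∷ ys) = sg x y ⊗ sgs x ys

vand : List ℕ → ℤ
vand []       = 1ℤ
vand (x ∷ xs) = sgs x xs ⊗ vand xs

lt : ℕ → ℕ → ℤ
lt x       zero    = 0ℤ
lt zero    (suc r) = 1ℤ
lt (suc x) (suc r) = lt x r

below : ℕ → List ℕ → ℤ
below r []       = 1ℤ
below r (x ∷ xs) = lt x r ⊗ below r xs

base : List ℕ → ℤ
base xs = below (length xs) xs ⊗ vand xs

sgs-swap : ∀ x {xs ys} → Swap xs ys → sgs x xs ≡ sgs x ys
sgs-swap x (here {a} {b} {xs}) = lem (sg x a) (sg x b) (sgs x xs)
  where
  lem : ∀ a b c → a ⊗ (b ⊗ c) ≡ b ⊗ (a ⊗ c)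
  lem = solve-∀
sgs-swap x (there {a} s) = cong (sg x a ⊗_) (sgs-swap x s)

below-swap : ∀ r {xs ys} → Swap xs ys → below r xs ≡ below r ys
below-swap r (here {a} {b} {xs}) = lem (lt a r) (lt b r) (below r xs)
  where
  lem : ∀ a b c → a ⊗ (b ⊗ c) ≡ b ⊗ (a ⊗ c)
  lem = solve-∀
below-swap r (there {a} s) = cong (lt a r ⊗_) (below-swap r s)

alt-vand : Alt vand
alt-vand (here {a} {b} {xs}) = ≡.trans (cong (λ z → z ⊗ sgs a xs ⊗ (sgs b xs ⊗ vand xs)) (sg-anti a b))
  (lem (sg b a) (sgs a xs) (sgs b xs) (vand xs))
  where
  lem : ∀ s a b c → (⊝ s ⊗ a) ⊗ (b ⊗ c) ≡ ⊝ ((s ⊗ b) ⊗ (a ⊗ c))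
  lem = solve-∀
alt-vand (there {a} {xs} {ys} s) = ≡.trans (cong₂ _⊗_ (sgs-swap a s) (alt-vand s))
  (sym (ℤₚ.neg-distribʳ-* (sgs a ys) (vand ys)))

swap-length : ∀ {xs ys} → Swap xs ys → length xs ≡ length ys
swap-length here      = refl
swap-length (there s) = cong suc (swap-length s)

alt-base : Alt base
alt-base {xs} {ys} s = ≡.trans
  (cong₂ _⊗_ (≡.trans (cong (λ r → below r xs) (swap-length s)) (below-swap (length ys) s)) (alt-vand s))
  (sym (ℤₚ.neg-distribʳ-* (below (length ys) ys) (vand ys)))

alt-base-⊗ : ∀ c → Alt (λ xs → base xs ⊗ c)
alt-base-⊗ c {xs} {ys} s = ≡.trans (cong (_⊗ c) (alt-base s)) (sym (ℤₚ.neg-distribˡ-* (base ys) c))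

base-drop : ∀ xs → base (map suc xs ++ 0 ∷ []) ≡ base xs
base-drop xs = cong₂ _⊗_ (≡.trans (cong (λ r → below r (map suc xs ++ 0 ∷ [])) (len xs)) (below-drop (length xs) xs)) (vand-drop xs)
  where
  len : ∀ xs → length (map suc xs ++ 0 ∷ []) ≡ suc (length xs)
  len []       = refl
  len (x ∷ xs) = cong suc (len xs)
  below-drop : ∀ r xs → below (suc r) (map suc xs ++ 0 ∷ []) ≡ below r xs
  below-drop r []       = refl
  below-drop r (x ∷ xs) = cong (lt x r ⊗_) (below-drop r xs)
  sgs-drop : ∀ x xs → sgs (suc x) (map suc xs ++ 0 ∷ []) ≡ sgs x xs
  sgs-drop x []       = refl
  sgs-drop x (y ∷ ys) = cong (sg x y ⊗_) (sgs-drop x ys)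
  vand-drop : ∀ xs → vand (map suc xs ++ 0 ∷ []) ≡ vand xs
  vand-drop []       = refl
  vand-drop (x ∷ xs) = cong₂ _⊗_ (sgs-drop x xs) (vand-drop xs)

lt-no : ∀ {x r} → r ≤ x → lt x r ≡ 0ℤ
lt-no z≤n             = refl
lt-no {suc x} (s≤s h) = lt-no h

lt-yes : ∀ {x r} → x < r → lt x r ≡ 1ℤ
lt-yes {zero}  {suc r} _       = refl
lt-yes {suc x} {suc r} (s≤s h) = lt-yes h

base-β-pos : ∀ l ls → 1 ≤ l → base (β (l ∷ ls)) ≡ 0ℤ
base-β-pos l ls 1≤l = cong (λ z → z ⊗ below (suc (length (β ls))) (β ls) ⊗ vand (β (l ∷ ls)))
  (lt-no (ℕₚ.≤-trans (ℕₚ.≤-reflexive (cong suc (length-β ls))) (ℕₚ.+-monoˡ-≤ (length ls) 1≤l)))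

staircase : ℕ → ℕ
staircase n = sum (β (replicate n 0))

wd-zero : ∀ ls → WD ls → at ls 0 ≡ 0 → ls ≡ replicate (length ls) 0
wd-zero []       wd h    = refl
wd-zero (.0 ∷ ls) wd refl = cong (0 ∷_) (wd-zero ls (wd-tail {0} wd) (ℕₚ.n≤0⇒n≡0 (wd 0)))

staircase-≤ : ∀ ls → staircase (length ls) ≤ sum (β ls)
staircase-≤ []       = z≤n
staircase-≤ (l ∷ ls) = ℕₚ.+-mono-≤
  (ℕₚ.≤-trans (ℕₚ.≤-reflexive (L.length-replicate (length ls))) (ℕₚ.m≤n+m _ l)) (staircase-≤ ls)

-- Sorting gives either a repetition or the beta numbers of a nonempty shape, whose first entry is
-- too large for a permutation of 0, ..., length - 1.
base-zero : ∀ xs → staircase (length xs) < sum xs → base xs ≡ 0ℤ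
base-zero xs h with β-sort xs
... | inj₁ v = v base alt-base
... | inj₂ ([] , wd , len , p) = ⊥-elim (ℕₚ.<⇒≱ h (ℕₚ.≤-trans (ℕₚ.≤-reflexive (sum-↭ p)) z≤n))
... | inj₂ (zero ∷ ls , wd , len , p) = ⊥-elim (ℕₚ.<-irrefl (≡.trans (cong staircase (sym len))
        (≡.trans (cong (λ z → sum (β z)) (sym (wd-zero (0 ∷ ls) wd refl))) (sym (sum-↭ p)))) h)
... | inj₂ (suc l ∷ ls , wd , len , p) with ↭-sgn p
...   | s , eq = ≡.trans (eq base alt-base) (≡.trans (cong (act s) (base-β-pos (suc l) ls (s≤s z≤n))) (act-0 s))

U-sum-zero : ∀ k φ xs → (∀ ys → length ys ≡ length xs → sum ys ≡ k + sum xs → φ ys ≡ 0ℤ) → U k φ xs ≡ 0ℤ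
U-sum-zero zero    φ xs       h = h xs refl refl
U-sum-zero (suc k) φ []       h = refl
U-sum-zero (suc k) φ (x ∷ xs) h = cong₂ _⊕_
  (U-sum-zero (suc k) (λ ys → φ (x ∷ ys)) xs (λ ys l e → h (x ∷ ys) (cong suc l)
    (≡.trans (cong (x +_) e) (lem x (suc k) (sum xs)))))
  (U-sum-zero k φ (suc x ∷ xs) (λ ys l e → h ys l (≡.trans e (ℕₚ.+-suc k _))))
  where
  lem : ∀ x k s → x + (k + s) ≡ k + (x + s)
  lem x k s = ≡.trans (sym (ℕₚ.+-assoc x k s)) (≡.trans (cong (_+ s) (ℕₚ.+-comm x k)) (ℕₚ.+-assoc k x s))

-- h_(k+1) and e_(k+1) vanish in no variables. Once `xs` is sorted its sum is at least that of the
-- staircase, so every raised vector exceeds it.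
U-base : ∀ k c xs → U (suc k) (λ ys → base ys ⊗ c) xs ≡ 0ℤ
U-base k c xs = go (β-sort xs)
  where
  φ : List ℕ → ℤ
  φ ys = base ys ⊗ c
  go : _ → U (suc k) φ xs ≡ 0ℤ
  go (inj₁ v) = v _ (alt-U (suc k) (alt-base-⊗ c))
  go (inj₂ (ls , wd , len , p)) with ↭-sgn p
  ... | s , eq = ≡.trans (eq _ (alt-U (suc k) (alt-base-⊗ c))) (≡.trans (cong (act s)
        (U-sum-zero (suc k) φ (β ls) (λ ys l e → cong (_⊗ c) (base-zero ys
          (ℕₚ.≤-trans (s≤s (ℕₚ.≤-trans (ℕₚ.≤-reflexive (cong staircase (≡.trans l (length-β ls))))
            (ℕₚ.≤-trans (staircase-≤ ls) (ℕₚ.m≤n+m _ k)))) (ℕₚ.≤-reflexive (sym e))))))) (act-0 s))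

base-linear : ∀ c → Linear {Vec ℕ 0} (λ f → c ⊗ f [])
base-linear c = record
  { ext = λ eq → cong (c ⊗_) (eq [])
  ; add = λ f g → ℤₚ.*-distribˡ-+ c (f []) (g []) }

base-pieri : ∀ k xs c → base (k ∷ []) ⊗ (base (xs ++ 0 ∷ []) ⊗ c) ≡ U k (λ ys → base ys ⊗ c) (xs ++ 0 ∷ [])
base-pieri zero    xs c = ℤₚ.*-identityˡ _
base-pieri (suc k) xs c = sym (U-base k c (xs ++ 0 ∷ []))

-- The alternating functions of rows and of columns, and their Pieri rules

bump : ∀ {N} → Vec ℕ (suc N) → Vec ℕ (suc N)
bump (d ∷ α) = suc d ∷ α

rowA : List ℕ → Fam
rowA xs zero    f = base xs ⊗ f []
rowA xs (suc N) f = D (λ e ys → rowA ys N (λ α → f (e ∷ α))) xs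

-- A horizontal strip has at most one box in each column, hence the 0/1 lowerings.
colA : List ℕ → Fam
colA xs zero    f = base xs ⊗ f []
colA xs (suc N) f = W (λ e ys → colA ys N (λ α → f (e ∷ α))) xs

row-linear : ∀ xs N → Linear (rowA xs N)
row-linear xs zero    = base-linear (base xs)
row-linear xs (suc N) = record
  { ext = λ eq → D-cong xs (λ e ys _ → Linear.ext (row-linear ys N) (λ α → eq (e ∷ α)))
  ; add = λ f g → ≡.trans (D-cong xs (λ e ys _ → Linear.add (row-linear ys N) (λ α → f (e ∷ α)) (λ α → g (e ∷ α))))
                          (D-+ _ _ xs) }

col-linear : ∀ xs N → Linear (colA xs N)
col-linear xs zero    = base-linear (base xs)
col-linear xs (suc N) = record
  { ext = λ eq → W-cong xs (λ e ys _ → Linear.ext (col-linear ys N) (λ α → eq (e ∷ α)))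
  ; add = λ f g → ≡.trans (W-cong xs (λ e ys _ → Linear.add (col-linear ys N) (λ α → f (e ∷ α)) (λ α → g (e ∷ α))))
                          (W-+ _ _ xs) }

row-alt : ∀ N f → Alt (λ xs → rowA xs N f)
row-alt zero    f = alt-base-⊗ (f [])
row-alt (suc N) f = alt-D (λ e → row-alt N (λ α → f (e ∷ α)))

col-alt : ∀ N f → Alt (λ xs → colA xs N f)
col-alt zero    f = alt-base-⊗ (f [])
col-alt (suc N) f = alt-W (λ e → col-alt N (λ α → f (e ∷ α)))

row-drop : ∀ xs N f → rowA (map suc xs ++ 0 ∷ []) N f ≡ rowA xs N f
row-drop xs zero    f = cong (_⊗ f []) (base-drop xs)
row-drop xs (suc N) f = ≡.trans (D-drop (λ e → row-alt N (λ α → f (e ∷ α))) xs)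
  (D-cong xs (λ e ys _ → row-drop ys N (λ α → f (e ∷ α))))

col-drop : ∀ xs N f → colA (map suc xs ++ 0 ∷ []) N f ≡ colA xs N f
col-drop xs zero    f = cong (_⊗ f []) (base-drop xs)
col-drop xs (suc N) f = ≡.trans (W-drop (λ e → col-alt N (λ α → f (e ∷ α))) xs)
  (W-cong xs (λ e ys _ → col-drop ys N (λ α → f (e ∷ α))))

row-pieri : ∀ k xs N f → (rowA (k ∷ []) ⊛ rowA (xs ++ 0 ∷ [])) N f ≡ U k (λ ys → rowA ys N f) (xs ++ 0 ∷ [])
row-pieri k xs zero    f = base-pieri k xs (f [])
row-pieri k xs (suc N) f = ≡.trans (go k) (sym (UD k φ xs (λ e → row-alt N (λ α → f (e ∷ α)))))
  where
  φ : Series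
  φ e ys = rowA ys N (λ α → f (e ∷ α))
  xs₀ = xs ++ 0 ∷ []
  g : Vec ℕ (suc N) → ℤ
  g α = rowA xs₀ (suc N) (λ γ → f (zipWith _+_ α γ))
  open ≡-Reasoning
  low : ∀ k → rowA (k ∷ []) N (λ α → g (0 ∷ α)) ≡ D (λ e → U k (φ e)) xs₀
  low k = begin
    rowA (k ∷ []) N (λ α → g (0 ∷ α))
      ≡⟨ Linear.ext (row-linear (k ∷ []) N) (λ α → D-++ _ xs) ⟩
    rowA (k ∷ []) N (λ α → D (λ e ys → rowA (ys ++ 0 ∷ []) N (λ γ → f (e ∷ zipWith _+_ α γ))) xs)
      ≡⟨ L-D (row-linear (k ∷ []) N) (λ α e ys → rowA (ys ++ 0 ∷ []) N (λ γ → f (e ∷ zipWith _+_ α γ))) xs ⟩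
    D (λ e ys → (rowA (k ∷ []) ⊛ rowA (ys ++ 0 ∷ [])) N (λ α → f (e ∷ α))) xs
      ≡⟨ D-cong xs (λ e ys _ → row-pieri k ys N (λ α → f (e ∷ α))) ⟩
    D (λ e ys → U k (φ e) (ys ++ 0 ∷ [])) xs
      ≡⟨ sym (D-++ (λ e → U k (φ e)) xs) ⟩
    D (λ e → U k (φ e)) xs₀ ∎
  go : ∀ k → rowA (k ∷ []) (suc N) g ≡ D (λ e → U k (φ e)) xs₀ ⊕ U⁻ k (D (sh φ)) xs₀
  go zero    = ≡.trans (low 0) (sym (ℤₚ.+-identityʳ _))
  -- `bump` is the factor x₀ in x₀ h_k(x₀, x'); this call lowers the degree and keeps the number of
  -- variables.
  go (suc k) = cong₂ _⊕_ (low (suc k)) (row-pieri k xs (suc N) (λ α → f (bump α)))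

col-pieri : ∀ k xs N f → (colA (k ∷ []) ⊛ colA (xs ++ 0 ∷ [])) N f ≡ U k (λ ys → colA ys N f) (xs ++ 0 ∷ [])
col-pieri k xs zero    f = base-pieri k xs (f [])
col-pieri k xs (suc N) f = ≡.trans (go k) (sym (UW k φ xs (λ e → col-alt N (λ α → f (e ∷ α)))))
  where
  φ : Series
  φ e ys = colA ys N (λ α → f (e ∷ α))
  xs₀ = xs ++ 0 ∷ []
  g : Vec ℕ (suc N) → ℤ
  g α = colA xs₀ (suc N) (λ γ → f (zipWith _+_ α γ))
  open ≡-Reasoning
  low : ∀ k d → colA (k ∷ []) N (λ α → g (d ∷ α)) ≡ W (λ e → U k (φ (d + e))) xs₀
  low k d = begin
    colA (k ∷ []) N (λ α → g (d ∷ α))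
      ≡⟨ Linear.ext (col-linear (k ∷ []) N) (λ α → W-++ _ xs) ⟩
    colA (k ∷ []) N (λ α → W (λ e ys → colA (ys ++ 0 ∷ []) N (λ γ → f (d + e ∷ zipWith _+_ α γ))) xs)
      ≡⟨ L-W (col-linear (k ∷ []) N) (λ α e ys → colA (ys ++ 0 ∷ []) N (λ γ → f (d + e ∷ zipWith _+_ α γ))) xs ⟩
    W (λ e ys → (colA (k ∷ []) ⊛ colA (ys ++ 0 ∷ [])) N (λ α → f (d + e ∷ α))) xs
      ≡⟨ W-cong xs (λ e ys _ → col-pieri k ys N (λ α → f (d + e ∷ α))) ⟩
    W (λ e ys → U k (φ (d + e)) (ys ++ 0 ∷ [])) xs
      ≡⟨ sym (W-++ (λ e → U k (φ (d + e))) xs) ⟩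
    W (λ e → U k (φ (d + e))) xs₀ ∎
  go : ∀ k → colA (k ∷ []) (suc N) g ≡ W (λ e → U k (φ e)) xs₀ ⊕ W (λ e → U⁻ k (φ (suc e))) xs₀
  go zero    = ≡.trans (low 0 0) (sym (≡.trans (cong (W φ xs₀ ⊕_) (W-0 xs₀)) (ℤₚ.+-identityʳ _)))
  go (suc k) = cong₂ _⊕_ (low (suc k) 0) (low k 1)

rows cols : Side
rows = record { A = rowA ; lin = row-linear ; alt = row-alt ; drop = row-drop ; pieri = row-pieri }
cols = record { A = colA ; lin = col-linear ; alt = col-alt ; drop = col-drop ; pieri = col-pieri }

-- Schur polynomials as functionals

lsum : ∀ {X : Set} → (X → ℤ) → List X → ℤ
lsum g []       = 0ℤ
lsum g (x ∷ xs) = g x ⊕ lsum g xs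

lsum-cong : ∀ {X : Set} {g h : X → ℤ} → (∀ x → g x ≡ h x) → ∀ xs → lsum g xs ≡ lsum h xs
lsum-cong eq []       = refl
lsum-cong eq (x ∷ xs) = cong₂ _⊕_ (eq x) (lsum-cong eq xs)

lsum-++ : ∀ {X : Set} (g : X → ℤ) xs ys → lsum g (xs ++ ys) ≡ lsum g xs ⊕ lsum g ys
lsum-++ g []       ys = sym (ℤₚ.+-identityˡ _)
lsum-++ g (x ∷ xs) ys = ≡.trans (cong (g x ⊕_) (lsum-++ g xs ys)) (sym (ℤₚ.+-assoc (g x) _ _))

lsum-map : ∀ {X Y : Set} (g : Y → ℤ) (h : X → Y) xs → lsum g (map h xs) ≡ lsum (λ x → g (h x)) xs
lsum-map g h []       = refl
lsum-map g h (x ∷ xs) = cong (g (h x) ⊕_) (lsum-map g h xs)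

lsum-concatMap : ∀ {X Y : Set} (g : Y → ℤ) (h : X → List Y) xs → lsum g (concatMap h xs) ≡ lsum (λ x → lsum g (h x)) xs
lsum-concatMap g h []       = refl
lsum-concatMap g h (x ∷ xs) = ≡.trans (lsum-++ g (h x) (concatMap h xs)) (cong (lsum g (h x) ⊕_) (lsum-concatMap g h xs))

term : ∀ {N} → (Vec ℕ N → ℤ) → ℤ × Vec ℕ N → ℤ
term f (a , α) = a ⊗ f α

⟦_⟧ : ∀ {N} → Poly N → (Vec ℕ N → ℤ) → ℤ
⟦ p ⟧ f = lsum (term f) p

S : List ℕ → Fam
S μ N f = ⟦ schur N μ ⟧ f

S-suc : ∀ μ N f → S μ (suc N) f ≡ lsum (λ m → S m N (λ α → f (sum μ ∸ sum m ∷ α))) (interlace μ)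
S-suc μ N f = ≡.trans (lsum-concatMap (term f) _ (interlace μ))
  (lsum-cong (λ m → ≡.trans (lsum-map (term f) _ (schur N m)) (lsum-cong (λ { (a , α) → refl }) (schur N m))) (interlace μ))

Σ< : ℕ → (ℕ → ℤ) → ℤ
Σ< zero    g = 0ℤ
Σ< (suc n) g = g 0 ⊕ Σ< n (λ a → g (suc a))

Σ<-cong : ∀ n {g h : ℕ → ℤ} → (∀ a → a < n → g a ≡ h a) → Σ< n g ≡ Σ< n h
Σ<-cong zero    eq = refl
Σ<-cong (suc n) eq = cong₂ _⊕_ (eq 0 (s≤s z≤n)) (Σ<-cong n (λ a a<n → eq (suc a) (s≤s a<n)))

Σ<-zero : ∀ n {g : ℕ → ℤ} → (∀ a → a < n → g a ≡ 0ℤ) → Σ< n g ≡ 0ℤ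
Σ<-zero zero    eq = refl
Σ<-zero (suc n) eq = cong₂ _⊕_ (eq 0 (s≤s z≤n)) (Σ<-zero n (λ a a<n → eq (suc a) (s≤s a<n)))

Σ<-top : ∀ n g → Σ< (suc n) g ≡ Σ< n g ⊕ g n
Σ<-top zero    g = ℤₚ.+-comm (g 0) 0ℤ
Σ<-top (suc n) g = ≡.trans (cong (g 0 ⊕_) (Σ<-top n (λ a → g (suc a)))) (sym (ℤₚ.+-assoc (g 0) _ _))

lsum-applyUpTo : ∀ (g : ℕ → ℤ) h n → lsum g (applyUpTo h n) ≡ Σ< n (λ a → g (h a))
lsum-applyUpTo g h zero    = refl
lsum-applyUpTo g h (suc n) = cong (g (h 0) ⊕_) (lsum-applyUpTo g (λ a → h (suc a)) n)

lsum-range : ∀ (g : ℕ → ℤ) lo hi → lo ≤ hi → lsum g (range lo hi) ≡ Σ< (suc (hi ∸ lo)) (λ a → g (lo + a))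
lsum-range g lo hi lo≤hi with lo ℕ.≤ᵇ hi in eq
... | true  = ≡.trans (lsum-map g (lo +_) (upTo (suc (hi ∸ lo)))) (lsum-applyUpTo (λ a → g (lo + a)) (λ a → a) (suc (hi ∸ lo)))
... | false = ⊥-elim (subst T eq (ℕₚ.≤⇒≤ᵇ lo≤hi))

-- Sum over the shapes k obtained from μ by removing a horizontal strip, with
-- the number of removed boxes as degree.

strips : List ℕ → Series → ℤ
strips []      φ = φ 0 []
strips (l ∷ μ) φ = Σ< (suc (l ∸ head0 μ)) (λ a → strips μ (λ e k → φ (l ∸ head0 μ ∸ a + e) (head0 μ + a ∷ k)))

private
  head0-≤ : ∀ {l μ} → WD (l ∷ μ) → head0 μ ≤ l
  head0-≤ {l} {μ} wd = ℕₚ.≤-trans (ℕₚ.≤-reflexive (head0-at μ)) (wd 0)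

  range-bound : ∀ {h l a} → h ≤ l → a < suc (l ∸ h) → h + a ≤ l
  range-bound {h} {l} h≤l (s≤s a≤) = ℕₚ.≤-trans (ℕₚ.+-monoʳ-≤ h a≤) (ℕₚ.≤-reflexive (ℕₚ.m+[n∸m]≡n h≤l))

strips-cong : ∀ μ {φ ψ} → WD μ →
  (∀ e k → WD k → length k ≡ length μ → at k 0 ≤ at μ 0 → φ e k ≡ ψ e k) → strips μ φ ≡ strips μ ψ
strips-cong []      wd eq = eq 0 [] wd-[] refl z≤n
strips-cong (l ∷ μ) wd eq = Σ<-cong (suc (l ∸ head0 μ)) (λ a a< → strips-cong μ (wd-tail {l} wd) (λ e k wdk len k≤ →
  eq (l ∸ head0 μ ∸ a + e) (head0 μ + a ∷ k)
    (wd-∷ (ℕₚ.≤-trans k≤ (ℕₚ.≤-trans (ℕₚ.≤-reflexive (sym (head0-at μ))) (ℕₚ.m≤m+n _ a))) wdk)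
    (cong suc len) (range-bound (head0-≤ {l} {μ} wd) a<)))

-- `schur` records the exponent as a difference of total sizes, `strips` row by row. The free
-- constant `C` makes the claim inductive, since a row that has been treated still contributes to
-- the total.
strips-interlace : ∀ μ C (ψ : Series) → WD μ → sum μ ≤ C →
  lsum (λ k → ψ (C ∸ sum k) k) (interlace μ) ≡ strips μ (λ e k → ψ (C ∸ sum μ + e) k)
strips-interlace []      C ψ wd h = ≡.trans (ℤₚ.+-identityʳ _) (cong (λ d → ψ d []) (sym (ℕₚ.+-identityʳ C)))
strips-interlace (l ∷ μ) C ψ wd h = begin
  lsum (λ k → ψ (C ∸ sum k) k) (interlace (l ∷ μ))
    ≡⟨ lsum-concatMap _ (λ m → map (m ∷_) (interlace μ)) (range (head0 μ) l) ⟩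
  lsum (λ m → lsum (λ k → ψ (C ∸ sum k) k) (map (m ∷_) (interlace μ))) (range (head0 μ) l)
    ≡⟨ lsum-cong (λ m → lsum-map _ (m ∷_) (interlace μ)) (range (head0 μ) l) ⟩
  lsum (λ m → lsum (λ k → ψ (C ∸ (m + sum k)) (m ∷ k)) (interlace μ)) (range (head0 μ) l)
    ≡⟨ lsum-range _ (head0 μ) l (head0-≤ {l} {μ} wd) ⟩
  Σ< (suc (l ∸ head0 μ)) (λ a → lsum (λ k → ψ (C ∸ (head0 μ + a + sum k)) (head0 μ + a ∷ k)) (interlace μ))
    ≡⟨ Σ<-cong (suc (l ∸ head0 μ)) step ⟩
  strips (l ∷ μ) (λ e k → ψ (C ∸ sum (l ∷ μ) + e) k) ∎
  where
  open ≡-Reasoning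
  arith : ∀ m x s d e → (m + x + s + d) ∸ m ∸ s + e ≡ d + (x + e)
  arith m x s d e = ≡.trans (cong (λ z → z ∸ m ∸ s + e) (≡.trans (cong (_+ d) (ℕₚ.+-assoc m x s)) (ℕₚ.+-assoc m (x + s) d)))
    (≡.trans (cong (λ z → z ∸ s + e) (ℕₚ.m+n∸m≡n m (x + s + d)))
    (≡.trans (cong (λ z → z ∸ s + e) (≡.trans (cong (_+ d) (ℕₚ.+-comm x s)) (ℕₚ.+-assoc s x d)))
    (≡.trans (cong (_+ e) (≡.trans (ℕₚ.m+n∸m≡n s (x + d)) (ℕₚ.+-comm x d))) (ℕₚ.+-assoc d x e))))
  step : ∀ a → a < suc (l ∸ head0 μ) →
    lsum (λ k → ψ (C ∸ (head0 μ + a + sum k)) (head0 μ + a ∷ k)) (interlace μ) ≡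
    strips μ (λ e k → ψ (C ∸ (l + sum μ) + (l ∸ head0 μ ∸ a + e)) (head0 μ + a ∷ k))
  step a a< = ≡.trans (lsum-cong (λ k → cong (λ d → ψ d (m ∷ k)) (sym (ℕₚ.∸-+-assoc C m (sum k)))) (interlace μ))
    (≡.trans (strips-interlace μ (C ∸ m) (λ d k → ψ d (m ∷ k)) (wd-tail {l} wd) sum≤)
      (strips-cong μ (wd-tail {l} wd) (λ e k _ _ _ → cong (λ d → ψ d (m ∷ k)) (eq e))))
    where
    m = head0 μ + a
    m≤l : m ≤ l
    m≤l = range-bound (head0-≤ {l} {μ} wd) a<
    sum≤ : sum μ ≤ C ∸ m
    sum≤ = ℕₚ.m+n≤o⇒m≤o∸n (sum μ) (ℕₚ.≤-trans (ℕₚ.≤-trans (ℕₚ.≤-reflexive (ℕₚ.+-comm (sum μ) m)) (ℕₚ.+-monoˡ-≤ (sum μ) m≤l)) h)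
    eq : ∀ e → C ∸ m ∸ sum μ + e ≡ C ∸ (l + sum μ) + (l ∸ head0 μ ∸ a + e)
    eq e with ℕₚ.m≤n⇒∃[o]m+o≡n h
    ... | d , refl = begin
      (l + sum μ + d) ∸ m ∸ sum μ + e
        ≡⟨ cong (λ z → (z + sum μ + d) ∸ m ∸ sum μ + e) (sym (ℕₚ.m+[n∸m]≡n m≤l)) ⟩
      (m + (l ∸ m) + sum μ + d) ∸ m ∸ sum μ + e
        ≡⟨ arith m (l ∸ m) (sum μ) d e ⟩
      d + (l ∸ m + e)
        ≡⟨ cong₂ (λ u v → u + (v + e)) (sym (ℕₚ.m+n∸m≡n (l + sum μ) d)) (sym (ℕₚ.∸-+-assoc l (head0 μ) a)) ⟩
      (l + sum μ + d) ∸ (l + sum μ) + (l ∸ head0 μ ∸ a + e) ∎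

S-strips : ∀ μ N f → WD μ → S μ (suc N) f ≡ strips μ (λ e k → S k N (λ α → f (e ∷ α)))
S-strips μ N f wd = ≡.trans (S-suc μ N f)
  (≡.trans (strips-interlace μ (sum μ) (λ d k → S k N (λ α → f (d ∷ α))) wd ℕₚ.≤-refl)
    (strips-cong μ wd (λ e k _ _ _ → cong (λ d → S k N (λ α → f (d + e ∷ α))) (ℕₚ.n∸n≡0 (sum μ)))))

isZero-replicate : ∀ n → isZeroᵇ (replicate n 0) ≡ true
isZero-replicate zero    = refl
isZero-replicate (suc n) = isZero-replicate n

S-zero : ∀ μ f → WD μ → at μ 0 ≡ 0 → S μ 0 f ≡ f []
S-zero μ f wd h = ≡.trans (cong (λ b → ⟦ (if b then (1ℤ , []) ∷ [] else []) ⟧ f)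
    (≡.trans (cong isZeroᵇ (wd-zero μ wd h)) (isZero-replicate (length μ))))
  (≡.trans (ℤₚ.+-identityʳ _) (ℤₚ.*-identityˡ _))

below-one : ∀ r xs → All (_< r) xs → below r xs ≡ 1ℤ
below-one r []       []      = refl
below-one r (x ∷ xs) (h ∷ p) = cong₂ _⊗_ (lt-yes h) (below-one r xs p)

sg-one : ∀ {x y} → y < x → sg x y ≡ 1ℤ
sg-one {suc x} {zero}  _       = refl
sg-one {suc x} {suc y} (s≤s h) = sg-one h

sgs-one : ∀ x ys → All (_< x) ys → sgs x ys ≡ 1ℤ
sgs-one x []       []      = refl
sgs-one x (y ∷ ys) (h ∷ p) = cong₂ _⊗_ (sg-one h) (sgs-one x ys p)

staircase-below : ∀ n → All (_< n) (β (replicate n 0))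
staircase-below zero    = []
staircase-below (suc n) = s≤s (ℕₚ.≤-reflexive (L.length-replicate n)) ∷ All.map ℕₚ.m<n⇒m<1+n (staircase-below n)

vand-staircase : ∀ n → vand (β (replicate n 0)) ≡ 1ℤ
vand-staircase zero    = refl
vand-staircase (suc n) = cong₂ _⊗_
  (sgs-one _ _ (subst (λ m → All (_< m) (β (replicate n 0))) (sym (L.length-replicate n)) (staircase-below n)))
  (vand-staircase n)

base-staircase : ∀ n → base (β (replicate n 0)) ≡ 1ℤ
base-staircase n = cong₂ _⊗_
  (below-one _ _ (subst (λ m → All (_< m) (β (replicate n 0))) (sym (≡.trans (length-β (replicate n 0)) (L.length-replicate n))) (staircase-below n)))
  (vand-staircase n)

-- Rows: lowering beta numbers removes horizontal strips

-- Separates the lowerings that keep the first coordinate above `y`. With `y` the next beta number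
-- the remainder starts with two equal coordinates and vanishes, which leaves exactly the
-- interlacing condition.
D-unroll : ∀ z y φ ys → D φ (y + z ∷ ys) ≡
  Σ< z (λ a → D (λ e k → φ (z ∸ suc a + e) (suc (y + a) ∷ k)) ys) ⊕ D (λ e → φ (z + e)) (y ∷ ys)
D-unroll zero    y φ ys = ≡.trans (cong (λ x → D φ (x ∷ ys)) (ℕₚ.+-identityʳ y)) (sym (ℤₚ.+-identityˡ _))
D-unroll (suc z) y φ ys = begin
  D φ (y + suc z ∷ ys)
    ≡⟨ cong (λ x → D φ (x ∷ ys)) (ℕₚ.+-suc y z) ⟩
  D (suc (y + z) ▹ φ) ys ⊕ D (sh φ) (y + z ∷ ys)
    ≡⟨ cong (D (suc (y + z) ▹ φ) ys ⊕_) (D-unroll z y (sh φ) ys) ⟩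
  D (suc (y + z) ▹ φ) ys ⊕ (Σ< z g' ⊕ r)
    ≡⟨ cong₂ (λ u v → u ⊕ (v ⊕ r)) top (Σ<-cong z low) ⟩
  g z ⊕ (Σ< z g ⊕ r)
    ≡⟨ lem (g z) (Σ< z g) r ⟩
  (Σ< z g ⊕ g z) ⊕ r
    ≡⟨ cong (_⊕ r) (sym (Σ<-top z g)) ⟩
  Σ< (suc z) g ⊕ r ∎
  where
  open ≡-Reasoning
  r = D (λ e → φ (suc z + e)) (y ∷ ys)
  g g' : ℕ → ℤ
  g a = D (λ e k → φ (z ∸ a + e) (suc (y + a) ∷ k)) ys
  g' a = D (λ e k → φ (suc (z ∸ suc a + e)) (suc (y + a) ∷ k)) ys
  lem : ∀ a b c → a ⊕ (b ⊕ c) ≡ (b ⊕ a) ⊕ c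
  lem = solve-∀
  top : D (suc (y + z) ▹ φ) ys ≡ g z
  top = D-cong ys (λ e k _ → cong (λ d → φ (d + e) (suc (y + z) ∷ k)) (sym (ℕₚ.n∸n≡0 z)))
  low : ∀ a → a < z → g' a ≡ g a
  low a a<z = D-cong ys (λ e k _ → cong (λ d → φ (d + e) (suc (y + a) ∷ k)) (sym (ℕₚ.+-∸-assoc 1 a<z)))

D-strips-∷ : ∀ l μ φ → WD (l ∷ μ) → Altₛ φ →
  (∀ ψ → Altₛ ψ → D ψ (β μ) ≡ strips μ (λ e k → ψ e (β k))) →
  D φ (β (l ∷ μ)) ≡ strips (l ∷ μ) (λ e k → φ e (β k))
D-strips-∷ l [] φ wd al ih = begin
  D φ (l + 0 ∷ [])
    ≡⟨ cong (λ x → D φ (x ∷ [])) (ℕₚ.+-identityʳ l) ⟩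
  D φ (0 + l ∷ [])
    ≡⟨ D-unroll l 0 φ [] ⟩
  Σ< l (λ a → φ (l ∸ suc a + 0) (suc a ∷ [])) ⊕ φ (l + 0) (0 ∷ [])
    ≡⟨ ℤₚ.+-comm (Σ< l (λ a → φ (l ∸ suc a + 0) (suc a ∷ []))) _ ⟩
  φ (l + 0) (0 ∷ []) ⊕ Σ< l (λ a → φ (l ∸ suc a + 0) (suc a ∷ []))
    ≡⟨ cong (φ (l + 0) (0 ∷ []) ⊕_) (Σ<-cong l (λ a _ → cong (λ x → φ (l ∸ suc a + 0) (x ∷ [])) (sym (ℕₚ.+-identityʳ (suc a))))) ⟩
  strips (l ∷ []) (λ e k → φ e (β k)) ∎
  where open ≡-Reasoning
D-strips-∷ l μ@(h ∷ μ') φ wd al ih = begin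
  D φ (l + suc n ∷ β μ)
    ≡⟨ cong (λ x → D φ (x ∷ β μ)) head-eq ⟩
  D φ (y + suc w ∷ β μ)
    ≡⟨ D-unroll (suc w) y φ (β μ) ⟩
  Σ< (suc w) (λ a → D (λ e k → φ (w ∸ a + e) (suc (y + a) ∷ k)) (β μ)) ⊕ D (λ e → φ (suc w + e)) (y ∷ β μ)
    ≡⟨ cong₂ _⊕_ (Σ<-cong (suc w) step) (alt-adj (alt-D (λ e → al (suc w + e))) y (β μ')) ⟩
  strips (l ∷ μ) (λ e k → φ e (β k)) ⊕ 0ℤ
    ≡⟨ ℤₚ.+-identityʳ _ ⟩
  strips (l ∷ μ) (λ e k → φ e (β k)) ∎
  where
  open ≡-Reasoning
  n = length μ'
  w = l ∸ h
  y = h + n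
  head-eq : l + suc n ≡ y + suc w
  head-eq = ≡.trans (cong (_+ suc n) (sym (ℕₚ.m+[n∸m]≡n (wd 0)))) (≡.trans (ℕₚ.+-assoc h w (suc n))
    (≡.trans (cong (h +_) (≡.trans (ℕₚ.+-suc w n) (≡.trans (cong suc (ℕₚ.+-comm w n)) (sym (ℕₚ.+-suc n w))))) (sym (ℕₚ.+-assoc h n (suc w)))))
  pos-eq : ∀ a → suc (y + a) ≡ h + a + suc n
  pos-eq a = ≡.trans (cong suc (≡.trans (ℕₚ.+-assoc h n a) (≡.trans (cong (h +_) (ℕₚ.+-comm n a)) (sym (ℕₚ.+-assoc h a n))))) (sym (ℕₚ.+-suc (h + a) n))
  step : ∀ a → a < suc w → D (λ e k → φ (w ∸ a + e) (suc (y + a) ∷ k)) (β μ) ≡ strips μ (λ e k → φ (w ∸ a + e) (h + a + length k ∷ β k))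
  step a _ = ≡.trans (ih _ (λ e t → al (w ∸ a + e) (there t)))
    (strips-cong μ (wd-tail {l} wd) (λ e k _ len _ → cong (λ x → φ (w ∸ a + e) (x ∷ β k))
      (≡.trans (pos-eq a) (cong (h + a +_) (sym len)))))

D-strips : ∀ μ φ → WD μ → Altₛ φ → D φ (β μ) ≡ strips μ (λ e k → φ e (β k))
D-strips []      φ wd al = refl
D-strips (l ∷ μ) φ wd al = D-strips-∷ l μ φ wd al (λ ψ → D-strips μ ψ (wd-tail {l} wd))

row-schur : ∀ μ → WD μ → ∀ N f → rowA (β μ) N f ≡ S μ N f
row-schur [] wd zero f = ≡.trans (ℤₚ.*-identityˡ (f [])) (sym (S-zero [] f wd refl))
row-schur (zero ∷ μ) wd zero f = ≡.trans
  (≡.trans (cong (_⊗ f []) (≡.trans (cong (λ ν → base (β ν)) (wd-zero (0 ∷ μ) wd refl)) (base-staircase (suc (length μ))))) (ℤₚ.*-identityˡ (f [])))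
  (sym (S-zero (0 ∷ μ) f wd refl))
row-schur (suc l ∷ μ) wd zero f = cong (_⊗ f []) (base-β-pos (suc l) μ (s≤s z≤n))
row-schur μ wd (suc N) f = ≡.trans (D-strips μ _ wd (λ e → row-alt N (λ α → f (e ∷ α))))
  (≡.trans (strips-cong μ wd (λ e k wdk _ _ → row-schur k wdk N (λ α → f (e ∷ α)))) (sym (S-strips μ N f wd)))

-- Conjugate partition, as the list of its first L columns.

cc : ℕ → List ℕ → List ℕ
cc L []       = replicate L 0
cc L (m ∷ ms) = map suc (cc m ms) ++ replicate (L ∸ m) 0

length-cc : ∀ L ms → WD ms → at ms 0 ≤ L → length (cc L ms) ≡ L
length-cc L []       wd h = L.length-replicate L
length-cc L (m ∷ ms) wd h = begin
  length (map suc (cc m ms) ++ replicate (L ∸ m) 0)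
    ≡⟨ L.length-++ (map suc (cc m ms)) ⟩
  length (map suc (cc m ms)) + length (replicate (L ∸ m) 0)
    ≡⟨ cong₂ _+_ (≡.trans (L.length-map suc (cc m ms)) (length-cc m ms (wd-tail {m} wd) (wd 0))) (L.length-replicate (L ∸ m)) ⟩
  m + (L ∸ m)
    ≡⟨ ℕₚ.m+[n∸m]≡n h ⟩
  L ∎
  where open ≡-Reasoning

replicate-+ : ∀ a b {x : ℕ} → replicate (a + b) x ≡ replicate a x ++ replicate b x
replicate-+ zero    b = refl
replicate-+ (suc a) b = cong (_ ∷_) (replicate-+ a b)

cc-+ : ∀ L d ms → at ms 0 ≤ L → cc (L + d) ms ≡ cc L ms ++ replicate d 0
cc-+ L d []       h = replicate-+ L d
cc-+ L d (m ∷ ms) h = ≡.trans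
  (cong (λ n → map suc (cc m ms) ++ replicate n 0) (ℕₚ.+-∸-comm d h))
  (≡.trans (cong (map suc (cc m ms) ++_) (replicate-+ (L ∸ m) d))
           (sym (L.++-assoc (map suc (cc m ms)) (replicate (L ∸ m) 0) (replicate d 0))))

β-++ : ∀ xs ys → β (xs ++ ys) ≡ map (length ys +_) (β xs) ++ β ys
β-++ []       ys = refl
β-++ (x ∷ xs) ys = cong₂ _∷_
  (≡.trans (cong (x +_) (≡.trans (L.length-++ xs) (ℕₚ.+-comm (length xs) (length ys))))
    (≡.trans (sym (ℕₚ.+-assoc x (length ys) (length xs)))
      (≡.trans (cong (_+ length xs) (ℕₚ.+-comm x (length ys))) (ℕₚ.+-assoc (length ys) x (length xs)))))
  (β-++ xs ys)

β-map-suc : ∀ xs → β (map suc xs) ≡ map suc (β xs)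
β-map-suc []       = refl
β-map-suc (x ∷ xs) = cong₂ _∷_ (cong (λ n → suc (x + n)) (L.length-map suc xs)) (β-map-suc xs)

map-+ : ∀ s w xs → map (s +_) (map (w +_) (map suc xs)) ≡ map ((s + suc w) +_) xs
map-+ s w []       = refl
map-+ s w (x ∷ xs) = cong₂ _∷_
  (≡.trans (cong (s +_) (ℕₚ.+-suc w x)) (sym (ℕₚ.+-assoc s (suc w) x))) (map-+ s w xs)

-- Columns: lowering beta numbers removes horizontal strips

swap-++ˡ : ∀ zs {xs ys} → Swap xs ys → Swap (zs ++ xs) (zs ++ ys)
swap-++ˡ []       t = t
swap-++ˡ (z ∷ zs) t = there (swap-++ˡ zs t)

swap-++ʳ : ∀ zs {xs ys} → Swap xs ys → Swap (xs ++ zs) (ys ++ zs)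
swap-++ʳ zs here      = here
swap-++ʳ zs (there t) = there (swap-++ʳ zs t)

W-append : ∀ φ xs ys → W φ (xs ++ ys) ≡ W (λ e xs' → W (λ e' ys' → φ (e + e') (xs' ++ ys')) ys) xs
W-append φ []           ys = refl
W-append φ (zero ∷ xs)  ys = W-append (0 ▹ φ) xs ys
W-append φ (suc x ∷ xs) ys = cong₂ _⊕_ (W-append (suc x ▹ φ) xs ys) (W-append (x ▹ sh φ) xs ys)

W-Σ< : ∀ n (ψ : ℕ → Series) xs → W (λ e ys → Σ< n (λ a → ψ a e ys)) xs ≡ Σ< n (λ a → W (ψ a) xs)
W-Σ< zero    ψ xs = W-0 xs
W-Σ< (suc n) ψ xs = ≡.trans (W-+ (ψ 0) (λ e ys → Σ< n (λ a → ψ (suc a) e ys)) xs)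
  (cong (W (ψ 0) xs ⊕_) (W-Σ< n (λ a → ψ (suc a)) xs))

-- In a block of empty columns a lowered coordinate collides with the next unless that is lowered
-- too, and the final 0 cannot be lowered.
W-staircase : ∀ z {ψ} → Altₛ ψ → W ψ (β (replicate z 0)) ≡ ψ 0 (β (replicate z 0))
W-staircase zero          al = refl
W-staircase (suc zero)    al = refl
W-staircase (suc (suc z)) {ψ} al = ≡.trans
  (cong₂ _⊕_ (W-staircase (suc z) (λ e t → al e (there t)))
             (≡.trans (W-staircase (suc z) (λ e t → al (suc e) (there t))) (alt-adj (al 1) _ _)))
  (ℤₚ.+-identityʳ _)

column : ℕ → ℕ → ℕ → List ℕ
column s a b = map (s +_) (β (replicate a 1 ++ replicate b 0))

length-ones-zeros : ∀ {z a} → a ≤ z → length (replicate a 1 ++ replicate (z ∸ a) 0) ≡ z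
length-ones-zeros {z} {a} h = ≡.trans (L.length-++ (replicate a 1))
  (≡.trans (cong₂ _+_ (L.length-replicate a) (L.length-replicate (z ∸ a))) (ℕₚ.m+[n∸m]≡n h))

-- Among neighbouring columns of equal height a lowered one collides with the next unless that is
-- lowered too. So only a final segment is lowered: a strip takes the boxes of a row from its right
-- end.
W-run : ∀ z s ψ → Altₛ ψ → W ψ (map (s +_) (β (replicate z 1))) ≡ Σ< (suc z) (λ a → ψ (z ∸ a) (column s a (z ∸ a)))
W-run zero    s ψ al = sym (ℤₚ.+-identityʳ _)
W-run (suc z) s ψ al = begin
  W ψ (s + suc (length (replicate z 1)) ∷ run)
    ≡⟨ cong (λ x → W ψ (x ∷ run)) (≡.trans (cong (λ n → s + suc n) (L.length-replicate z)) (ℕₚ.+-suc s z)) ⟩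
  W (suc (s + z) ▹ ψ) run ⊕ W (s + z ▹ sh ψ) run
    ≡⟨ cong₂ _⊕_ (W-run z s _ (λ e t → al e (there t))) (W-run z s _ (λ e t → al (suc e) (there t))) ⟩
  Σ< (suc z) (λ a → ψ (z ∸ a) (suc (s + z) ∷ column s a (z ∸ a))) ⊕
  Σ< (suc z) (λ a → ψ (suc (z ∸ a)) (s + z ∷ column s a (z ∸ a)))
    ≡⟨ cong₂ _⊕_ (Σ<-cong (suc z) kept) lowered ⟩
  Σ< (suc z) (λ a → g (suc a)) ⊕ g 0
    ≡⟨ ℤₚ.+-comm _ (g 0) ⟩
  Σ< (suc (suc z)) g ∎
  where
  open ≡-Reasoning
  run = map (s +_) (β (replicate z 1))
  g : ℕ → ℤ
  g a = ψ (suc z ∸ a) (column s a (suc z ∸ a))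
  kept : ∀ a → a < suc z → ψ (z ∸ a) (suc (s + z) ∷ column s a (z ∸ a)) ≡ g (suc a)
  kept a (s≤s a≤z) = cong (λ x → ψ (z ∸ a) (x ∷ column s a (z ∸ a)))
    (sym (≡.trans (cong (λ n → s + suc n) (length-ones-zeros a≤z)) (ℕₚ.+-suc s z)))
  clash : ∀ z a → suc a ≤ z → ψ (suc (z ∸ suc a)) (s + z ∷ column s (suc a) (z ∸ suc a)) ≡ 0ℤ
  clash (suc z) a (s≤s a≤z) = ≡.trans
    (cong (λ x → ψ (suc (z ∸ a)) (x ∷ column s (suc a) (z ∸ a))) (cong (λ n → s + suc n) (sym (length-ones-zeros a≤z))))
    (alt-adj (al (suc (z ∸ a))) _ _)
  lowered : Σ< (suc z) (λ a → ψ (suc (z ∸ a)) (s + z ∷ column s a (z ∸ a))) ≡ g 0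
  lowered = ≡.trans (cong₂ _⊕_
    (cong (λ n → ψ (suc z) (s + n ∷ column s 0 z)) (sym (L.length-replicate z)))
    (Σ<-zero z (λ a a<z → clash z a a<z))) (ℤₚ.+-identityʳ _)

cc-column : ∀ m m₁ a s k → a ≤ m ∸ m₁ → at k 0 ≤ m₁ →
  map ((s + suc (m ∸ m₁)) +_) (β (cc m₁ k)) ++ column s a (m ∸ m₁ ∸ a) ≡ map (s +_) (β (cc m (m₁ + a ∷ k)))
cc-column m m₁ a s k a≤ k≤ = sym (begin
  map (s +_) (β (map suc (cc (m₁ + a) k) ++ replicate (m ∸ (m₁ + a)) 0))
    ≡⟨ cong (λ xs → map (s +_) (β xs)) shape ⟩
  map (s +_) (β (map suc (cc m₁ k) ++ tl))
    ≡⟨ cong (map (s +_)) (≡.trans (β-++ (map suc (cc m₁ k)) tl) (cong₂ (λ n xs → map (n +_) xs ++ β tl) (length-ones-zeros a≤) (β-map-suc (cc m₁ k)))) ⟩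
  map (s +_) (map (w +_) (map suc (β (cc m₁ k))) ++ β tl)
    ≡⟨ L.map-++ (s +_) _ (β tl) ⟩
  map (s +_) (map (w +_) (map suc (β (cc m₁ k)))) ++ column s a (w ∸ a)
    ≡⟨ cong (_++ column s a (w ∸ a)) (map-+ s w (β (cc m₁ k))) ⟩
  map ((s + suc w) +_) (β (cc m₁ k)) ++ column s a (w ∸ a) ∎)
  where
  open ≡-Reasoning
  w = m ∸ m₁
  tl = replicate a 1 ++ replicate (w ∸ a) 0
  shape : map suc (cc (m₁ + a) k) ++ replicate (m ∸ (m₁ + a)) 0 ≡ map suc (cc m₁ k) ++ tl
  shape = ≡.trans (cong₂ (λ xs n → map suc xs ++ replicate n 0) (cc-+ m₁ a k k≤) (sym (ℕₚ.∸-+-assoc m m₁ a)))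
    (≡.trans (cong (_++ replicate (w ∸ a) 0) (≡.trans (L.map-++ suc (cc m₁ k) (replicate a 0)) (cong (map suc (cc m₁ k) ++_) (L.map-replicate suc a 0))))
      (L.++-assoc (map suc (cc m₁ k)) (replicate a 1) (replicate (w ∸ a) 0)))

-- The last m - m₁ of these columns meet the first row only and form one run; the first m₁ columns
-- form the same problem for the remaining rows. `s` is an offset common to all coordinates.
W-strips-∷ : ∀ m ms s φ → WD (m ∷ ms) → Altₛ φ →
  W φ (map (s +_) (β (map suc (cc m ms)))) ≡ strips (m ∷ ms) (λ e k → φ e (map (s +_) (β (cc m k))))
W-strips-∷ m [] s φ wd al = begin
  W φ (map (s +_) (β (map suc (replicate m 0))))
    ≡⟨ cong (λ xs → W φ (map (s +_) (β xs))) (L.map-replicate suc m 0) ⟩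
  W φ (map (s +_) (β (replicate m 1)))
    ≡⟨ W-run m s φ al ⟩
  Σ< (suc m) (λ a → φ (m ∸ a) (column s a (m ∸ a)))
    ≡⟨ Σ<-cong (suc m) (λ a _ → cong₂ (λ d xs → φ d (map (s +_) (β (xs ++ replicate (m ∸ a) 0))))
         (sym (ℕₚ.+-identityʳ (m ∸ a))) (sym (L.map-replicate suc a 0))) ⟩
  strips (m ∷ []) (λ e k → φ e (map (s +_) (β (cc m k)))) ∎
  where open ≡-Reasoning
W-strips-∷ m (m₁ ∷ ms) s φ wd al = begin
  W φ (map (s +_) (β (map suc (X ++ replicate w 0))))
    ≡⟨ cong (W φ) split ⟩
  W φ (P ++ map (s +_) (β (replicate w 1)))
    ≡⟨ W-append φ P _ ⟩
  W (λ e P' → W (λ e' R → φ (e + e') (P' ++ R)) (map (s +_) (β (replicate w 1)))) P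
    ≡⟨ W-cong P (λ e P' _ → W-run w s _ (λ e' t → al (e + e') (swap-++ˡ P' t))) ⟩
  W (λ e P' → Σ< (suc w) (λ a → φ (e + (w ∸ a)) (P' ++ column s a (w ∸ a)))) P
    ≡⟨ W-Σ< (suc w) (λ a e P' → φ (e + (w ∸ a)) (P' ++ column s a (w ∸ a))) P ⟩
  Σ< (suc w) (λ a → W (λ e P' → φ (e + (w ∸ a)) (P' ++ column s a (w ∸ a))) P)
    ≡⟨ Σ<-cong (suc w) (λ { a (s≤s a≤w) → ≡.trans
         -- The offset grows by `w` for the columns split off on the right and by one for the first
         -- row.
         (W-strips-∷ m₁ ms (s + suc w) _ (wd-tail {m} wd) (λ e t → al (e + (w ∸ a)) (swap-++ʳ (column s a (w ∸ a)) t)))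
         (strips-cong (m₁ ∷ ms) (wd-tail {m} wd) (λ e k _ _ k≤ →
           cong₂ φ (ℕₚ.+-comm e (w ∸ a)) (cc-column m m₁ a s k a≤w k≤))) }) ⟩
  strips (m ∷ m₁ ∷ ms) (λ e k → φ e (map (s +_) (β (cc m k)))) ∎
  where
  open ≡-Reasoning
  w = m ∸ m₁
  X = map suc (cc m₁ ms)
  P = map ((s + suc w) +_) (β X)
  split : map (s +_) (β (map suc (X ++ replicate w 0))) ≡ P ++ map (s +_) (β (replicate w 1))
  split = ≡.trans (cong (λ xs → map (s +_) (β xs)) (≡.trans (L.map-++ suc X (replicate w 0)) (cong (map suc X ++_) (L.map-replicate suc w 0))))
    (≡.trans (cong (map (s +_)) (≡.trans (β-++ (map suc X) (replicate w 1)) (cong₂ (λ n xs → map (n +_) xs ++ β (replicate w 1)) (L.length-replicate w) (β-map-suc X))))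
      (≡.trans (L.map-++ (s +_) (map (w +_) (map suc (β X))) (β (replicate w 1)))
        (cong (_++ map (s +_) (β (replicate w 1))) (map-+ s w (β X)))))

W-strips : ∀ C μ φ → WD μ → at μ 0 ≤ C → Altₛ φ → W φ (β (cc C μ)) ≡ strips μ (λ e k → φ e (β (cc C k)))
W-strips C []       φ wd h al = W-staircase C al
W-strips C (m ∷ ms) φ wd h al = begin
  W φ (β (map suc (cc m ms) ++ replicate d 0))
    ≡⟨ cong (W φ) (join (map suc (cc m ms))) ⟩
  W φ (map (d +_) (β (map suc (cc m ms))) ++ β (replicate d 0))
    ≡⟨ W-append φ (map (d +_) (β (map suc (cc m ms)))) (β (replicate d 0)) ⟩
  W (λ e xs → W (λ e' ys → φ (e + e') (xs ++ ys)) (β (replicate d 0))) (map (d +_) (β (map suc (cc m ms))))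
    ≡⟨ W-cong (map (d +_) (β (map suc (cc m ms)))) (λ e xs _ → ≡.trans
         (W-staircase d (λ e' t → al (e + e') (swap-++ˡ xs t)))
         (cong (λ e' → φ e' (xs ++ β (replicate d 0))) (ℕₚ.+-identityʳ e))) ⟩
  W (λ e xs → φ e (xs ++ β (replicate d 0))) (map (d +_) (β (map suc (cc m ms))))
    ≡⟨ W-strips-∷ m ms d _ wd (λ e t → al e (swap-++ʳ (β (replicate d 0)) t)) ⟩
  strips (m ∷ ms) (λ e k → φ e (map (d +_) (β (cc m k)) ++ β (replicate d 0)))
    ≡⟨ strips-cong (m ∷ ms) wd (λ e k _ _ k≤ → cong (φ e) (≡.trans (sym (join (cc m k)))
         (cong β (≡.trans (sym (cc-+ m d k k≤)) (cong (λ n → cc n k) (ℕₚ.m+[n∸m]≡n h)))))) ⟩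
  strips (m ∷ ms) (λ e k → φ e (β (cc C k))) ∎
  where
  open ≡-Reasoning
  d = C ∸ m
  join : ∀ xs → β (xs ++ replicate d 0) ≡ map (d +_) (β xs) ++ β (replicate d 0)
  join xs = ≡.trans (β-++ xs (replicate d 0)) (cong (λ n → map (n +_) (β xs) ++ β (replicate d 0)) (L.length-replicate d))

cc-zero : ∀ C μ → WD μ → at μ 0 ≡ 0 → cc C μ ≡ replicate C 0
cc-zero C []        wd h    = refl
cc-zero C (.0 ∷ μ) wd refl rewrite cc-zero 0 μ (wd-tail {0} wd) (ℕₚ.n≤0⇒n≡0 (wd 0)) = refl

base-cc-pos : ∀ C l μ → WD (suc l ∷ μ) → base (β (cc C (suc l ∷ μ))) ≡ 0ℤ
base-cc-pos C l μ wd with cc (suc l) μ | length-cc (suc l) μ (wd-tail {suc l} wd) (wd 0)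
... | x ∷ xs | _ = base-β-pos (suc x) (map suc xs ++ replicate (C ∸ suc l) 0) (s≤s z≤n)

col-schur-zero : ∀ C μ → WD μ → at μ 0 ≡ 0 → ∀ f → colA (β (cc C μ)) 0 f ≡ S μ 0 f
col-schur-zero C μ wd h f = ≡.trans
  (≡.trans (cong (_⊗ f []) (≡.trans (cong (λ ν → base (β ν)) (cc-zero C μ wd h)) (base-staircase C))) (ℤₚ.*-identityˡ (f [])))
  (sym (S-zero μ f wd h))

col-schur : ∀ C μ → WD μ → at μ 0 ≤ C → ∀ N f → colA (β (cc C μ)) N f ≡ S μ N f
col-schur C []          wd h zero    f = col-schur-zero C [] wd refl f
col-schur C (zero ∷ μ)  wd h zero    f = col-schur-zero C (0 ∷ μ) wd refl f
col-schur C (suc l ∷ μ) wd h zero    f = cong (_⊗ f []) (base-cc-pos C l μ wd)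
col-schur C μ           wd h (suc N) f = ≡.trans (W-strips C μ _ wd h (λ e → col-alt N (λ α → f (e ∷ α))))
  (≡.trans (strips-cong μ wd (λ e k wdk _ k≤ → col-schur C k wdk (ℕₚ.≤-trans k≤ h) N (λ α → f (e ∷ α)))) (sym (S-strips μ N f wd)))

-- Conjugation, box by box

at-replicate-0 : ∀ n p → at (replicate n 0) p ≡ 0
at-replicate-0 zero    p       = refl
at-replicate-0 (suc n) zero    = refl
at-replicate-0 (suc n) (suc p) = at-replicate-0 n p

at-map-suc-< : ∀ xs ys p → p < length xs → at (map suc xs ++ ys) p ≡ suc (at xs p)
at-map-suc-< (x ∷ xs) ys zero    _       = refl
at-map-suc-< (x ∷ xs) ys (suc p) (s≤s h) = at-map-suc-< xs ys p h

at-map-suc-≥ : ∀ xs n p → length xs ≤ p → at (map suc xs ++ replicate n 0) p ≡ 0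
at-map-suc-≥ []       n p       h       = at-replicate-0 n p
at-map-suc-≥ (x ∷ xs) n (suc p) (s≤s h) = at-map-suc-≥ xs n p h

-- Stated for boxes instead of lengths, conjugation is a symmetric relation. Monotonicity, the
-- involution and all bounds on rows then follow through `≤-by-<`, with no further recursion on
-- `cc`.
cc⇒ : ∀ L μ → WD μ → at μ 0 ≤ L → ∀ {p k} → k < at (cc L μ) p → p < at μ k
cc⇒ L [] wd h {p} lt = ⊥-elim (ℕₚ.<⇒≱ lt (ℕₚ.≤-trans (ℕₚ.≤-reflexive (at-replicate-0 L p)) z≤n))
cc⇒ L (m ∷ ms) wd h {p} {k} lt with p ℕ.<? m
... | no p≮m = ⊥-elim (ℕₚ.<⇒≱ lt (ℕₚ.≤-trans (ℕₚ.≤-reflexive (at-map-suc-≥ (cc m ms) (L ∸ m) p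
        (ℕₚ.≤-trans (ℕₚ.≤-reflexive (length-cc m ms (wd-tail {m} wd) (wd 0))) (ℕₚ.≮⇒≥ p≮m)))) z≤n))
cc⇒ L (m ∷ ms) wd h {p} {zero}  lt | yes p<m = p<m
cc⇒ L (m ∷ ms) wd h {p} {suc k} lt | yes p<m = cc⇒ m ms (wd-tail {m} wd) (wd 0)
  (ℕₚ.≤-pred (subst (suc k <_) (at-map-suc-< (cc m ms) (replicate (L ∸ m) 0) p
    (ℕₚ.≤-trans p<m (ℕₚ.≤-reflexive (sym (length-cc m ms (wd-tail {m} wd) (wd 0)))))) lt))

cc⇐ : ∀ L μ → WD μ → at μ 0 ≤ L → ∀ {p k} → p < at μ k → k < at (cc L μ) p
cc⇐ L (m ∷ ms) wd h {p} {k} lt = subst (k <_) (sym (at-map-suc-< (cc m ms) (replicate (L ∸ m) 0) p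
    (ℕₚ.≤-trans p<m (ℕₚ.≤-reflexive (sym (length-cc m ms (wd-tail {m} wd) (wd 0))))))) (go k lt)
  where
  p<m : p < m
  p<m = ℕₚ.≤-trans lt (at-≤-head {m ∷ ms} wd k)
  go : ∀ k → p < at (m ∷ ms) k → k < suc (at (cc m ms) p)
  go zero    _  = s≤s z≤n
  go (suc k) lt = s≤s (cc⇐ m ms (wd-tail {m} wd) (wd 0) lt)

≤-by-< : ∀ {a b} → (∀ k → k < a → k < b) → a ≤ b
≤-by-< {zero}  h = z≤n
≤-by-< {suc a} h = h a ℕₚ.≤-refl

at-≢0 : ∀ ls {k} → 0 < at ls k → k < length ls
at-≢0 (l ∷ ls) {zero}  _ = s≤s z≤n
at-≢0 (l ∷ ls) {suc k} h = s≤s (at-≢0 ls h)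

wd-cc : ∀ L μ → WD μ → at μ 0 ≤ L → WD (cc L μ)
wd-cc L μ wd h p = ≤-by-< (λ k lt → cc⇐ L μ wd h (ℕₚ.<-trans (ℕₚ.n<1+n p) (cc⇒ L μ wd h {suc p} {k} lt)))

cc-head : ∀ L μ → WD μ → at μ 0 ≤ L → at (cc L μ) 0 ≤ length μ
cc-head L μ wd h = ≤-by-< (λ k lt → at-≢0 μ (cc⇒ L μ wd h {0} {k} lt))

at-ext : ∀ {xs ys} → length xs ≡ length ys → (∀ k → at xs k ≡ at ys k) → xs ≡ ys
at-ext {[]}     {[]}     _ _  = refl
at-ext {x ∷ xs} {y ∷ ys} l eq = cong₂ _∷_ (eq 0) (at-ext (ℕₚ.suc-injective l) (λ k → eq (suc k)))

cc-invol : ∀ r α → WD α → at α 0 ≤ r → cc (length α) (cc r α) ≡ α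
cc-invol r α wd h = at-ext (length-cc (length α) (cc r α) wd' h') (λ p → ℕₚ.≤-antisym
  (≤-by-< (λ k lt → cc⇒ r α wd h (cc⇒ (length α) (cc r α) wd' h' lt)))
  (≤-by-< (λ k lt → cc⇐ (length α) (cc r α) wd' h' (cc⇐ r α wd h lt))))
  where
  wd' = wd-cc r α wd h
  h' = cc-head r α wd h

-- Subgroups of families and what multiplication generates in them

-- The reductions only use membership in an abstract subgroup. They are applied to the ideal in
-- question, and also to the multipliers p for which p s_τ stays in a given span.
record IsSub (M : Fam → Set) : Set where
  field
    m-0    : M (λ _ _ → 0ℤ)
    m-+    : ∀ {p q} → M p → M q → M (λ N f → p N f ⊕ q N f)
    m-neg  : ∀ {p} → M p → M (λ N f → ⊝ p N f)
    m-resp : ∀ {p q} → (∀ N f → p N f ≡ q N f) → M p → M q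

  m-act : ∀ s {p} → M p → M (λ N f → act s (p N f))
  m-act pos h = h
  m-act neg h = m-neg h

  m-cancel : ∀ {p q s} → (∀ N f → p N f ≡ q N f ⊕ s N f) → M p → M q → M s
  m-cancel {p} {q} {s} eq hp hq = m-resp (λ N f → ≡.trans (cong (_⊖ q N f) (eq N f)) (lem (q N f) (s N f))) (m-+ hp (m-neg hq))
    where
    lem : ∀ a b → a ⊕ b ⊖ a ≡ b
    lem = solve-∀

  U-closed : ∀ k (Ψ : List ℕ → Fam) xs → (∀ ys → Pointwise _≤_ xs ys → M (Ψ ys)) → M (λ N f → U k (λ ys → Ψ ys N f) xs)
  U-closed zero    Ψ xs       h = h xs (Pointwise.refl ℕₚ.≤-refl)
  U-closed (suc k) Ψ []       h = m-0
  U-closed (suc k) Ψ (x ∷ xs) h = m-+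
    (U-closed (suc k) (λ ys → Ψ (x ∷ ys)) xs (λ ys p → h (x ∷ ys) (ℕₚ.≤-refl ∷ p)))
    (U-closed k Ψ (suc x ∷ xs) (λ { ys (q ∷ p) → h ys (ℕₚ.<⇒≤ q ∷ p) }))

  V-closed : ∀ k (Ψ : List ℕ → Fam) xs → (∀ ys → length ys ≡ length xs → M (Ψ ys)) → M (λ N f → V k (λ ys → Ψ ys N f) xs)
  V-closed zero    Ψ xs       h = h xs refl
  V-closed (suc k) Ψ []       h = m-0
  V-closed (suc k) Ψ (x ∷ xs) h = m-+
    (V-closed (suc k) (λ ys → Ψ (x ∷ ys)) xs (λ ys l → h (x ∷ ys) (cong suc l)))
    (V-closed k (λ ys → Ψ (suc x ∷ ys)) xs (λ ys l → h (suc x ∷ ys) (cong suc l)))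

  altsum-mem : ∀ k (Ψ : ℕ → ℕ → Fam) → (∀ l m → l + suc m ≡ k → M (Ψ l (suc m))) →
               M (λ N f → altsum (λ l m → Ψ l m N f) k) → M (Ψ k 0)
  altsum-mem zero    Ψ h s = s
  altsum-mem (suc k) Ψ h s = altsum-mem k (λ l → Ψ (suc l)) (λ l m e → h (suc l) m (cong suc e))
    (m-cancel (λ N f → lem (Ψ 0 (suc k) N f) _) (h 0 k refl) s)
    where
    lem : ∀ a b → a ≡ (a ⊖ b) ⊕ b
    lem = solve-∀

map-suc? : ∀ xs → (Σ (List ℕ) λ ys → xs ≡ map suc ys) ⊎ Vanishing (xs ++ 0 ∷ [])
map-suc? []           = inj₁ ([] , refl)
map-suc? (zero ∷ xs)  = inj₂ (λ φ al → alt-dup al 0 xs)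
map-suc? (suc x ∷ xs) with map-suc? xs
... | inj₁ (ys , refl) = inj₁ (x ∷ ys , refl)
... | inj₂ v           = inj₂ (vanishing-∷ (suc x) v)

cnt-map-suc : ∀ c xs → cnt (suc c) (map suc xs) ≡ cnt c xs
cnt-map-suc c []       = refl
cnt-map-suc c (x ∷ xs) = cong (ge c x +_) (cnt-map-suc c xs)

pw-length : ∀ {xs ys} → Pointwise _≤_ xs ys → length ys ≡ length xs
pw-length []      = refl
pw-length (_ ∷ p) = cong suc (pw-length p)

pw-pos : ∀ {xs ys} → All (1 ≤_) xs → Pointwise _≤_ xs ys → All (1 ≤_) ys
pw-pos []      []      = []
pw-pos (h ∷ a) (q ∷ p) = ℕₚ.≤-trans h q ∷ pw-pos a p

V-long : ∀ k φ xs → length xs < k → V k φ xs ≡ 0ℤ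
V-long (suc k) φ []       h       = refl
V-long (suc k) φ (x ∷ xs) (s≤s h) = cong₂ _⊕_ (V-long (suc k) _ xs (ℕₚ.m<n⇒m<1+n h)) (V-long k _ xs h)

module Sorting (side : Side) (M : Fam → Set) (sub : IsSub M) where
  open Side side
  open IsSub sub

  m-vanish : ∀ {xs} → Vanishing xs → M (A xs)
  m-vanish v = m-resp (λ N f → sym (v _ (alt N f))) m-0

  m-↭ : ∀ {xs ys} → xs ↭ ys → M (A ys) → M (A xs)
  m-↭ p h with ↭-sgn p
  ... | s , eq = m-resp (λ N f → sym (eq _ (alt N f))) (m-act s h)

  m-sort : ∀ xs → (∀ ls → WD ls → length ls ≡ length xs → xs ↭ β ls → M (A (β ls))) → M (A xs)
  m-sort xs h with β-sort xs
  ... | inj₁ v                   = m-vanish v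
  ... | inj₂ (ls , wd , len , p) = m-↭ p (h ls wd len p)

module Closure (side : Side) (M : Fam → Set) (sub : IsSub M)
               (mul : ∀ k {p} → M p → M (Side.A side (k ∷ []) ⊛ p)) where
  open Side side
  open IsSub sub
  open Sorting side M sub public

  -- Adding q boxes to a shape whose last row is empty gives the shape with
  -- last row q, up to shapes with a shorter last row.

  module _ (c j n : ℕ) (empty : ∀ xs → length xs ≡ n → j ≤ cnt c xs → M (A (xs ++ 0 ∷ []))) where

    Last : ℕ → Set
    Last q = ∀ xs → length xs ≡ n → j ≤ cnt c xs → M (A (xs ++ q ∷ []))

    -- The sum `U k` at last coordinate `a` consists of the wanted vector and of vectors with
    -- smaller last coordinate. The latter are removed one value of the last coordinate at a time.
    climb : ∀ k a → (∀ {l} → l < a + k → Last l) → ∀ xs → length xs ≡ n → j ≤ cnt c xs →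
            M (λ N f → U k (λ ys → A ys N f) (xs ++ a ∷ [])) → M (A (xs ++ a + k ∷ []))
    climb zero    a ih xs len h u = subst (λ z → M (A (xs ++ z ∷ []))) (sym (ℕₚ.+-identityʳ a)) u
    climb (suc k) a ih xs len h u = subst (λ z → M (A (xs ++ z ∷ []))) (sym (ℕₚ.+-suc a k))
      (climb k (suc a) (λ l< → ih (ℕₚ.≤-trans l< (ℕₚ.≤-reflexive (sym (ℕₚ.+-suc a k))))) xs len h
        (m-cancel (λ N f → U-++ (suc k) (λ ys → A ys N f) xs a) u
          (U-closed (suc k) (λ ys → A (ys ++ a ∷ [])) xs (λ ys p →
            ih (ℕₚ.m<m+n a (s≤s z≤n)) ys (≡.trans (pw-length p) len) (ℕₚ.≤-trans h (cnt-mono c p))))))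

    last : ∀ q → Last q
    last = <-rec Last (λ q ih xs len h → climb q 0 ih xs len h
      (m-resp (λ N f → pieri q xs N f) (mul q (empty xs len h))))

  -- Induction on the number `t` of rows beyond the rectangle. Each further row raises the beta
  -- numbers of the others by one, hence the threshold i + t. The row moved to the end is any one
  -- that the count can spare, not necessarily the shortest.
  peel : ∀ i j → (∀ xs → length xs ≡ j → j ≤ cnt i xs → M (A xs)) →
         ∀ t xs → length xs ≡ t + j → j ≤ cnt (i + t) xs → M (A xs)
  peel i j h₀ zero    xs len h = h₀ xs len (subst (λ c → j ≤ cnt c xs) (ℕₚ.+-identityʳ i) h)
  peel i j h₀ (suc t) xs len h with cnt-extract (i + suc t) xs j (t + j) len (ℕₚ.m≤n+m j t) h
  ... | q , ys , p , h' = m-↭ (trans p (∷↭∷ʳ q ys))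
          (last (i + suc t) j (t + j) empty q ys (ℕₚ.suc-injective (≡.trans (sym (↭-length p)) len)) h')
    where
    empty : ∀ xs → length xs ≡ t + j → j ≤ cnt (i + suc t) xs → M (A (xs ++ 0 ∷ []))
    empty xs len h with map-suc? xs
    ... | inj₂ v = m-vanish v
    ... | inj₁ (ys , refl) = m-resp (λ N f → sym (drop ys N f))
      (peel i j h₀ t ys (≡.trans (sym (L.length-map suc ys)) len)
        (subst (j ≤_) (≡.trans (cong (λ c → cnt c (map suc ys)) (ℕₚ.+-suc i t)) (cnt-map-suc (i + t) ys)) h))

  A-pad : ∀ t ls N f → A (β (ls ++ replicate t 0)) N f ≡ A (β ls) N f
  A-pad zero    ls N f = cong (λ xs → A (β xs) N f) (L.++-identityʳ ls)
  A-pad (suc t) ls N f = ≡.trans (cong (λ xs → A (β xs) N f) (sym (L.++-assoc ls (0 ∷ []) (replicate t 0))))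
    (≡.trans (A-pad t (ls ++ 0 ∷ []) N f) (≡.trans (cong (λ xs → A xs N f) (β-++ ls (0 ∷ []))) (drop (β ls) N f)))

  module Truncated (r : ℕ) (long : ∀ xs → length xs ≡ suc r → All (1 ≤_) xs → M (A xs)) where

    -- The correction collects the vectors in which the pinned 0 has been raised. All their r + 1
    -- coordinates are positive, so `long` applies.
    pieri-mod : ∀ k xs → length xs ≡ r → M (λ N f → (A (k ∷ []) ⊛ A xs) N f ⊖ U k (λ ys → A ys N f) xs)
    pieri-mod k xs len = m-resp (λ N f → sym (≡.trans (cong (_⊖ U k (λ ys → A ys N f) xs) (eq N f)) (lem (U k (λ ys → A ys N f) xs) _))) (rest k)
      where
      lem : ∀ a b → a ⊕ b ⊖ a ≡ b
      lem = solve-∀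
      eq : ∀ N f → (A (k ∷ []) ⊛ A xs) N f ≡ U k (λ ys → A ys N f) xs ⊕ U⁻ k (λ ys → A ys N f) (map suc xs ++ 1 ∷ [])
      eq N f = ≡.trans (Linear.ext (lin (k ∷ []) N) (λ α → sym (drop xs N _)))
        (≡.trans (pieri k (map suc xs) N f) (≡.trans (U-++ k (λ ys → A ys N f) (map suc xs) 0)
          (cong (_⊕ U⁻ k (λ ys → A ys N f) (map suc xs ++ 1 ∷ []))
            (≡.trans (U-map-suc k (λ ys → A (ys ++ 0 ∷ []) N f) xs) (U-cong k xs (λ ys _ → drop ys N f))))))
      pos-suc : ∀ xs → All (1 ≤_) (map suc xs ++ 1 ∷ [])
      pos-suc []       = s≤s z≤n ∷ []
      pos-suc (x ∷ xs) = s≤s z≤n ∷ pos-suc xs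
      len' : length (map suc xs ++ 1 ∷ []) ≡ suc r
      len' = ≡.trans (L.length-++ (map suc xs)) (≡.trans (ℕₚ.+-comm _ 1) (cong suc (≡.trans (L.length-map suc xs) len)))
      rest : ∀ k → M (λ N f → U⁻ k (λ ys → A ys N f) (map suc xs ++ 1 ∷ []))
      rest zero    = m-0
      rest (suc k) = U-closed k A (map suc xs ++ 1 ∷ []) (λ ys p → long ys (≡.trans (pw-length p) len') (pw-pos (pos-suc xs) p))

    -- Only multiplication by `A (k ∷ [])` is at hand, and it acts through `U`. The alternating
    -- relation is solved for its term with m = 0; every other term V_l U_(m+1) is, modulo `M`, a
    -- multiple of V_l with smaller l.
    V-mem : ∀ xs → length xs ≡ r → M (A xs) → ∀ k → M (λ N f → V k (λ ys → A ys N f) xs)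
    V-mem xs len h = <-rec (λ k → M (λ N f → V k (λ ys → A ys N f) xs)) step
      where
      step : ∀ k → (∀ {l} → l < k → M (λ N f → V l (λ ys → A ys N f) xs)) → M (λ N f → V k (λ ys → A ys N f) xs)
      step zero    ih = h
      step (suc k) ih = altsum-mem (suc k) (λ l m N f → V l (U m (λ ys → A ys N f)) xs) mixed
          (m-resp (λ N f → sym (VU-altsum k (λ ys → A ys N f) xs)) m-0)
        where
        lem : ∀ a b → a ≡ (a ⊖ b) ⊕ b
        lem = solve-∀
        mixed : ∀ l m → l + suc m ≡ suc k → M (λ N f → V l (U (suc m) (λ ys → A ys N f)) xs)
        mixed l m e = m-cancel
          (λ N f → ≡.trans (L-V (lin (suc m ∷ []) N) l _ xs)
            (≡.trans (V-cong l xs (λ ys _ → lem ((A (suc m ∷ []) ⊛ A ys) N f) (U (suc m) (λ zs → A zs N f) ys)))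
                     (V-+ l _ (U (suc m) (λ ys → A ys N f)) xs)))
          (mul (suc m) (ih (ℕₚ.≤-trans (ℕₚ.m<m+n l (s≤s z≤n)) (ℕₚ.≤-reflexive e))))
          (V-closed l (λ ys N f → (A (suc m ∷ []) ⊛ A ys) N f ⊖ U (suc m) (λ zs → A zs N f) ys) xs
            (λ ys l → pieri-mod (suc m) ys (≡.trans l len)))

    -- With T k = V k applied to the coordinates other than the first, at first
    -- coordinate m − k: V (k+1) at first coordinate m − k − 1 is T (k+1) + T k, and T r = 0.
    shrink : ∀ m ys → suc (length ys) ≡ r → r ≤ m → (∀ k → 1 ≤ k → k ≤ r → M (A (m ∸ k ∷ ys))) → M (A (m ∷ ys))
    shrink m ys len r≤m h = down r 0 refl
      where
      down : ∀ d k → k + d ≡ r → M (λ N f → V k (λ zs → A (m ∸ k ∷ zs) N f) ys)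
      down zero    k e = m-resp (λ N f → sym (V-long k _ ys (ℕₚ.≤-reflexive (≡.trans len (≡.trans (sym e) (ℕₚ.+-identityʳ k)))))) m-0
      down (suc d) k e = m-cancel eq
        (V-mem (m ∸ suc k ∷ ys) len (h (suc k) (s≤s z≤n) k<r) (suc k))
        (down d (suc k) (≡.trans (sym (ℕₚ.+-suc k d)) e))
        where
        k<r : suc k ≤ r
        k<r = ℕₚ.≤-trans (ℕₚ.m<m+n k (s≤s z≤n)) (ℕₚ.≤-reflexive e)
        eq : ∀ N f → V (suc k) (λ zs → A zs N f) (m ∸ suc k ∷ ys) ≡
             V (suc k) (λ zs → A (m ∸ suc k ∷ zs) N f) ys ⊕ V k (λ zs → A (m ∸ k ∷ zs) N f) ys
        -- `r ≤ m` makes `m ∸ k` the successor of `m ∸ suc k`, so the telescoping never meets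
        -- truncated subtraction.
        eq N f = cong (λ x → V (suc k) (λ zs → A (m ∸ suc k ∷ zs) N f) ys ⊕ V k (λ zs → A (x ∷ zs) N f) ys)
          (sym (ℕₚ.+-∸-assoc 1 (ℕₚ.≤-trans k<r r≤m)))

-- Bounding the first row and the first column beyond the rectangle

∸-<  : ∀ {m k} → 1 ≤ k → 1 ≤ m → m ∸ k < m
∸-< {suc m} {suc k} _ _ = s≤s (ℕₚ.m∸n≤m m k)

-- Empty rows from `j` on have the beta numbers t - 1, ..., 0. Emptiness thus becomes an upper bound
-- on a count, and such a bound survives every lowering.
at-zero⇒cnt : ∀ ls j t → WD ls → length ls ≡ j + t → at ls j ≡ 0 → cnt t (β ls) ≤ j
at-zero⇒cnt ls j zero    wd len z = ℕₚ.≤-trans (cnt-≤-length 0 (β ls))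
  (ℕₚ.≤-reflexive (≡.trans (length-β ls) (≡.trans len (ℕₚ.+-identityʳ j))))
at-zero⇒cnt ls j (suc t) wd len z with cnt (suc t) (β ls) ℕ.≤? j
... | yes h = h
... | no ¬h = ⊥-elim (ℕₚ.<⇒≱ (cnt⇒at ls j {1} wd j< e (ℕₚ.≰⇒> ¬h)) (ℕₚ.≤-reflexive z))
  where
  j< : j < length ls
  j< = ℕₚ.≤-trans (ℕₚ.m<m+n j (s≤s z≤n)) (ℕₚ.≤-reflexive (sym len))
  e : suc t + suc j ≡ 1 + length ls
  e = ≡.trans (ℕₚ.+-suc (suc t) j) (cong suc (≡.trans (ℕₚ.+-comm (suc t) j) (sym len)))

cnt⇒at-zero : ∀ ls j t → WD ls → length ls ≡ j + t → cnt t (β ls) ≤ j → ∀ p → j ≤ p → at ls p ≡ 0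
cnt⇒at-zero ls j zero    wd len h p j≤p = at-beyond ls p
  (ℕₚ.≤-trans (ℕₚ.≤-reflexive (≡.trans len (ℕₚ.+-identityʳ j))) j≤p)
cnt⇒at-zero ls j (suc t) wd len h p j≤p with 1 ℕ.≤? at ls j
... | no ¬1 = ℕₚ.n≤0⇒n≡0 (ℕₚ.≤-trans (at-mono {ls} wd j≤p) (ℕₚ.≤-pred (ℕₚ.≰⇒> ¬1)))
... | yes 1≤ = ⊥-elim (ℕₚ.<⇒≱ (at⇒cnt ls j {1} wd j< e 1≤) h)
  where
  j< : j < length ls
  j< = ℕₚ.≤-trans (ℕₚ.m<m+n j (s≤s z≤n)) (ℕₚ.≤-reflexive (sym len))
  e : suc t + suc j ≡ 1 + length ls
  e = ≡.trans (ℕₚ.+-suc (suc t) j) (cong suc (≡.trans (ℕₚ.+-comm (suc t) j) (sym len)))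

private
  shift-length : ∀ i t j {n} → n ≡ suc j + t → i + t + suc j ≡ i + n
  shift-length i t j refl = ≡.trans (ℕₚ.+-assoc i t (suc j)) (cong (i +_) (ℕₚ.+-comm t (suc j)))

at-≥⇒cnt : ∀ ls i j t → WD ls → length ls ≡ suc j + t → i ≤ at ls j → suc j ≤ cnt (i + t) (β ls)
at-≥⇒cnt ls i j t wd len h = at⇒cnt ls j wd
  (ℕₚ.≤-trans (ℕₚ.m≤m+n (suc j) t) (ℕₚ.≤-reflexive (sym len))) (shift-length i t j len) h

cnt⇒at-≥ : ∀ ls i j t → WD ls → length ls ≡ suc j + t → suc j ≤ cnt (i + t) (β ls) → ∀ p → p < suc j → i ≤ at ls p
cnt⇒at-≥ ls i j t wd len h p (s≤s p≤j) = ℕₚ.≤-trans (cnt⇒at ls j wd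
  (ℕₚ.≤-trans (ℕₚ.m≤m+n (suc j) t) (ℕₚ.≤-reflexive (sym len))) (shift-length i t j len) h) (at-mono {ls} wd p≤j)

cnt⇒at-≤ : ∀ ls j → WD ls → cnt (j + length ls) (β ls) ≤ 0 → ∀ q → at ls q ≤ j
cnt⇒at-≤ []       j wd h q = z≤n
cnt⇒at-≤ (l ∷ ls) j wd h q with l ℕ.≤? j
... | yes le = ℕₚ.≤-trans (at-≤-head {l ∷ ls} wd q) le
... | no ¬le = ⊥-elim (ℕₚ.<⇒≱ (at⇒cnt (l ∷ ls) 0 {suc j} wd (s≤s z≤n) (ℕₚ.+-comm (j + suc (length ls)) 1) (ℕₚ.≰⇒> ¬le)) h)

module Reduction (side : Side) (M : Fam → Set) (sub : IsSub M)
                 (mul : ∀ k {p} → M p → M (Side.A side (k ∷ []) ⊛ p))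
                 (r : ℕ) (long : ∀ xs → length xs ≡ suc r → All (1 ≤_) xs → M (Side.A side xs)) where
  open Side side
  open IsSub sub
  open Closure side M sub mul
  open Truncated r long

  by-sum : (P : List ℕ → Set) → (∀ xs → (∀ ys → sum ys < sum xs → P ys) → P xs) → ∀ xs → P xs
  by-sum P step xs = <-rec (λ n → ∀ xs → sum xs ≡ n → P xs) (λ n ih xs e → step xs (λ ys lt → ih (subst (sum ys <_) e lt) ys refl)) (sum xs) xs refl

  -- Lowered vectors need not be sorted, so the induction runs over all vectors and replaces the
  -- shape conditions by counts: at least `suc j` coordinates ≥ i + t for the rectangle, at most
  -- `suc j` coordinates ≥ t for no further rows. The measure is the sum of the coordinates.
  first-row : ∀ i j t → r ≡ suc j + t →
    (∀ ν → WD ν → length ν ≡ r → (∀ p → p < suc j → i ≤ at ν p) → (∀ p → suc j ≤ p → at ν p ≡ 0) → at ν 0 ≤ i + t → M (A (β ν))) →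
    ∀ ν → WD ν → length ν ≡ r → (∀ p → p < suc j → i ≤ at ν p) → (∀ p → suc j ≤ p → at ν p ≡ 0) → M (A (β ν))
  first-row i j t r≡ hyp ν wd len lo hi = by-sum P step (β ν) (≡.trans (length-β ν) len)
      (at-≥⇒cnt ν i j t wd (≡.trans len r≡) (lo j ℕₚ.≤-refl)) (at-zero⇒cnt ν (suc j) t wd (≡.trans len r≡) (hi (suc j) ℕₚ.≤-refl))
    where
    P : List ℕ → Set
    P xs = length xs ≡ r → suc j ≤ cnt (i + t) xs → cnt t xs ≤ suc j → M (A xs)
    step : ∀ xs → (∀ ys → sum ys < sum xs → P ys) → P xs
    step xs ih len h₁ h₂ = m-sort xs sorted
      where
      sorted : ∀ ls → WD ls → length ls ≡ length xs → xs ↭ β ls → M (A (β ls))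
      sorted ls wd len' p with at ls 0 ℕ.≤? i + t
      ... | yes le = hyp ls wd (≡.trans len' len)
              (cnt⇒at-≥ ls i j t wd (≡.trans len' (≡.trans len r≡)) (subst (suc j ≤_) (cnt-↭ (i + t) p) h₁))
              (cnt⇒at-zero ls (suc j) t wd (≡.trans len' (≡.trans len r≡)) (subst (_≤ suc j) (cnt-↭ t p) h₂)) le
      sorted [] wd len' p | no ¬le = ⊥-elim (¬le z≤n)
      sorted (v ∷ ls) wd len' p | no ¬le = shrink m (β ls) (≡.trans (cong suc (length-β ls)) lenr) r≤m (λ k 1≤k k≤r →
          ih (m ∸ k ∷ β ls) (smaller k 1≤k) (≡.trans (cong suc (length-β ls)) lenr) (keep k k≤r)
            (ℕₚ.≤-trans (ℕₚ.+-monoˡ-≤ _ (ge-mono t (ℕₚ.m∸n≤m m k))) (subst (_≤ suc j) (cnt-↭ t p) h₂)))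
        where
        m = v + length ls
        lenr : suc (length ls) ≡ r
        lenr = ≡.trans len' len
        v> : i + t < v
        v> = ℕₚ.≰⇒> ¬le
        r≤m : r ≤ m
        r≤m = ℕₚ.≤-trans (ℕₚ.≤-reflexive (sym lenr)) (ℕₚ.+-monoˡ-≤ (length ls) (ℕₚ.≤-trans (s≤s z≤n) v>))
        smaller : ∀ k → 1 ≤ k → sum (m ∸ k ∷ β ls) < sum xs
        smaller k 1≤k = ℕₚ.≤-trans (ℕₚ.+-monoˡ-< (sum (β ls)) (∸-< 1≤k (ℕₚ.≤-trans (ℕₚ.≤-trans (s≤s z≤n) v>) (ℕₚ.m≤m+n v _))))
          (ℕₚ.≤-reflexive (sym (sum-↭ p)))
        keep : ∀ k → k ≤ r → suc j ≤ cnt (i + t) (m ∸ k ∷ β ls)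
        keep k k≤r = ℕₚ.≤-trans (subst (suc j ≤_) (cnt-↭ (i + t) p) h₁) (ℕₚ.+-monoˡ-≤ _
          (ℕₚ.≤-trans (ge-≤1 (i + t) m) (ℕₚ.≤-reflexive (sym (ge-yes bound)))))
          where
          bound : i + t ≤ m ∸ k
          bound = ℕₚ.m+n≤o⇒m≤o∸n (i + t) (ℕₚ.≤-trans (ℕₚ.+-monoʳ-≤ (i + t) (ℕₚ.≤-trans k≤r (ℕₚ.≤-reflexive (sym lenr))))
            (ℕₚ.≤-trans (ℕₚ.≤-reflexive (ℕₚ.+-suc (i + t) (length ls))) (ℕₚ.+-monoˡ-≤ (length ls) v>)))

  -- Three counts describe the shapes: `suc i` parts reach `j`, none exceeds `j`, at most suc i + a
  -- are nonzero. The lowered coordinate lies below the threshold of the first count and was not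
  -- counted there; the other two are upper bounds, which lowering preserves.
  next-row : ∀ i j a d → r ≡ suc i + a + d →
    (∀ α → WD α → length α ≡ r → (∀ p → p < suc i → at α p ≡ j) → at α (suc i) ≤ suc i ⊓ j →
       (∀ p → suc i + a ≤ p → at α p ≡ 0) → M (A (β α))) →
    ∀ α → WD α → length α ≡ r → (∀ p → p < suc i → at α p ≡ j) → (∀ p → suc i + a ≤ p → at α p ≡ 0) → M (A (β α))
  next-row i j a d r≡ hyp α wd len top bot = by-sum P step (β α) (≡.trans (length-β α) len)
      (at-≥⇒cnt α j i (a + d) wd (≡.trans len r≡') (ℕₚ.≤-reflexive (sym (top i ℕₚ.≤-refl))))
      (ℕₚ.≤-reflexive (cnt-zero α wd (ℕₚ.≤-reflexive (cong₂ _+_ (top 0 (s≤s z≤n)) len))))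
      (at-zero⇒cnt α (suc i + a) d wd (≡.trans len r≡) (bot (suc i + a) ℕₚ.≤-refl))
    where
    r≡' : r ≡ suc i + (a + d)
    r≡' = ≡.trans r≡ (ℕₚ.+-assoc (suc i) a d)
    P : List ℕ → Set
    P xs = length xs ≡ r → suc i ≤ cnt (j + (a + d)) xs → cnt (j + r) xs ≤ 0 → cnt d xs ≤ suc i + a → M (A xs)
    step : ∀ xs → (∀ ys → sum ys < sum xs → P ys) → P xs
    step xs ih len h₁ h₂ h₃ = m-sort xs sorted
      where
      at-≤j : ∀ ls → WD ls → length ls ≡ r → xs ↭ β ls → ∀ q → at ls q ≤ j
      at-≤j ls wd lenr p = cnt⇒at-≤ ls j wd (subst (_≤ 0) (≡.trans (cnt-↭ (j + r) p) (cong (λ n → cnt (j + n) (β ls)) (sym lenr))) h₂)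
      sorted : ∀ ls → WD ls → length ls ≡ length xs → xs ↭ β ls → M (A (β ls))
      sorted ls wd len' p with at ls (suc i) ℕ.≤? suc i ⊓ j
      ... | yes le = hyp ls wd lenr (λ q q< → ℕₚ.≤-antisym (at-≤j ls wd lenr p q) (≥j q q<)) le
              (cnt⇒at-zero ls (suc i + a) d wd (≡.trans lenr r≡) (subst (_≤ suc i + a) (cnt-↭ d p) h₃))
        where
        lenr = ≡.trans len' len
        ≥j = cnt⇒at-≥ ls j i (a + d) wd (≡.trans lenr r≡') (subst (suc i ≤_) (cnt-↭ (j + (a + d)) p) h₁)
      ... | no ¬le = m-↭ q (shrink m ys (≡.trans (sym (↭-length q)) (≡.trans (length-β ls) lenr)) r≤m (λ k 1≤k k≤r →
              ih (m ∸ k ∷ ys) (smaller k 1≤k) (≡.trans (sym (↭-length q)) (≡.trans (length-β ls) lenr)) (keep k)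
                (shrunk (j + r) k h₂) (shrunk d k h₃)))
        where
        lenr = ≡.trans len' len
        v = at ls (suc i)
        v≤j : v ≤ j
        v≤j = at-≤j ls wd lenr p (suc i)
        i<v : suc i < v
        i<v with suc i ℕ.<? v
        ... | yes lt = lt
        ... | no ¬lt = ⊥-elim (¬le (ℕₚ.⊓-glb (ℕₚ.≮⇒≥ ¬lt) v≤j))
        i<len : suc i < length ls
        i<len = at-≢0 ls (ℕₚ.≤-trans (s≤s z≤n) i<v)
        e = β-extract ls (suc i) i<len
        ys = proj₁ e
        q = proj₂ e
        m = v + (length ls ∸ suc (suc i))
        xs↭ : xs ↭ m ∷ ys
        xs↭ = trans p q
        r≤m : r ≤ m
        r≤m = ℕₚ.≤-trans (ℕₚ.≤-reflexive (≡.trans (sym lenr) (sym (ℕₚ.m+[n∸m]≡n i<len)))) (ℕₚ.+-monoˡ-≤ _ i<v)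
        smaller : ∀ k → 1 ≤ k → sum (m ∸ k ∷ ys) < sum xs
        smaller k 1≤k = ℕₚ.≤-trans (ℕₚ.+-monoˡ-< (sum ys) (∸-< 1≤k (ℕₚ.≤-trans (ℕₚ.≤-trans (s≤s z≤n) i<v) (ℕₚ.m≤m+n v _))))
          (ℕₚ.≤-reflexive (sym (sum-↭ xs↭)))
        shrunk : ∀ c k {b} → cnt c xs ≤ b → cnt c (m ∸ k ∷ ys) ≤ b
        shrunk c k h = ℕₚ.≤-trans (ℕₚ.+-monoˡ-≤ _ (ge-mono c (ℕₚ.m∸n≤m m k))) (ℕₚ.≤-trans (ℕₚ.≤-reflexive (sym (cnt-↭ c xs↭))) h)
        m< : m < j + (a + d)
        m< = ℕₚ.≤-trans (s≤s (ℕₚ.+-monoˡ-≤ (length ls ∸ suc (suc i)) v≤j)) (ℕₚ.≤-reflexive (≡.trans (sym (ℕₚ.+-suc j _)) (cong (j +_)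
          (≡.trans (sym (ℕₚ.+-∸-assoc 1 i<len)) (≡.trans (cong (_∸ suc i) (≡.trans lenr r≡')) (ℕₚ.m+n∸m≡n (suc i) (a + d)))))))
        keep : ∀ k → suc i ≤ cnt (j + (a + d)) (m ∸ k ∷ ys)
        keep k = ℕₚ.≤-trans (subst (suc i ≤_) (≡.trans (cnt-↭ (j + (a + d)) xs↭) (cong (_+ cnt (j + (a + d)) ys) (ge-no m<))) h₁)
          (ℕₚ.m≤n+m _ (ge (j + (a + d)) (m ∸ k)))

at-pad : ∀ ls t p → at (ls ++ replicate t 0) p ≡ at ls p
at-pad []       t p       = at-replicate-0 t p
at-pad (l ∷ ls) t zero    = refl
at-pad (l ∷ ls) t (suc p) = at-pad ls t p

-- s and s' are the two sides of the box (rows and columns, in either order):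
-- the shapes of s have r parts, those of s' are their conjugates and have c parts,
-- and suc j, suc i stand for the j and i of the theorem.

module Generation (s s' : Side) (M : Fam → Set) (sub : IsSub M)
  (mul  : ∀ k {p} → M p → M (Side.A s (k ∷ []) ⊛ p))
  (mul' : ∀ k {p} → M p → M (Side.A s' (k ∷ []) ⊛ p))
  (i j t w r c : ℕ) (r≡ : r ≡ suc j + t) (c≡ : c ≡ suc i + w)
  (long  : ∀ xs → length xs ≡ suc r → All (1 ≤_) xs → M (Side.A s xs))
  (long' : ∀ xs → length xs ≡ suc c → All (1 ≤_) xs → M (Side.A s' xs))
  (wide  : ∀ ν → WD ν → length ν ≡ r → c < at ν 0 → M (Side.A s (β ν)))
  (conj  : ∀ ν → WD ν → length ν ≡ r → at ν 0 ≤ c → M (Side.A s' (β (cc c ν))) → M (Side.A s (β ν)))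
  (gens  : ∀ α → WD α → length α ≡ c → (∀ p → p < suc i → at α p ≡ suc j) → at α (suc i) ≤ suc i ⊓ suc j →
           (∀ p → suc i + w ⊓ t ≤ p → at α p ≡ 0) → M (Side.A s' (β α))) where
  open Side s
  open IsSub sub
  open Closure s M sub mul
  module R  = Reduction s M sub mul r long
  module R' = Reduction s' M sub mul' c long'

  private
    c≡' : c ≡ suc i + w ⊓ t + (w ∸ w ⊓ t)
    c≡' = ≡.trans c≡ (≡.trans (cong (suc i +_) (sym (ℕₚ.m+[n∸m]≡n (ℕₚ.m⊓n≤m w t)))) (sym (ℕₚ.+-assoc (suc i) (w ⊓ t) (w ∸ w ⊓ t))))

  row-reduced : ∀ ν → WD ν → length ν ≡ r → (∀ p → p < suc j → suc i ≤ at ν p) → (∀ p → suc j ≤ p → at ν p ≡ 0) →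
                at ν 0 ≤ suc i + t → M (A (β ν))
  row-reduced ν wd len lo hi le with at ν 0 ℕ.≤? c
  ... | no ¬h = wide ν wd len (ℕₚ.≰⇒> ¬h)
  ... | yes h = conj ν wd len h (R'.next-row i (suc j) (w ⊓ t) (w ∸ w ⊓ t) c≡' gens (cc c ν) (wd-cc c ν wd h) (length-cc c ν wd h) full none)
    where
    full : ∀ p → p < suc i → at (cc c ν) p ≡ suc j
    full p p< = ℕₚ.≤-antisym
      (≤-by-< (λ k lt → ℕₚ.≰⇒> (λ j≤k → ℕₚ.<⇒≱ (cc⇒ c ν wd h {p} {k} lt) (ℕₚ.≤-trans (ℕₚ.≤-reflexive (hi k j≤k)) z≤n))))
      (≤-by-< (λ k lt → cc⇐ c ν wd h (ℕₚ.≤-trans p< (lo k lt))))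
    none : ∀ p → suc i + w ⊓ t ≤ p → at (cc c ν) p ≡ 0
    none p le' = ℕₚ.n≤0⇒n≡0 (≤-by-< (λ k lt → ⊥-elim (ℕₚ.<⇒≱ (cc⇒ c ν wd h {p} {k} lt)
      (ℕₚ.≤-trans (at-≤-head {ν} wd k) (ℕₚ.≤-trans width le')))))
      where
      -- The minimum in a arises here: `w` is the room left in the box, `t` the bound from the
      -- first-row reduction.
      width : at ν 0 ≤ suc i + w ⊓ t
      width = ℕₚ.≤-trans (ℕₚ.⊓-glb (ℕₚ.≤-trans h (ℕₚ.≤-reflexive c≡)) le) (ℕₚ.≤-reflexive (sym (ℕₚ.+-distribˡ-⊓ (suc i) w t)))

  -- The base case of `peel` has exactly `suc j` coordinates, while the reductions need all `r`, as
  -- they work modulo shapes with more than `r` rows; padding with empty rows connects the two.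
  few-rows : ∀ xs → length xs ≡ suc j → suc j ≤ cnt (suc i) xs → M (A xs)
  few-rows xs len h = m-sort xs (λ ls wd len' p → m-resp (A-pad t ls)
    (R.first-row (suc i) j t r≡ row-reduced (ls ++ replicate t 0) (wd-pad ls wd) (len-pad ls (≡.trans len' len))
      (λ q q< → ℕₚ.≤-trans (cnt⇒at-≥ ls (suc i) j 0 wd (≡.trans len' (≡.trans len (sym (ℕₚ.+-identityʳ (suc j)))))
          (subst (suc j ≤_) (≡.trans (cnt-↭ (suc i) p) (cong (λ c → cnt c (β ls)) (sym (ℕₚ.+-identityʳ (suc i))))) h) q q<)
        (ℕₚ.≤-reflexive (sym (at-pad ls t q))))
      (λ q q≥ → ≡.trans (at-pad ls t q) (at-beyond ls q (ℕₚ.≤-trans (ℕₚ.≤-reflexive (≡.trans len' len)) q≥)))))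
    where
    wd-pad : ∀ ls → WD ls → WD (ls ++ replicate t 0)
    wd-pad ls wd k = subst₂ _≤_ (sym (at-pad ls t (suc k))) (sym (at-pad ls t k)) (wd k)
    len-pad : ∀ ls → length ls ≡ suc j → length (ls ++ replicate t 0) ≡ r
    len-pad ls e = ≡.trans (L.length-++ ls) (≡.trans (cong₂ _+_ e (L.length-replicate t)) (sym r≡))

  generated : ∀ μ → WD μ → length μ ≡ r → (∀ p → p < suc j → suc i ≤ at μ p) → M (A (β μ))
  generated μ wd len lo = peel (suc i) (suc j) few-rows t (β μ)
    (≡.trans (length-β μ) (≡.trans len (≡.trans r≡ (ℕₚ.+-comm (suc j) t))))
    (at-≥⇒cnt μ (suc i) j t wd (≡.trans len r≡) (lo j ℕₚ.≤-refl))

-- Products of Schur functions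

data Span (P : Fam → Set) : Fam → Set where
  gen  : ∀ {p} → P p → Span P p
  zer  : Span P (λ _ _ → 0ℤ)
  add  : ∀ {p q} → Span P p → Span P q → Span P (λ N f → p N f ⊕ q N f)
  inv  : ∀ {p} → Span P p → Span P (λ N f → ⊝ p N f)
  resp : ∀ {p q} → (∀ N f → p N f ≡ q N f) → Span P p → Span P q

span-sub : ∀ P → IsSub (Span P)
span-sub P = record { m-0 = zer ; m-+ = add ; m-neg = inv ; m-resp = resp }

span-mulˡ : ∀ {P Q q} → (∀ N → Linear (q N)) → (∀ {g} → P g → Span Q (q ⊛ g)) → ∀ {p} → Span P p → Span Q (q ⊛ p)
span-mulˡ lin h (gen x)     = h x
span-mulˡ lin h zer         = resp (λ N f → sym (Linear.zer (lin N))) zer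
span-mulˡ lin h (add s t)   = resp (λ N f → sym (Linear.add (lin N) _ _)) (add (span-mulˡ lin h s) (span-mulˡ lin h t))
span-mulˡ lin h (inv s)     = resp (λ N f → sym (Linear.neg (lin N) _)) (inv (span-mulˡ lin h s))
span-mulˡ lin h (resp eq s) = resp (λ N f → Linear.ext (lin N) (λ α → eq N _)) (span-mulˡ lin h s)

span-mulʳ : ∀ {P Q} q → (∀ {g} → P g → Span Q (g ⊛ q)) → ∀ {p} → Span P p → Span Q (p ⊛ q)
span-mulʳ q h (gen x)     = h x
span-mulʳ q h zer         = zer
span-mulʳ q h (add s t)   = add (span-mulʳ q h s) (span-mulʳ q h t)
span-mulʳ q h (inv s)     = inv (span-mulʳ q h s)
span-mulʳ q h (resp eq s) = resp (λ N f → eq N _) (span-mulʳ q h s)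

span-map : ∀ {P Q} → (∀ {g} → P g → Span Q g) → ∀ {p} → Span P p → Span Q p
span-map h (gen x)     = h x
span-map h zer         = zer
span-map h (add s t)   = add (span-map h s) (span-map h t)
span-map h (inv s)     = inv (span-map h s)
span-map h (resp eq s) = resp eq (span-map h s)

span-times : ∀ {P} n {p} → Span P p → Span P (λ N f → ℤ.+ n ⊗ p N f)
span-times zero        s = resp (λ N f → refl) zer
span-times (suc n) {p} s = resp (λ N f → sym (ℤₚ.suc-* (ℤ.+ n) (p N f))) (add s (span-times n s))

span-scale : ∀ {P} z {p} → Span P p → Span P (λ N f → z ⊗ p N f)
span-scale (ℤ.+ n)         s = span-times n s
span-scale ℤ.-[1+ n ]  {p} s = resp (λ N f → ℤₚ.neg-distribˡ-* (ℤ.+ suc n) (p N f)) (inv (span-times (suc n) s))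

⟦⟧-linear : ∀ {N} (p : Poly N) → Linear ⟦ p ⟧
⟦⟧-linear p = record
  { ext = λ eq → lsum-cong (λ { (a , α) → cong (a ⊗_) (eq α) }) p
  ; add = λ f g → go f g p }
  where
  go : ∀ f g p → ⟦ p ⟧ (λ x → f x ⊕ g x) ≡ ⟦ p ⟧ f ⊕ ⟦ p ⟧ g
  go f g []            = refl
  go f g ((a , α) ∷ p) = ≡.trans (cong₂ _⊕_ (ℤₚ.*-distribˡ-+ a (f α) (g α)) (go f g p))
    (interchange (a ⊗ f α) (a ⊗ g α) _ _)

S-linear : ∀ μ N → Linear (S μ N)
S-linear μ N = ⟦⟧-linear (schur N μ)

⊛-linear : ∀ {p q : Fam} → (∀ N → Linear (p N)) → (∀ N → Linear (q N)) → ∀ N → Linear ((p ⊛ q) N)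
⊛-linear lp lq N = record
  { ext = λ eq → Linear.ext (lp N) (λ α → Linear.ext (lq N) (λ γ → eq _))
  ; add = λ f g → ≡.trans (Linear.ext (lp N) (λ α → Linear.add (lq N) _ _)) (Linear.add (lp N) _ _) }

⊛-assoc : ∀ {p q s : Fam} → (∀ N → Linear (p N)) → (∀ N → Linear (q N)) → (∀ N → Linear (s N)) →
          ∀ N f → ((p ⊛ q) ⊛ s) N f ≡ (p ⊛ (q ⊛ s)) N f
⊛-assoc lp lq ls N f = Linear.ext (lp N) (λ α → Linear.ext (lq N) (λ γ → Linear.ext (ls N) (λ δ →
  cong f (zipWith-assoc ℕₚ.+-assoc α γ δ))))

rowA-[] : ∀ N f → rowA [] N f ≡ f (Vec.replicate N 0)
rowA-[] zero    f = ℤₚ.*-identityˡ (f [])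
rowA-[] (suc N) f = rowA-[] N (λ α → f (0 ∷ α))

unit-⊛ : ∀ {p : Fam} → (∀ N → Linear (p N)) → ∀ N f → (rowA [] ⊛ p) N f ≡ p N f
unit-⊛ lp N f = ≡.trans (rowA-[] N _) (Linear.ext (lp N) (λ γ → cong f (zipWith-identityˡ (λ _ → refl) γ)))

strip : List ℕ → List ℕ
strip []           = []
strip (zero ∷ ls)  = []
strip (suc l ∷ ls) = suc l ∷ strip ls

at-strip : ∀ ls → WD ls → ∀ k → at (strip ls) k ≡ at ls k
at-strip []           wd k       = refl
at-strip (zero ∷ ls)  wd k       = sym (ℕₚ.n≤0⇒n≡0 (at-≤-head {0 ∷ ls} wd k))
at-strip (suc l ∷ ls) wd zero    = refl
at-strip (suc l ∷ ls) wd (suc k) = at-strip ls (wd-tail {suc l} wd) k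

wd-strip : ∀ ls → WD ls → WD (strip ls)
wd-strip ls wd k = subst₂ _≤_ (sym (at-strip ls wd (suc k))) (sym (at-strip ls wd k)) (wd k)

strip-partition : ∀ ls → WD ls → IsPartition (strip ls)
strip-partition ls wd = pos-strip ls , wd-strip ls wd
  where
  pos-strip : ∀ ls → All (1 ≤_) (strip ls)
  pos-strip []           = []
  pos-strip (zero ∷ ls)  = []
  pos-strip (suc l ∷ ls) = s≤s z≤n ∷ pos-strip ls

cc-strip : ∀ C ls → WD ls → cc C (strip ls) ≡ cc C ls
cc-strip C []           wd = refl
cc-strip C (zero ∷ ls)  wd = sym (cc-zero C (0 ∷ ls) wd refl)
cc-strip C (suc l ∷ ls) wd = cong (λ xs → map suc xs ++ replicate (C ∸ suc l) 0) (cc-strip (suc l) ls (wd-tail {suc l} wd))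

-- Proved through the conjugate, in which trailing zeros are invisible.
S-strip : ∀ ls → WD ls → ∀ N f → S (strip ls) N f ≡ S ls N f
S-strip ls wd N f = ≡.trans (sym (col-schur (at ls 0) (strip ls) (wd-strip ls wd) (ℕₚ.≤-reflexive (at-strip ls wd 0)) N f))
  (≡.trans (cong (λ xs → colA (β xs) N f) (cc-strip (at ls 0) ls wd)) (col-schur (at ls 0) ls wd ℕₚ.≤-refl N f))

data Above (τ : List ℕ) : Fam → Set where
  above : ∀ {ls} → IsPartition ls → τ ⊆ₚ ls → Above τ (S ls)

row-above : ∀ τ ls → WD ls → τ ⊆ₚ ls → Span (Above τ) (rowA (β ls))
row-above τ ls wd h = resp (λ N f → ≡.trans (S-strip ls wd N f) (sym (row-schur ls wd N f)))
  (gen (above (strip-partition ls wd) (λ k → ℕₚ.≤-trans (h k) (ℕₚ.≤-reflexive (sym (at-strip ls wd k))))))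

-- Raising coordinates can only increase the counts, so the sorted results contain `ls`.
pieri-above : ∀ τ k ls → WD ls → τ ⊆ₚ ls → Span (Above τ) (rowA (k ∷ []) ⊛ S ls)
pieri-above τ k ls wd h = resp eq
  (IsSub.U-closed (span-sub (Above τ)) k rowA (map suc (β ls) ++ 0 ∷ []) (λ ys p →
    m-sort ys (λ ms wdm len q → row-above τ ms wdm (λ x → ℕₚ.≤-trans (h x) (grow ys p ms wdm len q x)))))
  where
  open Sorting rows (Span (Above τ)) (span-sub (Above τ))
  eq : ∀ N f → U k (λ ys → rowA ys N f) (map suc (β ls) ++ 0 ∷ []) ≡ (rowA (k ∷ []) ⊛ S ls) N f
  eq N f = ≡.trans (sym (row-pieri k (map suc (β ls)) N f))
    (Linear.ext (row-linear (k ∷ []) N) (λ α → ≡.trans (row-drop (β ls) N _) (row-schur ls wd N _)))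
  ls⁺ = ls ++ replicate 1 0
  wd⁺ : WD ls⁺
  wd⁺ x = subst₂ _≤_ (sym (at-pad ls 1 (suc x))) (sym (at-pad ls 1 x)) (wd x)
  grow : ∀ ys → Pointwise _≤_ (map suc (β ls) ++ 0 ∷ []) ys → ∀ ms → WD ms → length ms ≡ length ys → ys ↭ β ms →
         ls ⊆ₚ ms
  grow ys p ms wdm len q x with x ℕ.<? length ls⁺
  ... | no x≥ = ℕₚ.≤-trans (ℕₚ.≤-reflexive (≡.trans (sym (at-pad ls 1 x)) (at-beyond ls⁺ x (ℕₚ.≮⇒≥ x≥)))) z≤n
  ... | yes x< = ℕₚ.≤-trans (ℕₚ.≤-reflexive (sym (at-pad ls 1 x)))
      (cnt⇒at ms x wdm (subst (x <_) (sym len-eq) x<) (≡.trans c≡ (cong (at ls⁺ x +_) (sym len-eq)))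
        (ℕₚ.≤-trans (at⇒cnt ls⁺ x wd⁺ x< c≡ ℕₚ.≤-refl)
          (ℕₚ.≤-trans (ℕₚ.≤-trans (ℕₚ.≤-reflexive (cong (cnt c) (β-++ ls (0 ∷ [])))) (cnt-mono c p)) (ℕₚ.≤-reflexive (cnt-↭ c q)))))
    where
    -- The threshold is the beta number of row `x` itself.
    c = at ls⁺ x + (length ls⁺ ∸ suc x)
    c≡ : c + suc x ≡ at ls⁺ x + length ls⁺
    c≡ = ≡.trans (ℕₚ.+-assoc (at ls⁺ x) (length ls⁺ ∸ suc x) (suc x)) (cong (at ls⁺ x +_) (ℕₚ.m∸n+n≡m x<))
    len-eq : length ms ≡ length ls⁺
    len-eq = ≡.trans len (≡.trans (pw-length p) (≡.trans (cong length (sym (β-++ ls (0 ∷ [])))) (length-β ls⁺)))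

-- No Littlewood-Richardson rule is required: with the empty rectangle, `peel` obtains every Schur
-- function from 1 by products with h_k, and each such product keeps the shapes above `τ`.
schur-product : ∀ τ → IsPartition τ → ∀ κ → WD κ → Span (Above τ) (S κ ⊛ S τ)
schur-product τ pτ κ wd = resp (λ N f → row-schur κ wd N _)
  (proj₂ (peel 0 0 empty (length κ) (β κ) (≡.trans (length-β κ) (sym (ℕₚ.+-identityʳ _))) z≤n))
  where
  -- Linearity is carried along because reassociating the products needs it.
  M : Fam → Set
  M p = (∀ N → Linear (p N)) × Span (Above τ) (p ⊛ S τ)
  sub : IsSub M
  sub = record
    { m-0 = (λ N → record { ext = λ _ → refl ; add = λ _ _ → refl }) , zer
    ; m-+ = λ { {p} {q} (lp , sp) (lq , sq) →
        (λ N → record { ext = λ eq → cong₂ _⊕_ (Linear.ext (lp N) eq) (Linear.ext (lq N) eq)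
                      ; add = λ f g → ≡.trans (cong₂ _⊕_ (Linear.add (lp N) f g) (Linear.add (lq N) f g))
                                              (interchange (p N f) (p N g) (q N f) (q N g)) }) , add sp sq }
    ; m-neg = λ { {p} (lp , sp) →
        (λ N → record { ext = λ eq → cong ⊝_ (Linear.ext (lp N) eq)
                      ; add = λ f g → ≡.trans (cong ⊝_ (Linear.add (lp N) f g)) (ℤₚ.neg-distrib-+ (p N f) (p N g)) }) , inv sp }
    ; m-resp = λ { {p} {q} eq (lp , sp) →
        (λ N → record { ext = λ e → ≡.trans (sym (eq N _)) (≡.trans (Linear.ext (lp N) e) (eq N _))
                      ; add = λ f g → ≡.trans (sym (eq N _)) (≡.trans (Linear.add (lp N) f g) (cong₂ _⊕_ (eq N f) (eq N g))) }) ,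
        resp (λ N f → eq N _) sp } }
  mul : ∀ k {p} → M p → M (rowA (k ∷ []) ⊛ p)
  mul k (lp , sp) = ⊛-linear (row-linear (k ∷ [])) lp ,
    resp (λ N f → sym (⊛-assoc (row-linear (k ∷ [])) lp (S-linear τ) N f))
      (span-mulˡ (row-linear (k ∷ [])) (λ { (above {ls} pl h) → pieri-above τ k ls (proj₂ pl) h }) sp)
  open Closure rows M sub mul
  empty : ∀ xs → length xs ≡ 0 → 0 ≤ cnt 0 xs → M (rowA xs)
  empty [] _ _ = row-linear [] , resp (λ N f → sym (unit-⊛ (S-linear τ) N f)) (gen (above pτ (λ k → ℕₚ.≤-refl)))

-- The box and the ideal

at-rect-≤ : ∀ c d k → at (rect c d) k ≤ c
at-rect-≤ c zero    k       = z≤n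
at-rect-≤ c (suc d) zero    = ℕₚ.≤-refl
at-rect-≤ c (suc d) (suc k) = at-rect-≤ c d k

at-rect-< : ∀ c d k → k < d → at (rect c d) k ≡ c
at-rect-< c (suc d) zero    _       = refl
at-rect-< c (suc d) (suc k) (s≤s h) = at-rect-< c d k h

at-rect-≥ : ∀ c d k → d ≤ k → at (rect c d) k ≡ 0
at-rect-≥ c d k h = at-beyond (rect c d) k (ℕₚ.≤-trans (ℕₚ.≤-reflexive (L.length-replicate d)) h)

at-pos : ∀ ls → All (1 ≤_) ls → ∀ k → k < length ls → 1 ≤ at ls k
at-pos (l ∷ ls) (h ∷ _) zero    _       = h
at-pos (l ∷ ls) (_ ∷ a) (suc k) (s≤s q) = at-pos ls a k q

in-box? : ∀ ls → IsPartition ls → ∀ c r → (ls ⊆ₚ rect c r) ⊎ ¬ (ls ⊆ₚ rect c r)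
in-box? ls (all-pos , wd) c r with length ls ℕ.≤? r | at ls 0 ℕ.≤? c
... | no ¬l | _ = inj₂ (λ h → ℕₚ.<⇒≱ (at-pos ls all-pos r (ℕₚ.≰⇒> ¬l)) (ℕₚ.≤-trans (h r) (ℕₚ.≤-reflexive (at-rect-≥ c r r ℕₚ.≤-refl))))
... | yes _ | no ¬h = inj₂ (λ h → ¬h (ℕₚ.≤-trans (h 0) (at-rect-≤ c r 0)))
... | yes l | yes h = inj₁ go
  where
  go : ls ⊆ₚ rect c r
  go k with k ℕ.<? r
  ... | yes k<r = ℕₚ.≤-trans (at-≤-head {ls} wd k) (ℕₚ.≤-trans h (ℕₚ.≤-reflexive (sym (at-rect-< c r k k<r))))
  ... | no k≥r  = ℕₚ.≤-trans (ℕₚ.≤-reflexive (at-beyond ls k (ℕₚ.≤-trans l (ℕₚ.≮⇒≥ k≥r)))) z≤n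

β-last-pos : ∀ ls n → length ls ≡ suc n → All (1 ≤_) (β ls) → 1 ≤ at ls n
β-last-pos (l ∷ [])      zero    e (h ∷ _) = subst (1 ≤_) (ℕₚ.+-identityʳ l) h
β-last-pos (l ∷ l' ∷ ls) (suc n) e (_ ∷ a) = β-last-pos (l' ∷ ls) n (ℕₚ.suc-injective e) a

col-cc : ∀ L α → WD α → at α 0 ≤ L → ∀ N f → colA (β α) N f ≡ S (cc L α) N f
col-cc L α wd h N f = ≡.trans (cong (λ xs → colA (β xs) N f) (sym (cc-invol L α wd h)))
  (col-schur (length α) (cc L α) (wd-cc L α wd h) (cc-head L α wd h) N f)

cc-ones : ∀ k → cc 1 (replicate k 1) ≡ k ∷ []
cc-ones zero    = refl
cc-ones (suc k) = cong (λ xs → map suc xs ++ []) (cc-ones k)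

wd-replicate : ∀ k → WD (replicate k 1)
wd-replicate zero    = wd-[]
wd-replicate (suc k) = wd-∷ (at-rect-≤ 1 k 0) (wd-replicate k)

-- Spans, as an abelian group, the preimage in Λ of the ideal generated by `Gen` in the quotient.
data Ideal (c r : ℕ) (Gen : List ℕ → Set) : Fam → Set where
  multiple : ∀ {ls ν} → IsPartition ls → IsPartition ν → Gen ν → Ideal c r Gen (S ls ⊛ S ν)
  outside  : ∀ {ls} → IsPartition ls → ¬ (ls ⊆ₚ rect c r) → Ideal c r Gen (S ls)

module Quotient (c r : ℕ) (Gen : List ℕ → Set) where

  M : Fam → Set
  M = Span (Ideal c r Gen)

  sub : IsSub M
  sub = span-sub (Ideal c r Gen)

  -- For a multiple, the two Schur factors in front of the generator are expanded into single Schur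
  -- functions. For a shape outside the box, the product only has shapes containing it, which stay
  -- outside.
  mul : ∀ κ → WD κ → ∀ {p} → M p → M (S κ ⊛ p)
  mul κ wd = span-mulˡ (S-linear κ) step
    where
    step : ∀ {g} → Ideal c r Gen g → M (S κ ⊛ g)
    step (multiple {ls} {ν} pl pν gν) = resp (λ N f → ⊛-assoc (S-linear κ) (S-linear ls) (S-linear ν) N f)
      (span-mulʳ (S ν) (λ { (above pm _) → gen (multiple pm pν gν) }) (schur-product ls pl κ wd))
    step (outside {ls} pl out) = span-map (λ { (above pm h) → gen (outside pm (λ in' → out (λ k → ℕₚ.≤-trans (h k) (in' k)))) })
      (schur-product ls pl κ wd)

  mul-row : ∀ k {p} → M p → M (rowA (k ∷ []) ⊛ p)
  mul-row k h = resp (λ N f → sym (eq N _)) (mul (k ∷ []) (wd-∷ z≤n wd-[]) h)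
    where
    eq : ∀ N f → rowA (k ∷ []) N f ≡ S (k ∷ []) N f
    eq N f = ≡.trans (cong (λ x → rowA (x ∷ []) N f) (sym (ℕₚ.+-identityʳ k))) (row-schur (k ∷ []) (wd-∷ z≤n wd-[]) N f)

  mul-col : ∀ k {p} → M p → M (colA (k ∷ []) ⊛ p)
  mul-col k h = resp (λ N f → sym (eq N _)) (mul (replicate k 1) (wd-replicate k) h)
    where
    eq : ∀ N f → colA (k ∷ []) N f ≡ S (replicate k 1) N f
    eq N f = ≡.trans (cong (λ x → colA (x ∷ []) N f) (sym (ℕₚ.+-identityʳ k)))
      (≡.trans (cong (λ xs → colA (β xs) N f) (sym (cc-ones k))) (col-schur 1 (replicate k 1) (wd-replicate k) (at-rect-≤ 1 k 0) N f))

  outer : ∀ ls → WD ls → ∀ k → at (rect c r) k < at ls k → M (S ls)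
  outer ls wd k lt = resp (S-strip ls wd) (gen (outside (strip-partition ls wd)
    (λ h → ℕₚ.<⇒≱ lt (ℕₚ.≤-trans (ℕₚ.≤-reflexive (sym (at-strip ls wd k))) (h k)))))

  low-row : ∀ ls → WD ls → 1 ≤ at ls r → M (S ls)
  low-row ls wd h = outer ls wd r (ℕₚ.≤-trans (s≤s (ℕₚ.≤-reflexive (at-rect-≥ c r r ℕₚ.≤-refl))) h)

  far-col : ∀ ls → WD ls → c < at ls 0 → M (S ls)
  far-col ls wd h = outer ls wd 0 (ℕₚ.≤-trans (s≤s (at-rect-≤ c r 0)) h)

  long-row : ∀ xs → length xs ≡ suc r → All (1 ≤_) xs → M (rowA xs)
  long-row xs len a = m-sort xs (λ ls wd len' p → resp (λ N f → sym (row-schur ls wd N f))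
    (low-row ls wd (β-last-pos ls r (≡.trans len' len) (All-resp-↭ p a))))
    where open Sorting rows M sub

  long-col : ∀ xs → length xs ≡ suc c → All (1 ≤_) xs → M (colA xs)
  long-col xs len a = m-sort xs (λ ls wd len' p → resp (λ N f → sym (col-cc (at ls 0) ls wd ℕₚ.≤-refl N f))
    (far-col (cc (at ls 0) ls) (wd-cc (at ls 0) ls wd ℕₚ.≤-refl)
      (cc⇐ (at ls 0) ls wd ℕₚ.≤-refl (β-last-pos ls c (≡.trans len' len) (All-resp-↭ p a)))))
    where open Sorting cols M sub

  generator : ∀ ls → WD ls → Gen (strip ls) → M (S ls)
  generator ls wd g = resp (λ N f → ≡.trans
      (≡.trans (sym (row-schur [] wd-[] N _)) (unit-⊛ (S-linear (strip ls)) N f)) (S-strip ls wd N f))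
    (gen (multiple ([] , wd-[]) (strip-partition ls wd) g))

-- From functionals back to coefficients and explicit combinations

-- A coefficient is the value of the functional at an indicator function, so equal functionals give
-- equal polynomials.
δ : ∀ {N} → Vec ℕ N → Vec ℕ N → ℤ
δ α γ = if ⌊ ≡-dec ℕₚ._≟_ γ α ⌋ then 1ℤ else 0ℤ

coeff-⟦⟧ : ∀ {N} (p : Poly N) α → coeff p α ≡ ⟦ p ⟧ (δ α)
coeff-⟦⟧ []            α = refl
coeff-⟦⟧ ((a , γ) ∷ p) α with ⌊ ≡-dec ℕₚ._≟_ γ α ⌋
... | true  = cong₂ _⊕_ (sym (ℤₚ.*-identityʳ a)) (coeff-⟦⟧ p α)
... | false = ≡.trans (coeff-⟦⟧ p α) (≡.trans (sym (ℤₚ.+-identityˡ _)) (cong (_⊕ ⟦ p ⟧ (δ α)) (sym (ℤₚ.*-zeroʳ a))))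

≈P-by-⟦⟧ : ∀ {N} (p q : Poly N) → (∀ f → ⟦ p ⟧ f ≡ ⟦ q ⟧ f) → p ≈P q
≈P-by-⟦⟧ p q eq α = ≡.trans (coeff-⟦⟧ p α) (≡.trans (eq (δ α)) (sym (coeff-⟦⟧ q α)))

lsum-scale : ∀ {X : Set} z (g : X → ℤ) xs → lsum (λ x → z ⊗ g x) xs ≡ z ⊗ lsum g xs
lsum-scale z g []       = sym (ℤₚ.*-zeroʳ z)
lsum-scale z g (x ∷ xs) = ≡.trans (cong (z ⊗ g x ⊕_) (lsum-scale z g xs)) (sym (ℤₚ.*-distribˡ-+ z (g x) (lsum g xs)))

⟦scaleP⟧ : ∀ {N} z (p : Poly N) f → ⟦ scaleP z p ⟧ f ≡ z ⊗ ⟦ p ⟧ f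
⟦scaleP⟧ z p f = ≡.trans (lsum-map (term f) _ p)
  (≡.trans (lsum-cong (λ { (a , α) → ℤₚ.*-assoc z a (f α) }) p) (lsum-scale z (term f) p))

⟦mulP⟧ : ∀ {N} (p q : Poly N) f → ⟦ mulP p q ⟧ f ≡ ⟦ p ⟧ (λ α → ⟦ q ⟧ (λ γ → f (zipWith _+_ α γ)))
⟦mulP⟧ p q f = ≡.trans (lsum-concatMap (term f) _ p) (lsum-cong (λ { (a , α) →
  ≡.trans (lsum-map (term f) _ q) (≡.trans (lsum-cong (λ { (b , γ) → ℤₚ.*-assoc a b _ }) q)
    (lsum-scale a (term (λ γ → f (zipWith _+_ α γ))) q)) }) p)

Comb : {X : Set} → (X → Fam) → List (ℤ × X) → Fam
Comb ev G N f = lsum (λ { (z , x) → z ⊗ ev x N f }) G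

⟦evalLin⟧ : ∀ G N f → ⟦ evalLin N G ⟧ f ≡ Comb S G N f
⟦evalLin⟧ G N f = ≡.trans (lsum-concatMap (term f) _ G) (lsum-cong (λ { (z , l) → ⟦scaleP⟧ z (schur N l) f }) G)

S² : List ℕ × List ℕ → Fam
S² (l , m) = S l ⊛ S m

⟦evalGen⟧ : ∀ G N f → ⟦ evalGen N G ⟧ f ≡ Comb S² G N f
⟦evalGen⟧ G N f = ≡.trans (lsum-concatMap (term f) _ G) (lsum-cong (λ { (z , l , m) →
  ≡.trans (⟦scaleP⟧ z (mulP (schur N l) (schur N m)) f) (cong (z ⊗_) (⟦mulP⟧ (schur N l) (schur N m) f)) }) G)

-- Turns a derivation of span membership into the two explicit lists that `GeneratesJ` demands.
-- Negation is carried out on the coefficients, hence `negX` and `negY`.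
module Extract {X Y : Set} (evX : X → Fam) (evY : Y → Fam) (PX : ℤ × X → Set) (PY : ℤ × Y → Set)
  (negX : ∀ {z x} → PX (z , x) → PX (⊝ z , x)) (negY : ∀ {z y} → PY (z , y) → PY (⊝ z , y)) where

  Result : Fam → Set
  Result p = Σ (List (ℤ × X)) λ G → All PX G × Σ (List (ℤ × Y)) λ I → All PY I ×
             (∀ N f → p N f ≡ Comb evX G N f ⊕ Comb evY I N f)

  flip-sign : ∀ {Z : Set} → ℤ × Z → ℤ × Z
  flip-sign (z , x) = ⊝ z , x

  Comb-neg : ∀ {Z : Set} (ev : Z → Fam) G N f → Comb ev (map flip-sign G) N f ≡ ⊝ Comb ev G N f
  Comb-neg ev []            N f = refl
  Comb-neg ev ((z , x) ∷ G) N f = ≡.trans (cong₂ _⊕_ (sym (ℤₚ.neg-distribˡ-* z (ev x N f))) (Comb-neg ev G N f))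
    (sym (ℤₚ.neg-distrib-+ (z ⊗ ev x N f) _))

  all-neg : ∀ {Z : Set} {P : ℤ × Z → Set} → (∀ {z x} → P (z , x) → P (⊝ z , x)) → ∀ {G} → All P G → All P (map flip-sign G)
  all-neg h []      = []
  all-neg h (p ∷ a) = h p ∷ all-neg h a

  single : ∀ {Z : Set} (ev : Z → Fam) x N f → Comb ev ((1ℤ , x) ∷ []) N f ≡ ev x N f
  single ev x N f = ≡.trans (ℤₚ.+-identityʳ _) (ℤₚ.*-identityˡ _)

  left : ∀ x → PX (1ℤ , x) → Result (evX x)
  left x p = (1ℤ , x) ∷ [] , p ∷ [] , [] , [] , λ N f → sym (≡.trans (ℤₚ.+-identityʳ _) (single evX x N f))

  right : ∀ y → PY (1ℤ , y) → Result (evY y)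
  right y p = [] , [] , (1ℤ , y) ∷ [] , p ∷ [] , λ N f → sym (≡.trans (ℤₚ.+-identityˡ _) (single evY y N f))

  extract : ∀ {P : Fam → Set} → (∀ {g} → P g → Result g) → ∀ {p} → Span P p → Result p
  extract h (gen x) = h x
  extract h zer = [] , [] , [] , [] , λ _ _ → refl
  extract h (add s t) with extract h s | extract h t
  ... | G , aG , I , aI , e | G' , aG' , I' , aI' , e' = G ++ G' , ++⁺ aG aG' , I ++ I' , ++⁺ aI aI' , λ N f →
    ≡.trans (cong₂ _⊕_ (e N f) (e' N f)) (≡.trans (interchange (Comb evX G N f) _ _ _)
      (sym (cong₂ _⊕_ (lsum-++ _ G G') (lsum-++ _ I I'))))
  extract h (inv s) with extract h s
  ... | G , aG , I , aI , e = map flip-sign G , all-neg negX aG , map flip-sign I , all-neg negY aI , λ N f →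
    ≡.trans (cong ⊝_ (e N f)) (≡.trans (ℤₚ.neg-distrib-+ (Comb evX G N f) _)
      (sym (cong₂ _⊕_ (Comb-neg evX G N f) (Comb-neg evY I N f))))
  extract h (resp eq s) with extract h s
  ... | G , aG , I , aI , e = G , aG , I , aI , λ N f → ≡.trans (sym (eq N f)) (e N f)

-- The direction from the generators to J needs only `lower`: a product with s_ν expands in shapes
-- containing ν, hence the rectangle, and each of them lies in the box or is divided out.
generates : ∀ r n i j (Gen : List ℕ → Set) → (∀ ν → Gen ν → rect i j ⊆ₚ ν) →
  (∀ μ → IsPartition μ → rect i j ⊆ₚ μ → μ ⊆ₚ box r n → Quotient.M (n ∸ r) r Gen (S μ)) → GeneratesJ r n i j Gen
generates r n i j Gen lower mem = forward , backward
  where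
  forward : ∀ μ → IsPartition μ → rect i j ⊆ₚ μ → μ ⊆ₚ box r n →
     Σ GenComb λ G → All (InGen Gen) G × Σ LinComb λ I → All (InI r n) I × ∀ N → schur N μ ≈P (evalGen N G ++ evalLin N I)
  forward μ pμ lo hi with extract base-case (mem μ pμ lo hi)
    where
    open Extract S² S (InGen Gen) (InI r n) (λ p → p) (λ p → p)
    base-case : ∀ {g} → Ideal (n ∸ r) r Gen g → Result g
    base-case (multiple {ls} {ν} pl pν gν) = left (ls , ν) (pl , pν , gν)
    base-case (outside {ls} pl out)        = right ls (pl , out)
  ... | G , aG , I , aI , e = G , aG , I , aI , λ N → ≈P-by-⟦⟧ (schur N μ) (evalGen N G ++ evalLin N I) (λ f →
    ≡.trans (e N f) (sym (≡.trans (lsum-++ (term f) (evalGen N G) (evalLin N I)) (cong₂ _⊕_ (⟦evalGen⟧ G N f) (⟦evalLin⟧ I N f)))))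
  span : ∀ G → All (InGen Gen) G → Span (Above (rect i j)) (Comb S² G)
  span []              []                   = zer
  span ((z , l , m) ∷ G) ((pl , pm , gm) ∷ a) = add
    (span-scale z (span-map (λ { (above pk h) → gen (above pk (λ k → ℕₚ.≤-trans (lower m gm k) (h k))) })
      (schur-product m pm l (proj₂ pl))))
    (span G a)
  backward : ∀ (G : GenComb) → All (InGen Gen) G →
     Σ LinComb λ Jc → All (InJ r n i j) Jc × Σ LinComb λ I → All (InI r n) I × ∀ N → evalGen N G ≈P (evalLin N Jc ++ evalLin N I)
  backward G a with extract base-case (span G a)
    where
    open Extract S S (InJ r n i j) (InI r n) (λ p → p) (λ p → p)
    base-case : ∀ {g} → Above (rect i j) g → Result g
    base-case (above {ls} pl h) with in-box? ls pl (n ∸ r) r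
    ... | inj₁ inside = left ls (pl , h , inside)
    ... | inj₂ out    = right ls (pl , out)
  ... | J , aJ , I , aI , e = J , aJ , I , aI , λ N → ≈P-by-⟦⟧ (evalGen N G) (evalLin N J ++ evalLin N I) (λ f →
    ≡.trans (⟦evalGen⟧ G N f) (≡.trans (e N f) (sym (≡.trans (lsum-++ (term f) (evalLin N J) (evalLin N I))
      (cong₂ _⊕_ (⟦evalLin⟧ J N f) (⟦evalLin⟧ I N f))))))

-- The two generating sets

at-rect-++-< : ∀ x b ys k → k < b → at (rect x b ++ ys) k ≡ x
at-rect-++-< x (suc b) ys zero    _       = refl
at-rect-++-< x (suc b) ys (suc k) (s≤s h) = at-rect-++-< x b ys k h

at-rect-++-≥ : ∀ x b ys k → b ≤ k → at (rect x b ++ ys) k ≡ at ys (k ∸ b)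
at-rect-++-≥ x zero    ys k       _       = refl
at-rect-++-≥ x (suc b) ys (suc k) (s≤s h) = at-rect-++-≥ x b ys k h

rect-⊆ : ∀ i j ν → (∀ k → k < j → i ≤ at ν k) → rect i j ⊆ₚ ν
rect-⊆ i j ν h k with k ℕ.<? j
... | yes k<j = ℕₚ.≤-trans (at-rect-≤ i j k) (h k k<j)
... | no k≥j  = ℕₚ.≤-trans (ℕₚ.≤-reflexive (at-rect-≥ i j k (ℕₚ.≮⇒≥ k≥j))) z≤n

⊆-rect : ∀ {i j ν} → rect i j ⊆ₚ ν → ∀ k → k < j → i ≤ at ν k
⊆-rect {i} {j} h k k<j = ℕₚ.≤-trans (ℕₚ.≤-reflexive (sym (at-rect-< i j k k<j))) (h k)

module _ (r n i j : ℕ) (i≤c : suc i ≤ n ∸ r) (j≤r : suc j ≤ r) where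
  private
    c = n ∸ r
    w = c ∸ suc i
    t = r ∸ suc j
    a = w ⊓ t
    b = suc i ⊓ suc j
    r≡ : r ≡ suc j + t
    r≡ = sym (ℕₚ.m+[n∸m]≡n j≤r)
    c≡ : c ≡ suc i + w
    c≡ = sym (ℕₚ.m+[n∸m]≡n i≤c)

  Wide : List ℕ → Set
  Wide ν = IsPartition ν × rect (suc i) (suc j) ⊆ₚ ν × ν ⊆ₚ (rect (suc i + a) b ++ rect (suc i) (suc j ∸ b))

  Tall : List ℕ → Set
  Tall ν = IsPartition ν × rect (suc i) (suc j) ⊆ₚ ν × ν ⊆ₚ (rect (suc i) (suc j) ++ rect b a)

  module _ where
    open Quotient c r Wide

    wide-generator : ∀ α → WD α → length α ≡ c → (∀ p → p < suc i → at α p ≡ suc j) → at α (suc i) ≤ b →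
                     (∀ p → suc i + a ≤ p → at α p ≡ 0) → M (colA (β α))
    wide-generator α wd len top next bot = resp (λ N f → sym (col-cc r α wd h N f))
      (generator ν wdν (strip-partition ν wdν , rect-⊆ (suc i) (suc j) (strip ν) lower , upper))
      where
      h : at α 0 ≤ r
      h = ℕₚ.≤-trans (ℕₚ.≤-reflexive (top 0 (s≤s z≤n))) j≤r
      ν = cc r α
      wdν : WD ν
      wdν = wd-cc r α wd h
      lower : ∀ k → k < suc j → suc i ≤ at (strip ν) k
      lower k k<j = ℕₚ.≤-trans (≤-by-< (λ p p< → cc⇐ r α wd h (ℕₚ.≤-trans k<j (ℕₚ.≤-reflexive (sym (top p p<))))))
        (ℕₚ.≤-reflexive (sym (at-strip ν wdν k)))
      bound : ∀ k m → (∀ p → k < at α p → p < m) → at ν k ≤ m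
      bound k m f = ≤-by-< (λ p lt → f p (cc⇒ r α wd h {k} {p} lt))
      upper′ : ∀ k → at ν k ≤ at (rect (suc i + a) b ++ rect (suc i) (suc j ∸ b)) k
      upper′ k with k ℕ.<? b | k ℕ.<? suc j
      -- No row is longer than the number of nonempty columns.
      ... | yes k<b | _ = ℕₚ.≤-trans (bound k (suc i + a) (λ p lt → ℕₚ.≰⇒> (λ le → ℕₚ.<⇒≱ lt (ℕₚ.≤-trans (ℕₚ.≤-reflexive (bot p le)) z≤n))))
              (ℕₚ.≤-reflexive (sym (at-rect-++-< (suc i + a) b _ k k<b)))
      -- All columns from index `suc i` on have height at most `b`, so a row from `b` on ends with
      -- the rectangle.
      ... | no k≥b | yes k<j = ℕₚ.≤-trans (bound k (suc i) (λ p lt → ℕₚ.≰⇒> (λ le →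
                ℕₚ.<⇒≱ lt (ℕₚ.≤-trans (at-mono {α} wd le) (ℕₚ.≤-trans next (ℕₚ.≮⇒≥ k≥b))))))
              (ℕₚ.≤-reflexive (sym (≡.trans (at-rect-++-≥ (suc i + a) b _ k (ℕₚ.≮⇒≥ k≥b))
                (at-rect-< (suc i) (suc j ∸ b) (k ∸ b) (ℕₚ.∸-monoˡ-< k<j (ℕₚ.≮⇒≥ k≥b))))))
      ... | no _ | no k≥j = ℕₚ.≤-trans (bound k 0 (λ p lt → ⊥-elim (ℕₚ.<⇒≱ lt
                (ℕₚ.≤-trans (at-≤-head {α} wd p) (ℕₚ.≤-trans (ℕₚ.≤-reflexive (top 0 (s≤s z≤n))) (ℕₚ.≮⇒≥ k≥j)))))) z≤n
      upper : strip ν ⊆ₚ (rect (suc i + a) b ++ rect (suc i) (suc j ∸ b))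
      upper k = ℕₚ.≤-trans (ℕₚ.≤-reflexive (at-strip ν wdν k)) (upper′ k)

    wide-generates : GeneratesJ r n (suc i) (suc j) Wide
    wide-generates = generates r n (suc i) (suc j) Wide (λ _ g → proj₁ (proj₂ g)) mem
      where
      open Generation rows cols M sub mul-row mul-col i j t w r c r≡ c≡ long-row long-col
        (λ ν wd _ h → resp (λ N f → sym (row-schur ν wd N f)) (far-col ν wd h))
        (λ ν wd _ h → resp (λ N f → ≡.trans (col-schur c ν wd h N f) (sym (row-schur ν wd N f))))
        wide-generator using (generated)
      open Closure rows M sub mul-row using (A-pad)
      mem : ∀ μ → IsPartition μ → rect (suc i) (suc j) ⊆ₚ μ → μ ⊆ₚ box r n → M (S μ)
      mem μ (all-pos , wd) lo hi = resp (λ N f → ≡.trans (A-pad d μ N f) (row-schur μ wd N f))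
        (generated (μ ++ replicate d 0) wd⁺ len⁺ (λ p p< →
          ℕₚ.≤-trans (⊆-rect {suc i} {suc j} {μ} lo p p<) (ℕₚ.≤-reflexive (sym (at-pad μ d p)))))
        where
        d = r ∸ length μ
        len : length μ ≤ r
        len = ℕₚ.≮⇒≥ (λ r< → ℕₚ.<⇒≱ (at-pos μ all-pos r r<) (ℕₚ.≤-trans (hi r) (ℕₚ.≤-reflexive (at-rect-≥ c r r ℕₚ.≤-refl))))
        len⁺ : length (μ ++ replicate d 0) ≡ r
        len⁺ = ≡.trans (L.length-++ μ) (≡.trans (cong (length μ +_) (L.length-replicate d)) (ℕₚ.m+[n∸m]≡n len))
        wd⁺ : WD (μ ++ replicate d 0)
        wd⁺ k = subst₂ _≤_ (sym (at-pad μ d (suc k))) (sym (at-pad μ d k)) (wd k)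

  module _ where
    open Quotient c r Tall

    tall-generator : ∀ α → WD α → length α ≡ r → (∀ p → p < suc j → at α p ≡ suc i) → at α (suc j) ≤ suc j ⊓ suc i →
                     (∀ p → suc j + t ⊓ w ≤ p → at α p ≡ 0) → M (rowA (β α))
    tall-generator α wd len top next bot = resp (λ N f → sym (row-schur α wd N f))
      (generator α wd (strip-partition α wd ,
        rect-⊆ (suc i) (suc j) (strip α) (λ k k<j → ℕₚ.≤-reflexive (sym (≡.trans (at-strip α wd k) (top k k<j)))) , upper))
      where
      upper′ : ∀ k → at α k ≤ at (rect (suc i) (suc j) ++ rect b a) k
      upper′ k with k ℕ.<? suc j | k ∸ suc j ℕ.<? a
      ... | yes k<j | _ = ℕₚ.≤-reflexive (≡.trans (top k k<j) (sym (at-rect-++-< (suc i) (suc j) _ k k<j)))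
      ... | no k≥j | yes k<a = ℕₚ.≤-trans (at-mono {α} wd (ℕₚ.≮⇒≥ k≥j)) (ℕₚ.≤-trans next (ℕₚ.≤-reflexive
              (≡.trans (ℕₚ.⊓-comm (suc j) (suc i)) (sym (≡.trans (at-rect-++-≥ (suc i) (suc j) _ k (ℕₚ.≮⇒≥ k≥j)) (at-rect-< b a _ k<a))))))
      ... | no k≥j | no k≥a = ℕₚ.≤-trans (ℕₚ.≤-reflexive (bot k (ℕₚ.≤-trans
              (ℕₚ.+-monoʳ-≤ (suc j) (ℕₚ.≤-trans (ℕₚ.≤-reflexive (ℕₚ.⊓-comm t w)) (ℕₚ.≮⇒≥ k≥a)))
              (ℕₚ.≤-reflexive (ℕₚ.m+[n∸m]≡n (ℕₚ.≮⇒≥ k≥j)))))) z≤n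
      upper : strip α ⊆ₚ (rect (suc i) (suc j) ++ rect b a)
      upper k = ℕₚ.≤-trans (ℕₚ.≤-reflexive (at-strip α wd k)) (upper′ k)

    tall-generates : GeneratesJ r n (suc i) (suc j) Tall
    tall-generates = generates r n (suc i) (suc j) Tall (λ _ g → proj₁ (proj₂ g)) mem
      where
      open Generation cols rows M sub mul-col mul-row j i w t c r c≡ r≡ long-col long-row
        (λ α wd _ h → resp (λ N f → sym (col-cc (at α 0) α wd ℕₚ.≤-refl N f))
          (low-row (cc (at α 0) α) (wd-cc (at α 0) α wd ℕₚ.≤-refl) (cc⇐ (at α 0) α wd ℕₚ.≤-refl h)))
        (λ α wd _ h → resp (λ N f → ≡.trans (row-schur (cc r α) (wd-cc r α wd h) N f) (sym (col-cc r α wd h N f))))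
        tall-generator using (generated)
      mem : ∀ μ → IsPartition μ → rect (suc i) (suc j) ⊆ₚ μ → μ ⊆ₚ box r n → M (S μ)
      mem μ (_ , wd) lo hi = resp (λ N f → col-schur c μ wd h N f)
        (generated (cc c μ) (wd-cc c μ wd h) (length-cc c μ wd h) (λ p p< →
          ≤-by-< (λ k k< → cc⇐ c μ wd h (ℕₚ.≤-trans p< (⊆-rect {suc i} {suc j} {μ} lo k k<)))))
        where
        h : at μ 0 ≤ c
        h = ℕₚ.≤-trans (hi 0) (at-rect-≤ c r 0)

theorem4p8 : (r n i j : ℕ) → 1 ≤ r → r < n →
    1 ≤ i → i ≤ n ∸ r → 1 ≤ j → j ≤ r →
    let a = (n ∸ r ∸ i) ⊓ (r ∸ j)
        b = i ⊓ j
    in GeneratesJ r n i j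
         (λ ν → IsPartition ν × rect i j ⊆ₚ ν × ν ⊆ₚ (rect (i + a) b ++ rect i (j ∸ b)))
       ×
       GeneratesJ r n i j
         (λ ν → IsPartition ν × rect i j ⊆ₚ ν × ν ⊆ₚ (rect i j ++ rect b a))
theorem4p8 r n (suc i) (suc j) _ _ _ i≤c _ j≤r = wide-generates r n i j i≤c j≤r , tall-generates r n i j i≤c j≤r
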